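{- There is an absolute constant $C>0$ such that the following holds. Let $g\ge 2$, $\mu_2\ge 0$, and let $\mu=[2^{\mu_2},4g-2]$ or $\mu=[2^{\mu_2},(2g)^2]$. Then any two square-tiled surfaces in $\operatorname{ST}^{hyp}_{Ab}(\mu)$ are connected by a sequence of at most $Cg$ powers of cylinder shears.
   Context: A square-tiled surface on $[n]=\{1,\dots,n\}$ is a triple $\tau=(\tau_R,\tau_G,\tau_B)$ of involutions of $[n]$ (fixed points allowed) such that $\langle\tau_R,\tau_G,\tau_B\rangle$ acts transitively on $[n]$. (Geometrically, $S(\tau)$ is obtained from $n$ right-angled triangles labelled by $[n]$, each with a red horizontal leg, a blue vertical leg and a green hypotenuse, by gluing the colour-$c$ side of triangle $j$ to the colour-$c$ side of triangle $\tau_c(j)$, a side being folded onto itself by a half-turn if $\tau_c(j)=j$.) The dual tricoloured cubic graph $S^*(\tau)$ has vertex set $[n]$, an edge of colour $c$ joining $i\neq j$ for each transposition $(i\,j)$ of $\tau_c$, and a half-edge of colour $c$ at each fixed point of $\tau_c$. Two square-tiled surfaces $\tau,\tau'$ on $[n]$ are isomorphic if $\tau'_c=\sigma\tau_c\sigma^{ -1}$ for all $c$ and some $\sigma\in S_n$. The profile of $\tau$ is $(\mu,k)$ where $\mu=[1^{\mu_1},2^{\mu_2},\dots]$ is the cycle type of $\tau_R\tau_G\tau_B$ ($\mu_i$ cycles of length $i$) and $k$ is the total number of fixed points of $\tau_R,\tau_G,\tau_B$; the genus $g$ satisfies $4g-4=\sum_i\mu_i(i-2)-k$. $\operatorname{ST}(\mu)$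 is the set of isomorphism classes of square-tiled surfaces of profile $(\mu,0)$. $\tau$ is Abelian if there is a partition $[n]=A_+\sqcup A_-$ with $\tau_c(A_+)=A_-$ for each $c\in\{R,G,B\}$ (equivalently no fixed points and $S^*(\tau)$ bipartite); $\operatorname{ST}_{Ab}(\mu)$ denotes the Abelian ones. Shears: for distinct colours $i,j$, an $\{i,j\}$-component is an orbit of $\langle\tau_i,\tau_j\rangle$ (a path or a cycle in $S^*(\tau)$). For such a component $c$, $\operatorname{Shear}_{c,i,j}(\tau)$ is obtained by replacing $\tau_i$ on $c$ by $\tau_j|_c$ and $\tau_j$ on $c$ by $(\tau_j\tau_i\tau_j)|_c$, leaving everything else unchanged. Horizontal cylinders are $\{G,B\}$-components and horizontal cylinder shears are $\operatorname{Shear}_{c,G,B},\operatorname{Shear}_{c,B,G}$ for such $c$; vertical cylinders are $\{R,G\}$-components and vertical cylinder shears are $\operatorname{Shear}_{c,R,G},\operatorname{Shear}_{c,G,R}$. A cylinder shear is a horizontal or vertical one; a power of a cylinder shear is an iterate $\operatorname{Shear}_{c,i,j}^m$, $m\ge1$, along the same component $c$ (which stays a component). Hyperellipticity: an automorphism of $\tau$ is $\alpha\in S_n$ commuting with $\tau_R,\tau_G,\tau_B$. For a subgroup $H$ of automorphisms, the quotient $\tau/H$ is the square-tiled surface whose triangles are the $H$-orbits on $[n]$ with the induced involutions. A square-tiled surface of genus $g\ge2$ is hyperelliptic if it has an automorphism $\alpha$ of order $2$ with $\tau/\langle\alpha\rangle$ of genus $0$ (this $\alpha$ is then unique, the hyperelliptic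 involution). $\operatorname{ST}^{hyp}_{Ab}([2^{\mu_2},4g-2])$ is the set of hyperelliptic elements of $\operatorname{ST}_{Ab}([2^{\mu_2},4g-2])$, and $\operatorname{ST}^{hyp}_{Ab}([2^{\mu_2},(2g)^2])$ is the set of hyperelliptic elements of $\operatorname{ST}_{Ab}([2^{\mu_2},(2g)^2])$ whose hyperelliptic involution exchanges the two cycles of length $2g$ of $\tau_R\tau_G\tau_B$. -}

module Defs where

open import Data.Nat using (ℕ; zero; suc; _+_; _*_; _∸_; _≤_; _<_; _/_)
open import Data.Nat.Properties using (_≟_)
open import Data.Integer as ℤ using (ℤ; +_; -[1+_])
open import Data.Fin using (Fin)
import Data.Fin.Properties as FinP
open import Data.List using (List; []; _∷_; filter; length; foldr; map; upTo)
open import Data.List.Relation.Unary.All using (All)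
open import Data.Product using (Σ; ∃; ∃-syntax; Σ-syntax; _×_; _,_)
open import Data.Sum using (_⊎_)
open import Data.Bool using (Bool; not)
open import Data.Vec.Functional using (Vector)
open import Data.List using () renaming (length to len)
open import Data.Fin.Base using () 
open import Data.List.Base using (allFin)
open import Relation.Nullary using (¬_; Dec; yes; no)
open import Relation.Binary.PropositionalEquality using (_≡_; _≢_)
open import Function.Bundles using (_⇔_)

data Colour : Set where
  R G B : Colour

Tri : ℕ → Set
Tri n = Colour → Fin n → Fin n

module _ {n : ℕ} where

  act : Tri n → List Colour → Fin n → Fin n
  act τ []       x = x
  act τ (c ∷ w)  x = τ c (act τ w x)

  IsSTS : Tri n → Set
  IsSTS τ = (∀ c x → τ c (τ c x) ≡ x)
          × (∀ x y → ∃[ w ] act τ w x ≡ y)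

  prod : Tri n → Fin n → Fin n
  prod τ x = τ R (τ G (τ B x))

  fixCount : Tri n → ℕ
  fixCount τ = nfix R + nfix G + nfix B
    where
    nfix : Colour → ℕ
    nfix c = length (filter (λ x → τ c x FinP.≟ x) (allFin n))

  iter : (Fin n → Fin n) → ℕ → Fin n → Fin n
  iter p zero    x = x
  iter p (suc k) x = p (iter p k x)

  -- length of the cycle of x under a permutation p of Fin n:
  -- the least m with 1 ≤ m ≤ n and p^m x = x (searched with fuel n,
  -- which suffices for a permutation of an n-element set)
  orbitLen : (Fin n → Fin n) → Fin n → ℕ
  orbitLen p x = go 1 (p x) n
    where
    go : ℕ → Fin n → ℕ → ℕ
    go m y zero     = m
    go m y (suc f) with y FinP.≟ x
    ... | yes _ = m
    ... | no  _ = go (suc m) (p y) f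

  pointsOnCycles : (Fin n → Fin n) → ℕ → ℕ
  pointsOnCycles p i = length (filter (λ x → orbitLen p x ≟ i) (allFin n))

  cycCount : (Fin n → Fin n) → ℕ → ℕ
  cycCount p zero    = 0
  cycCount p (suc j) = pointsOnCycles p (suc j) / suc j

  HasCycleType : (Fin n → Fin n) → (ℕ → ℕ) → Set
  HasCycleType p μ = ∀ i → pointsOnCycles p i ≡ i * μ i

  euler : Tri n → ℤ
  euler τ = foldr ℤ._+_ (+ 0)
              (map (λ j → (+ cycCount (prod τ) (suc j)) ℤ.* ((+ suc j) ℤ.- + 2))
                   (upTo n))
            ℤ.- + fixCount τ

  HasGenus : Tri n → ℕ → Set
  HasGenus τ g = euler τ ≡ (+ (4 * g)) ℤ.- + 4

module _ {n : ℕ} where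

  NoFix : Tri n → Set
  NoFix τ = ∀ c x → τ c x ≢ x

  -- Abelian: a partition [n] = A₊ ⊔ A₋ (A₊ = {x | A x = true})
  -- with τ_c(A₊) = A₋ for each colour c
  IsAbelian : Tri n → Set
  IsAbelian τ = Σ[ A ∈ (Fin n → Bool) ] ∀ c x → A (τ c x) ≡ not (A x)

  IsAut : Tri n → (Fin n → Fin n) → Set
  IsAut τ α = (Σ[ β ∈ (Fin n → Fin n) ] (∀ x → β (α x) ≡ x) × (∀ x → α (β x) ≡ x))
            × (∀ c x → α (τ c x) ≡ τ c (α x))

  Order2 : (Fin n → Fin n) → Set
  Order2 α = (∀ x → α (α x) ≡ x) × (Σ[ x ∈ Fin n ] α x ≢ x)

  -- ρ on Fin m, together with π, is the quotient τ/⟨α⟩: π identifies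
  -- Fin m with the set of ⟨α⟩-orbits, and the involutions are induced.
  IsQuotient : Tri n → (Fin n → Fin n) → {m : ℕ} → (Fin n → Fin m) → Tri m → Set
  IsQuotient τ α {m} π ρ =
      (∀ z → ∃[ x ] π x ≡ z)
    × (∀ x y → (π x ≡ π y) ⇔ (y ≡ x ⊎ y ≡ α x))
    × (∀ c x → ρ c (π x) ≡ π (τ c x))

  -- α is a hyperelliptic involution of τ (genus ≥ 2 is assumed separately)
  IsHypInv : Tri n → (Fin n → Fin n) → Set
  IsHypInv τ α = IsAut τ α × Order2 α
               × ∃[ m ] Σ (Fin n → Fin m) λ π → Σ (Tri m) λ ρ →
                   IsQuotient τ α π ρ × HasGenus ρ 0

  Iso : Tri n → Tri n → Set
  Iso τ τ' = Σ[ σ ∈ (Fin n → Fin n) ] Σ[ σ⁻ ∈ (Fin n → Fin n) ] (∀ x → σ⁻ (σ x) ≡ x) × (∀ x → σ (σ⁻ x) ≡ x)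
                 × (∀ c x → τ' c (σ x) ≡ σ (τ c x))

  InComp : Tri n → Colour → Colour → Fin n → Fin n → Set
  InComp τ i j x₀ y = ∃[ w ] All (λ c → c ≡ i ⊎ c ≡ j) w × act τ w x₀ ≡ y

  ShearRel : Tri n → Colour → Colour → Fin n → Tri n → Set
  ShearRel τ i j x₀ τ' = ∀ y →
      (InComp τ i j x₀ y → τ' i y ≡ τ j y × τ' j y ≡ τ j (τ i (τ j y)))
    × (¬ InComp τ i j x₀ y → τ' i y ≡ τ i y × τ' j y ≡ τ j y)
    × (∀ c → c ≢ i → c ≢ j → τ' c y ≡ τ c y)

  -- m-fold iterate of Shear_{c,i,j} along the same component c
  -- (c is the component of x₀, which stays an {i,j}-component)
  data ShearIter (i j : Colour) (x₀ : Fin n) : ℕ → Tri n → Tri n → Set where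
    zero : ∀ {τ} → ShearIter i j x₀ zero τ τ
    step : ∀ {m τ τ' τ''} → ShearIter i j x₀ m τ τ' → ShearRel τ' i j x₀ τ''
         → ShearIter i j x₀ (suc m) τ τ''

  -- the pairs (i,j) giving cylinder shears:
  -- horizontal (G,B),(B,G) and vertical (R,G),(G,R)
  CylPair : Colour → Colour → Set
  CylPair i j = (i ≡ G × j ≡ B) ⊎ (i ≡ B × j ≡ G) ⊎ (i ≡ R × j ≡ G) ⊎ (i ≡ G × j ≡ R)

  CylShearPow : Tri n → Tri n → Set
  CylShearPow τ τ' = ∃[ i ] ∃[ j ] CylPair i j × ∃[ x₀ ] ∃[ m ]
                       1 ≤ m × ShearIter i j x₀ m τ τ'

  data ShearSeq : ℕ → Tri n → Tri n → Set where
    nil  : ∀ {τ} → ShearSeq zero τ τ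
    cons : ∀ {k τ τ' τ''} → CylShearPow τ τ' → ShearSeq k τ' τ''
         → ShearSeq (suc k) τ τ''

μHyp1 : ℕ → ℕ → ℕ → ℕ
μHyp1 g μ₂ i with i ≟ 2 | i ≟ 4 * g ∸ 2
... | yes _ | _     = μ₂
... | no _  | yes _ = 1
... | no _  | no _  = 0

μHyp2 : ℕ → ℕ → ℕ → ℕ
μHyp2 g μ₂ i with i ≟ 2 | i ≟ 2 * g
... | yes _ | _     = μ₂
... | no _  | yes _ = 2
... | no _  | no _  = 0

module _ {n : ℕ} where

  -- τ (labelled representative) lies in ST_Ab(μ): profile (μ,0), Abelian
  InSTAb : (ℕ → ℕ) → Tri n → Set
  InSTAb μ τ = IsSTS τ × HasCycleType (prod τ) μ × NoFix τ × IsAbelian τ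

  InSTHyp1 : ℕ → ℕ → Tri n → Set
  InSTHyp1 g μ₂ τ = InSTAb (μHyp1 g μ₂) τ × ∃[ α ] IsHypInv τ α

  -- ST^hyp_Ab([2^{μ₂}, (2g)^2]): the hyperelliptic involution exchanges
  -- the two cycles of length 2g of τ_R τ_G τ_B
  InSTHyp2 : ℕ → ℕ → Tri n → Set
  InSTHyp2 g μ₂ τ = InSTAb (μHyp2 g μ₂) τ ×
    ∃[ α ] IsHypInv τ α
         × (∀ x → orbitLen (prod τ) x ≡ 2 * g → ∀ k → iter (prod τ) k x ≢ α x)

  -- τ and τ' are connected (as isomorphism classes) by a sequence of at
  -- most L powers of cylinder shears
  ConnectedWithin : ℕ → Tri n → Tri n → Set
  ConnectedWithin L τ τ' = ∃[ k ] ∃[ τ'' ] k ≤ L × ShearSeq k τ τ'' × Iso τ'' τ'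

{-# OPTIONS --safe #-}
module Submission where

-- The quotient by the hyperelliptic involution is a square-tiled sphere t = (r, g, b) with one
-- vertex Z of angle dπ (d = 2g - 1 or 2g), all others of angle π or 2π, and d + 2 poles, a pole
-- being a fixed point of r, g, b or rgb.  The surface is the orientation double cover of t, so it
-- suffices to shear t.  Put T = gb, translation along horizontal strips, and P = rT, rotation about
-- vertices; away from the d directions of Z, r conjugates T to its inverse.  Counting poles shows
-- that every horizontal cylinder bordering Z is folded at its far end, and that a horizontal
-- segment leaving Z with both sides on the same cylinder ends in a pole.  Twisting the folds of two
-- adjacent cylinders makes a vertical line into a path that crosses every T-cycle of the two
-- cylinders once, and one shear along this path joins all these T-cycles into one.  After O(d) such
-- steps there is a single horizontal strip, whose boundary is glued to a star of d segments.
-- Four further moves turn consecutive segments of lengths p, q into 1, p + q - 1, so O(d) moves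
-- reach the star 1, …, 1, m - d + 1, which is unique up to isomorphism.  Moves are reversible.

open import Defs
open import Data.Nat using (ℕ; zero; suc; _+_; _*_; _∸_; _≤_; _<_; z≤n; s≤s; _/_; _%_; _≤?_; _<?_)
open import Data.Nat.Properties using (+-comm; +-assoc; +-suc; +-identityʳ; *-comm; ≤-refl; ≤-trans; ≤-reflexive; ≤-antisym; <-trans; ≤-<-trans; <-≤-trans; n≤1+n; m≤m+n; m≤n+m; m+[n∸m]≡n; m∸n+n≡m; m+n∸m≡n; <⇒≤; <-irrefl; <-cmp; ≤-pred; n<1+n; +-monoʳ-≤; +-monoˡ-≤; +-mono-≤; anyUpTo?; suc-injective; ≰⇒>; <⇒≢; m≤n⇒m<n∨m≡n; *-monoʳ-≤; *-monoˡ-≤; ≮⇒≥; +-cancelˡ-≡; +-cancelˡ-<; +-cancelˡ-≤; m<n⇒m<1+n; _≟_; *-cancelʳ-≡)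
open import Data.Nat.DivMod using (m≡m%n+[m/n]*n; m%n<n; n/1≡n; n/n≡1; 0/n≡0)
open import Data.Nat.Tactic.RingSolver using (solve-∀)
open import Data.Integer as ℤ using (ℤ; +_; -[1+_])
import Data.Integer.Properties as ℤP
open import Data.Integer.Tactic.RingSolver using () renaming (solve-∀ to ℤ-solve-∀)
open import Data.Fin using (Fin; toℕ; fromℕ<) renaming (zero to fzero; suc to fsuc)
import Data.Fin as Fin
import Data.Fin.Properties as FinP
open import Data.Bool using (Bool; true; false; not; if_then_else_)
open import Data.Bool.Properties using (not-involutive; ¬-not; not-¬)
open import Data.Empty using (⊥; ⊥-elim)
open import Data.Product using (Σ; ∃; ∃-syntax; _×_; _,_; proj₁; proj₂)
open import Data.Sum using (_⊎_; inj₁; inj₂; [_,_]′)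
open import Data.List using (List; []; _∷_; length; filter; lookup; foldr; applyUpTo; allFin)
open import Data.List.Properties using (map-upTo)
open import Data.List.Membership.Propositional using (_∈_)
open import Data.List.Membership.Propositional.Properties using (∈-filter⁺; ∈-filter⁻; ∈-allFin; ∈-lookup)
open import Data.List.Relation.Unary.Any using (index)
open import Data.List.Relation.Unary.Any.Properties using (lookup-index)
open import Data.List.Relation.Unary.All as All using (All; []; _∷_)
open import Data.List.Relation.Unary.AllPairs using ([]; _∷_)
open import Data.List.Relation.Unary.Unique.Propositional using (Unique)
open import Data.List.Relation.Unary.Unique.Propositional.Properties using (allFin⁺; filter⁺)
open import Function using (_∘_; id)
open import Function.Bundles using (Equivalence)
open import Relation.Nullary using (¬_; Dec; yes; no)
open import Relation.Nullary.Decidable using (_⊎-dec_; _×-dec_; ¬?; map′; decidable-stable)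
open import Relation.Binary.Definitions using (tri<; tri≈; tri>)
open import Relation.Binary.PropositionalEquality using (_≡_; _≢_; refl; sym; trans; cong; cong₂; subst)

-- The sphere enters through a count. Turn around Z in the order of `P`. A class of `T` met for the
-- first time, the initial one excepted, is entered across a segment whose two sides lie in
-- different classes; the ends of these two sides are two directions of Z, reserved for the two
-- poles at the fold of the new class. A segment folded onto itself has one such direction, reserved
-- for its central pole. With two spare slots for the initial class there are d + 2 slots, no slot
-- takes two poles, and genus 0 supplies d + 2 poles; so every slot is filled. A filled slot is what
-- certifies that a cylinder or a segment is folded.
--
-- The obstacle to joining is a single class that carries all of Z but is not closed under `g`: it
-- bounds one tall folded cylinder and has no second class to be merged with. Then the two
-- directions are exchanged, where the classes of Z can be pulled apart and merged; this gives a
-- single vertical strip, so the exchange is made twice. Hence everything is developed for a `Trip`,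
-- which may be either a surface or its exchange.

-- Iterates and orbits of permutations

least : {P : ℕ → Set} → (∀ k → Dec (P k)) → ∀ n → P n →
        ∃ λ k → P k × (∀ j → j < k → ¬ P j)
least P? zero p = 0 , p , λ _ ()
least {P} P? (suc n) p with P? 0
... | yes p0 = 0 , p0 , λ _ ()
... | no ¬p0 with least {P ∘ suc} (P? ∘ suc) n p
...   | k , pk , below = suc k , pk , λ { zero _ → ¬p0 ; (suc j) (s≤s j<k) → below j j<k }

<⇒offset : ∀ {i j} → i < j → ∃ λ e → i + suc e ≡ j
<⇒offset {i} {j} i<j = j ∸ suc i , trans (+-suc i _) (m+[n∸m]≡n i<j)

≤⇒offset : ∀ {i j} → i ≤ j → ∃ λ e → i + e ≡ j
≤⇒offset {i} {j} i≤j = j ∸ i , m+[n∸m]≡n i≤j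

opaque
  parity : ∀ i → (∃ λ h → i ≡ h + h) ⊎ (∃ λ h → i ≡ suc (h + h))
  parity zero = inj₁ (0 , refl)
  parity (suc i) with parity i
  ... | inj₁ (h , e) = inj₂ (h , cong suc e)
  ... | inj₂ (h , e) = inj₁ (suc h , trans (cong suc e) (cong suc (sym (+-suc h h))))

double-injective : ∀ {k l} → k + k ≡ l + l → k ≡ l
double-injective {zero}  {zero}  e = refl
double-injective {suc k} {suc l} e =
  cong suc (double-injective (suc-injective (trans (sym (+-suc k k)) (trans (suc-injective e) (+-suc l l)))))

module _ {n : ℕ} where

  iter-+ : ∀ (f : Fin n → Fin n) a b x → iter f (a + b) x ≡ iter f a (iter f b x)
  iter-+ f zero    b x = refl
  iter-+ f (suc a) b x = cong f (iter-+ f a b x)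

  iter-swap : ∀ (f : Fin n → Fin n) a b x → iter f a (iter f b x) ≡ iter f b (iter f a x)
  iter-swap f a b x = trans (sym (iter-+ f a b x)) (trans (cong (λ k → iter f k x) (+-comm a b)) (iter-+ f b a x))

  iter-shift : ∀ (f : Fin n → Fin n) a x → iter f a (f x) ≡ f (iter f a x)
  iter-shift f a x = iter-swap f a 1 x

  iter-cong : ∀ {f h : Fin n → Fin n} → (∀ x → f x ≡ h x) → ∀ k x → iter f k x ≡ iter h k x
  iter-cong e zero    x = refl
  iter-cong {f} e (suc k) x = trans (cong f (iter-cong e k x)) (e _)


  iter-* : ∀ (f : Fin n → Fin n) {x} w → iter f w x ≡ x → ∀ k → iter f (k * w) x ≡ x
  iter-* f w e zero    = refl
  iter-* f w e (suc k) = trans (iter-+ f w (k * w) _) (trans (cong (iter f w) (iter-* f w e k)) e)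

  iter-cancel : ∀ {f h : Fin n → Fin n} → (∀ x → f (h x) ≡ x) → ∀ k x → iter f k (iter h k x) ≡ x
  iter-cancel         e zero    x = refl
  iter-cancel {f} {h} e (suc k) x =
    trans (cong (λ y → f (iter f k y)) (sym (iter-shift h k x)))
          (trans (cong f (iter-cancel e k (h x))) (e x))

  iter-inj : ∀ {f : Fin n → Fin n} → (∀ {x y} → f x ≡ f y → x ≡ y) → ∀ k {x y} → iter f k x ≡ iter f k y → x ≡ y
  iter-inj inj zero    e = e
  iter-inj inj (suc k) e = iter-inj inj k (inj e)

  iter-reflect : ∀ {f h v : Fin n → Fin n} → (∀ x → v (f x) ≡ h (v x)) → ∀ k x → v (iter f k x) ≡ iter h k (v x)
  iter-reflect         e zero    x = refl
  iter-reflect {h = h} e (suc k) x = trans (e _) (cong h (iter-reflect e k x))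

module Orbit {n : ℕ} (f f⁻ : Fin n → Fin n) (ff⁻ : ∀ x → f (f⁻ x) ≡ x) (f⁻f : ∀ x → f⁻ (f x) ≡ x) where

  f-inj : ∀ {x y} → f x ≡ f y → x ≡ y
  f-inj {x} {y} e = trans (sym (f⁻f x)) (trans (cong f⁻ e) (f⁻f y))

  private
    opaque
      returns : ∀ x → ∃ λ e → iter f (suc e) x ≡ x
      returns x with FinP.pigeonhole (n<1+n n) (λ i → iter f (toℕ i) x)
      ... | i , j , i<j , eq with <⇒offset i<j
      ...   | e , i+e = e , sym (iter-inj f-inj (toℕ i)
                         (trans eq (trans (cong (λ k → iter f k x) (sym i+e)) (iter-+ f (toℕ i) (suc e) x))))

      leastReturn : ∀ x → ∃ λ k → iter f (suc k) x ≡ x × (∀ j → j < k → iter f (suc j) x ≢ x)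
      leastReturn x = least (λ k → iter f (suc k) x FinP.≟ x) (proj₁ (returns x)) (proj₂ (returns x))

  -- the period of x is suc (per x)
  per : Fin n → ℕ
  per x = proj₁ (leastReturn x)

  per-ret : ∀ x → iter f (suc (per x)) x ≡ x
  per-ret x = proj₁ (proj₂ (leastReturn x))

  per-min : ∀ x j → j < per x → iter f (suc j) x ≢ x
  per-min x = proj₂ (proj₂ (leastReturn x))

  infix 4 _~_
  _~_ : Fin n → Fin n → Set
  x ~ y = ∃ λ k → iter f k x ≡ y

  ~-refl : ∀ {x} → x ~ x
  ~-refl = 0 , refl

  ~-trans : ∀ {x y z} → x ~ y → y ~ z → x ~ z
  ~-trans (k , e) (l , e') = l + k , trans (iter-+ f l k _) (trans (cong (iter f l) e) e')

  ~-≡ : ∀ {x y} → x ≡ y → x ~ y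
  ~-≡ refl = ~-refl

  ~-cast : ∀ {x y x' y'} → x ≡ x' → y ≡ y' → x ~ y → x' ~ y'
  ~-cast refl refl p = p

  ~-step : ∀ {x} → x ~ f x
  ~-step = 1 , refl

  ~-iter : ∀ {x} k → x ~ iter f k x
  ~-iter k = k , refl

  opaque
    ~-short : ∀ {x y} → x ~ y → ∃ λ k → k < suc (per x) × iter f k x ≡ y
    ~-short {x} (k , e) = k % suc (per x) , m%n<n k (suc (per x)) , trans (sym eq) e
      where
      eq : iter f k x ≡ iter f (k % suc (per x)) x
      eq = trans (cong (λ a → iter f a x) (m≡m%n+[m/n]*n k (suc (per x))))
            (trans (iter-+ f (k % suc (per x)) _ x)
                   (cong (iter f (k % suc (per x))) (iter-* f (suc (per x)) (per-ret x) (k / suc (per x)))))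

  opaque
    ~-sym : ∀ {x y} → x ~ y → y ~ x
    ~-sym {x} {y} p with ~-short p
    ... | k , k<w , refl with ≤⇒offset (<⇒≤ k<w)
    ...   | e , k+e = e , trans (sym (iter-+ f e k x))
                       (trans (cong (λ a → iter f a x) (trans (+-comm e k) k+e)) (per-ret x))

  opaque
    ~-dec : ∀ x y → Dec (x ~ y)
    ~-dec x y = map′ (λ { (k , _ , e) → k , e }) ~-short (anyUpTo? (λ k → iter f k x FinP.≟ y) (suc (per x)))

  private
    iter-clash : ∀ x {i j} → i < j → j < suc (per x) → iter f i x ≢ iter f j x
    iter-clash x {i} i<j (s≤s j≤) e with <⇒offset i<j
    ... | a , refl = per-min x a (<-≤-trans (<-≤-trans (n<1+n a) (m≤n+m (suc a) i)) j≤)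
                       (sym (iter-inj f-inj i (trans e (iter-+ f i (suc a) x))))

  opaque
    iter-uniq : ∀ x {i j} → i < suc (per x) → j < suc (per x) → iter f i x ≡ iter f j x → i ≡ j
    iter-uniq x {i} {j} i< j< e with <-cmp i j
    ... | tri≈ _ i≡j _ = i≡j
    ... | tri< i<j _ _ = ⊥-elim (iter-clash x i<j j< e)
    ... | tri> _ _ j<i = ⊥-elim (iter-clash x j<i i< (sym e))

  opaque
    -- A position doubled stays below two periods, so a congruence between positions has just two
    -- readings. They become the two centres of a reflection of a cycle.
    iter-wrap : ∀ u {a j} → a < suc (per u) + suc (per u) → j < suc (per u) → iter f a u ≡ iter f j u →
                a ≡ j ⊎ a ≡ j + suc (per u)
    iter-wrap u {a} {j} a<2w j<w e with a <? suc (per u)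
    ... | yes a<w = inj₁ (iter-uniq u a<w j<w e)
    ... | no a≮w with ≤⇒offset (≮⇒≥ a≮w)
    ...   | a' , refl = inj₂ (trans (+-comm (suc (per u)) a') (cong (_+ suc (per u))
             (iter-uniq u (+-cancelˡ-< (suc (per u)) a' (suc (per u)) a<2w) j<w
               (trans (trans (cong (iter f a') (sym (per-ret u))) (trans (sym (iter-+ f a' (suc (per u)) u)) (cong (λ k → iter f k u) (+-comm a' _)))) e))))

  opaque
    per-unique : ∀ x e → iter f (suc e) x ≡ x → (∀ j → j < e → iter f (suc j) x ≢ x) → per x ≡ e
    per-unique x e ret mn with <-cmp (per x) e
    ... | tri≈ _ q _ = q
    ... | tri< l _ _ = ⊥-elim (mn (per x) l (per-ret x))
    ... | tri> _ _ l = ⊥-elim (per-min x e l ret)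

  ff⁻k : ∀ k x → iter f k (iter f⁻ k x) ≡ x
  ff⁻k = iter-cancel ff⁻

  f⁻fk : ∀ k x → iter f⁻ k (iter f k x) ≡ x
  f⁻fk = iter-cancel f⁻f

  ~-iter⁻ : ∀ {x} k → x ~ iter f⁻ k x
  ~-iter⁻ {x} k = ~-sym (k , ff⁻k k x)

  ~-step⁻ : ∀ {x} → x ~ f⁻ x
  ~-step⁻ = ~-iter⁻ 1

  opaque
    ~-back : ∀ {x y} → x ~ y → ∃ λ k → iter f⁻ k x ≡ y
    ~-back p with ~-sym p
    ... | k , refl = k , f⁻fk k _


  per-ret-~ : ∀ {x y} → x ~ y → iter f (suc (per x)) y ≡ y
  per-ret-~ {x} (k , refl) = trans (iter-swap f (suc (per x)) k x) (cong (iter f k) (per-ret x))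

  -- Shears come in positive powers only: `per x * s` further steps complete `s` full turns, and
  -- this is how a twist is undone by another twist.
  per-mult : ∀ {x y} → x ~ y → ∀ s → iter f s (iter f (per x * s) y) ≡ y
  per-mult {x} {y} p s = trans (sym (iter-+ f s (per x * s) y))
    (trans (cong (λ k → iter f k y) (*-comm (suc (per x)) s)) (iter-* f (suc (per x)) (per-ret-~ p) s))


  forward-as-back : ∀ {x y} → x ~ y → ∀ s → iter f s y ≡ iter f⁻ (per x * s) y
  forward-as-back {x} {y} p s = trans (sym (f⁻fk (per x * s) _))
    (cong (iter f⁻ (per x * s)) (trans (iter-swap f (per x * s) s y) (per-mult p s)))

-- The involutions τ_R, τ_G, τ_B of a square-tiled surface, or the same with R and B interchanged,
-- which exchanges the horizontal and the vertical direction.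
record Trip (m : ℕ) : Set where
  constructor trip
  field
    r g b : Fin m → Fin m

swapRB : ∀ {m} → Trip m → Trip m
swapRB (trip r g b) = trip b g r

record Inv {m} (t : Trip m) : Set where
  constructor inv
  open Trip t
  field
    rr : ∀ x → r (r x) ≡ x
    gg : ∀ x → g (g x) ≡ x
    bb : ∀ x → b (b x) ≡ x

inv-swap : ∀ {m} {t : Trip m} → Inv t → Inv (swapRB t)
inv-swap (inv rr gg bb) = inv bb gg rr

data Tag : Set where
  tR tP tG tB : Tag

Fix : ∀ {m} → Trip m → Tag → Fin m → Set
Fix t tR x = Trip.r t x ≡ x
Fix t tP x = Trip.r t (Trip.g t (Trip.b t x)) ≡ x
Fix t tG x = Trip.g t x ≡ x
Fix t tB x = Trip.b t x ≡ x

-- Only a lower bound on the number of poles is recorded. The slots of the counting argument provide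
-- the matching upper bound.
Enum : ∀ {m} → ℕ → (Tag → Fin m → Set) → Set
Enum {m} N F = Σ (Fin N → Tag × Fin m) λ ψ →
    (∀ {i j} → ψ i ≡ ψ j → i ≡ j) × (∀ i → F (proj₁ (ψ i)) (proj₂ (ψ i)))

-- Horizontal classes, vertical columns and folded cylinders

module Alg {m : ℕ} (t : Trip m) (I : Inv t) where
  open Trip t public
  open Inv I public

  T T⁻ P P⁻ : Fin m → Fin m
  T x = g (b x)
  T⁻ x = b (g x)
  P x = r (T x)
  P⁻ x = T⁻ (r x)

  TT⁻ : ∀ x → T (T⁻ x) ≡ x
  TT⁻ x = trans (cong g (bb (g x))) (gg x)

  T⁻T : ∀ x → T⁻ (T x) ≡ x
  T⁻T x = trans (cong b (gg (b x))) (bb x)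

  PP⁻ : ∀ x → P (P⁻ x) ≡ x
  PP⁻ x = trans (cong r (TT⁻ (r x))) (rr x)

  P⁻P : ∀ x → P⁻ (P x) ≡ x
  P⁻P x = trans (cong T⁻ (rr (T x))) (T⁻T x)

  open Orbit T T⁻ TT⁻ T⁻T public

  gT≡b : ∀ x → g (T x) ≡ b x
  gT≡b x = gg (b x)

  gT : ∀ x → g (T x) ≡ T⁻ (g x)
  gT x = trans (gg (b x)) (cong b (sym (gg x)))

  gTk : ∀ k x → g (iter T k x) ≡ iter T⁻ k (g x)
  gTk = iter-reflect gT

  bTk : ∀ k x → b (iter T k x) ≡ iter T⁻ k (b x)
  bTk = iter-reflect (λ _ → refl)

  P-inj : ∀ {x y} → P x ≡ P y → x ≡ y
  P-inj {x} {y} e = trans (sym (P⁻P x)) (trans (cong P⁻ e) (P⁻P y))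


  g-inj : ∀ {x y} → g x ≡ g y → x ≡ y
  g-inj {x} {y} e = trans (sym (gg x)) (trans (cong g e) (gg y))

  rP : ∀ x → r (P x) ≡ T x
  rP x = rr (T x)

  opaque
    g-cong : ∀ {x y} → x ~ y → g x ~ g y
    g-cong {x} (k , refl) = subst (g x ~_) (sym (gTk k x)) (~-iter⁻ k)

  opaque
    gb~ : ∀ x → g x ~ b x
    gb~ x = subst (g x ~_) (cong b (gg x)) ~-step⁻


  -- the vertex of x has angle at least 3π
  InZ : Fin m → Set
  InZ x = P (P x) ≢ x

  InZ? : ∀ x → Dec (InZ x)
  InZ? x = ¬? (P (P x) FinP.≟ x)

  InZ-P : ∀ {x} → InZ x → InZ (P x)
  InZ-P z e = z (P-inj e)

  InZ-P⁻ : ∀ {x} → InZ x → InZ (P⁻ x)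
  InZ-P⁻ {x} z e = z (trans (cong (P ∘ P) (sym (PP⁻ x))) (trans (cong P e) (PP⁻ x)))

  ¬InZ : ∀ {x} → ¬ InZ x → P (P x) ≡ x
  ¬InZ {x} = decidable-stable (P (P x) FinP.≟ x)

  -- As a corner, `x` lies between the red edges `x` and `T x`. Around a vertex of angle π or 2π the
  -- two sides of the red line run in opposite directions, so `r` takes the next edge to the
  -- previous one.
  rT : ∀ {x} → ¬ InZ x → r (T x) ≡ T⁻ (r x)
  rT {x} ¬z = trans (sym (T⁻T _)) (cong T⁻ (trans (sym (rr _)) (cong r (¬InZ ¬z))))

  r-run : ∀ k x → (∀ i → i < k → ¬ InZ (iter T i x)) → r (iter T k x) ≡ iter T⁻ k (r x)
  r-run zero    x fr = refl
  r-run (suc k) x fr = trans (rT (fr k ≤-refl)) (cong T⁻ (r-run k x (λ i i<k → fr i (m<n⇒m<1+n i<k))))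

  -- A class of `T` is a boundary circle of a strip of height one. If Z is not on it, `r` glues the
  -- whole circle by reversing it, and the flat cylinder continues beyond.
  ZC : Fin m → Set
  ZC x = ∃ λ y → x ~ y × InZ y

  opaque
    ZC? : ∀ x → Dec (ZC x)
    ZC? x = FinP.any? (λ y → ~-dec x y ×-dec InZ? y)

  InZ⇒ZC : ∀ {x} → InZ x → ZC x
  InZ⇒ZC z = _ , ~-refl , z

  opaque
    ZC-~ : ∀ {x y} → x ~ y → ZC x → ZC y
    ZC-~ p (w , q , z) = w , ~-trans (~-sym p) q , z

  opaque
    ¬ZC-~ : ∀ {x y} → x ~ y → ¬ ZC x → ¬ ZC y
    ¬ZC-~ p nz zc = nz (ZC-~ (~-sym p) zc)

  rTk : ∀ {x} → ¬ ZC x → ∀ k → r (iter T k x) ≡ iter T⁻ k (r x)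
  rTk {x} nz k = r-run k x (λ i _ z → nz (_ , ~-iter i , z))

  opaque
    r-cong : ∀ {x y} → ¬ ZC x → x ~ y → r x ~ r y
    r-cong {x} nz (k , refl) = subst (r x ~_) (sym (rTk nz k)) (~-iter⁻ k)

  opaque
    -- For a direction `y` of Z in the class of `r x`, `P⁻ y = T⁻ (r y)` is again a direction of Z,
    -- and it lies in the class of `x`.
    r-free : ∀ {x} → ¬ ZC x → ¬ ZC (r x)
    r-free {x} nz (y , p , z) with ~-back p
    ... | k , refl = nz (_ , ~-trans (~-iter k) (subst (λ w → iter T k x ~ T⁻ w) eq ~-step⁻) , InZ-P⁻ z)
      where
      eq : iter T k x ≡ r (iter T⁻ k (r x))
      eq = trans (sym (rr _)) (cong r (rTk nz k))

  opaque
    r-ZC : ∀ {x} → ZC x → ZC (r x)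
    r-ZC {x} zc with ZC? (r x)
    ... | yes zr = zr
    ... | no nzr = ⊥-elim (r-free nzr (subst ZC (sym (rr x)) zc))

  -- c k alternates g, r, g, r, …; col x follows the vertical line through x
  c : ℕ → Fin m → Fin m
  c 0 = g
  c 1 = r
  c (suc (suc k)) = c k

  col : Fin m → ℕ → Fin m
  col x zero    = x
  col x (suc k) = c k (col x k)

  cc : ∀ k x → c k (c k x) ≡ x
  cc 0 = gg
  cc 1 = rr
  cc (suc (suc k)) = cc k

  c-inj : ∀ k {x y} → c k x ≡ c k y → x ≡ y
  c-inj k {x} {y} e = trans (sym (cc k x)) (trans (cong (c k) e) (cc k y))

  c-kind : ∀ k → (∀ x → c k x ≡ g x) ⊎ (1 ≤ k × ∀ x → c k x ≡ r x)
  c-kind 0 = inj₁ (λ _ → refl)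
  c-kind 1 = inj₂ (≤-refl , λ _ → refl)
  c-kind (suc (suc k)) with c-kind k
  ... | inj₁ e = inj₁ e
  ... | inj₂ (_ , e) = inj₂ (s≤s z≤n , e)

  c-swap : ∀ i j k → i + j ≡ k + k → ∀ x → c i x ≡ c j x
  c-swap 0 j k refl x = sym (c-even k x)
    where
    c-even : ∀ k x → c (k + k) x ≡ g x
    c-even zero    x = refl
    c-even (suc k) x rewrite +-suc k k = c-even k x
  c-swap 1 j (suc k) e x rewrite trans (suc-injective e) (+-suc k k) = sym (c-odd k x)
    where
    c-odd : ∀ k x → c (suc (k + k)) x ≡ r x
    c-odd zero    x = refl
    c-odd (suc k) x rewrite +-suc k k = c-odd k x
  c-swap (suc (suc i)) j (suc k) e x =
    c-swap i j k (suc-injective (trans (suc-injective e) (+-suc k k))) x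

  opaque
    c-cong : ∀ k {x y} → (1 ≤ k → ¬ ZC x) → x ~ y → c k x ~ c k y
    c-cong k {x} {y} nz p with c-kind k
    ... | inj₁ e rewrite e x | e y = g-cong p
    ... | inj₂ (1≤k , e) rewrite e x | e y = r-cong (nz 1≤k) p

  c-run : ∀ k {x} → (1 ≤ k → ¬ ZC x) → ∀ i → c k (iter T i x) ≡ iter T⁻ i (c k x)
  c-run k {x} nz i with c-kind k
  ... | inj₁ e rewrite e x | e (iter T i x) = gTk i x
  ... | inj₂ (1≤k , e) rewrite e x | e (iter T i x) = rTk (nz 1≤k) i

  opaque
    col-cong : ∀ {x y} n → x ~ y → (∀ j → 1 ≤ j → j < n → ¬ ZC (col x j)) → col x n ~ col y n
    col-cong zero    p fr = p
    col-cong (suc n) p fr = c-cong n (λ 1≤n → fr n 1≤n ≤-refl)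
      (col-cong n p (λ j 1≤j j<n → fr j 1≤j (m<n⇒m<1+n j<n)))

  -- Every column starts with `g`. Restarted at an odd height it therefore retraces its steps
  -- downwards; restarted at an even height it continues upwards, as in `col-up`.
  col-down : ∀ x i h → i ≡ suc (h + h) → ∀ j l → j + l ≡ i → col (col x i) j ≡ col x l
  col-down x i h e zero l refl = refl
  col-down x i h e (suc j) l j+l = trans (cong (c j) (col-down x i h e j (suc l) (trans (+-suc j l) j+l)))
    (trans (c-swap j l h (suc-injective (trans j+l e)) _) (cc l (col x l)))

  col-up : ∀ x i h → i ≡ h + h → ∀ j → col (col x i) j ≡ col x (j + i)
  col-up x i h e zero = refl
  col-up x i h e (suc j) = trans (cong (c j) (col-up x i h e j))
    (c-swap j (j + i) (j + h) (trans (cong (λ a → j + (j + a)) e) (lem j h)) _)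
    where
    lem : ∀ j h → j + (j + (h + h)) ≡ j + h + (j + h)
    lem j h = trans (cong (λ n → j + n) (trans (sym (+-assoc j h h)) (trans (cong (_+ h) (+-comm j h)) (+-assoc h j h)))) (sym (+-assoc j h (j + h)))

  -- n is the first positive height at which the column over x is again in a class meeting Z
  Fst : Fin m → ℕ → Set
  Fst x n = 1 ≤ n × ZC (col x n) × (∀ j → 1 ≤ j → j < n → ¬ ZC (col x j))

  opaque
    Fst-uniq : ∀ {x y n n'} → x ~ y → Fst x n → Fst y n' → n ≡ n'
    Fst-uniq {x} {y} {n} {n'} p (1≤n , zn , fr) (1≤n' , zn' , fr') with <-cmp n n'
    ... | tri≈ _ e _ = e
    ... | tri< n<n' _ _ = ⊥-elim (fr' n 1≤n n<n' (ZC-~ (col-cong n p fr) zn))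
    ... | tri> _ _ n'<n = ⊥-elim (fr n' 1≤n' n'<n (ZC-~ (col-cong n' (~-sym p) fr') zn'))

  opaque
    -- An `r`-step leads from a class free of Z to a class free of Z, so the first arrival at Z is
    -- made by a `g`-step.
    Fst-odd : ∀ {x n} → Fst x n → ∃ λ k → n ≡ suc (k + k)
    Fst-odd {x} {n} (1≤n , zn , fr) with parity n
    ... | inj₂ o = o
    Fst-odd {x} {.(suc (h + suc h))} (1≤n , zn , fr) | inj₁ (suc h , refl) =
      ⊥-elim (r-free (fr (h + suc h) (≤-trans (s≤s z≤n) (m≤n+m (suc h) h)) ≤-refl)
        (subst ZC (c-swap (h + suc h) 1 (suc h) (trans (+-comm _ 1) refl) _) zn))

  -- The column turns between heights `k` and `k + 1`, by `g` when `k` is even and by `r` when `k`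
  -- is odd. The heights up to `k + k` belong to the way up and the way back inside one cylinder.
  record Fold (x : Fin m) (k : ℕ) : Set where
    constructor fold
    field
      free : ∀ j → 1 ≤ j → j ≤ k + k → ¬ ZC (col x j)
      home : col x (suc (k + k)) ~ x
      turn : col x (suc k) ~ col x k

    free≤ : ∀ j → 1 ≤ j → j ≤ k → ¬ ZC (col x j)
    free≤ j 1≤j j≤k = free j 1≤j (≤-trans j≤k (m≤m+n k k))

  -- past the turning point the column runs back through the same classes
  opaque
    col-return : ∀ x k → (∀ j → 1 ≤ j → j ≤ k → ¬ ZC (col x j)) → col x (suc k) ~ col x k →
                 ∀ j i → i + j ≡ k → col x (j + suc k) ~ col x i
    col-return x k fr tn zero i e rewrite trans (sym (+-identityʳ i)) e = tn
    col-return x k fr tn (suc j) i e =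
      ~-trans (~-sym (c-cong (j + suc k) (λ _ → fr (suc i) (s≤s z≤n) (subst (suc i ≤_) e' (m≤m+n (suc i) j))) (~-sym IH)))
              (~-≡ (trans (c-swap (j + suc k) i k (trans (cong (_+ i) (+-suc j k)) (trans (+-comm (suc (j + k)) i) (trans (+-suc i (j + k)) (trans (cong suc (sym (+-assoc i j k))) (cong (_+ k) e'))))) _) (cc i _)))
      where
      e' : suc i + j ≡ k
      e' = trans (sym (+-suc i j)) e
      IH : col x (j + suc k) ~ col x (suc i)
      IH = col-return x k fr tn j (suc i) e'

  opaque
    turn⇒Fold : ∀ x k → (∀ j → 1 ≤ j → j ≤ k → ¬ ZC (col x j)) → col x (suc k) ~ col x k → Fold x k
    turn⇒Fold x k fr tn = fold free (subst (λ a → col x a ~ x) (+-suc k k) (col-return x k fr tn k 0 refl)) tn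
      where
      free : ∀ j → 1 ≤ j → j ≤ k + k → ¬ ZC (col x j)
      free j 1≤j j≤2k with j ≤? k
      ... | yes j≤k = fr j 1≤j j≤k
      ... | no j≰k with <⇒offset (≰⇒> j≰k)
      ...   | e , refl with <⇒offset {e} {k} (+-cancelˡ-≤ k (suc e) k j≤2k)
      ...     | i , e+i = ¬ZC-~ (~-sym (subst (λ a → col x a ~ col x (suc i)) (trans (+-suc e k) (trans (cong suc (+-comm e k)) (sym (+-suc k e))))
                                  (col-return x k fr tn e (suc i) (trans (+-comm (suc i) e) e+i))))
                            (fr (suc i) (s≤s z≤n) (≤-trans (m≤n+m (suc i) e) (≤-reflexive e+i)))


  opaque
    Fold⇒Fst : ∀ {x k} → ZC x → Fold x k → Fst x (suc (k + k))
    Fold⇒Fst zc F = s≤s z≤n , ZC-~ (~-sym (Fold.home F)) zc , λ { j 1≤j (s≤s j≤) → Fold.free F j 1≤j j≤ }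

  opaque
    Fold-uniq : ∀ {x y k l} → ZC x → x ~ y → Fold x k → Fold y l → k ≡ l
    Fold-uniq {k = k} {l} zc p F F' = double-injective (suc-injective (Fst-uniq p (Fold⇒Fst zc F) (Fold⇒Fst (ZC-~ p zc) F')))

  opaque
    Fold-~ : ∀ {x y k} → x ~ y → Fold x k → Fold y k
    Fold-~ {x} {y} {k} p F = fold fr (~-trans (~-sym (cg (suc (k + k)) ≤-refl)) (~-trans (Fold.home F) p))
        (~-trans (~-sym (cg (suc k) (s≤s (m≤m+n k k)))) (~-trans (Fold.turn F) (cg k (≤-trans (m≤m+n k k) (n≤1+n _)))))
      where
      cg : ∀ j → j ≤ suc (k + k) → col x j ~ col y j
      cg j j≤ = col-cong j p (λ i 1≤i i<j → Fold.free F i 1≤i (≤-pred (≤-trans i<j j≤)))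
      fr : ∀ j → 1 ≤ j → j ≤ k + k → ¬ ZC (col y j)
      fr j 1≤j j≤ = ¬ZC-~ (cg j (≤-trans j≤ (n≤1+n _))) (Fold.free F j 1≤j j≤)

  -- The distance to Z, going along g first, tells the levels of a folded column apart.
  record Level (x : Fin m) (k i : ℕ) : Set where
    constructor level
    field
      n    : ℕ
      fst  : Fst (col x i) n
      land : col (col x i) n ~ x
      size : ((∃ λ h → i ≡ suc (h + h)) × n ≡ i) ⊎ ((∃ λ h → i ≡ h + h) × n + i ≡ suc (k + k))

  opaque
    Fold⇒Level : ∀ {x k} → ZC x → Fold x k → ∀ i → i ≤ k → Level x k i
    Fold⇒Level {x} {k} zc F i i≤k with parity i
    ... | inj₂ (h , e) = level i (subst (1 ≤_) (sym e) (s≤s z≤n) , subst ZC (sym (col-down x i h e i 0 (+-identityʳ i))) zc , fr)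
                           (~-≡ (col-down x i h e i 0 (+-identityʳ i))) (inj₁ ((h , e) , refl))
      where
      fr : ∀ j → 1 ≤ j → j < i → ¬ ZC (col (col x i) j)
      fr j 1≤j j<i with <⇒offset j<i
      ... | l , j+l = subst (¬_ ∘ ZC) (sym (col-down x i h e j (suc l) j+l))
                        (Fold.free≤ F (suc l) (s≤s z≤n) (≤-trans (subst (suc l ≤_) j+l (m≤n+m (suc l) j)) i≤k))
    ... | inj₁ (h , e) with ≤⇒offset (≤-trans i≤k (≤-trans (m≤m+n k k) (n≤1+n (k + k))))
    ...   | n , i+n = level n (1≤n , subst ZC (sym land) (ZC-~ (~-sym (Fold.home F)) zc) , fr)
                           (~-trans (~-≡ land) (Fold.home F)) (inj₂ ((h , e) , trans (+-comm n i) i+n))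
      where
      land : col (col x i) n ≡ col x (suc (k + k))
      land = trans (col-up x i h e n) (cong (col x) (trans (+-comm n i) i+n))
      pos : ∀ n → i + n ≡ suc (k + k) → 1 ≤ n
      pos (suc _) _ = s≤s z≤n
      pos zero    q = ⊥-elim (<-irrefl (trans (sym (+-identityʳ i)) q) (s≤s (≤-trans i≤k (m≤m+n k k))))
      1≤n : 1 ≤ n
      1≤n = pos n i+n
      fr : ∀ j → 1 ≤ j → j < n → ¬ ZC (col (col x i) j)
      fr j 1≤j j<n = subst (¬_ ∘ ZC) (sym (col-up x i h e j))
        (Fold.free F (j + i) (≤-trans 1≤j (m≤m+n j i)) (≤-pred (subst (suc (j + i) ≤_) (trans (+-comm n i) i+n) (+-monoˡ-≤ i j<n))))

  opaque
    Fold-distinct : ∀ {x k} → ZC x → Fold x k → ∀ {i j} → i ≤ k → j ≤ k → col x i ~ col x j → i ≡ j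
    Fold-distinct {x} {k} zc F {i} {j} i≤k j≤k p with Fold⇒Level zc F i i≤k | Fold⇒Level zc F j j≤k
    ... | level n f _ s | level n' f' _ s' with Fst-uniq p f f'
    Fold-distinct zc F i≤k j≤k p | level n f _ (inj₁ (_ , refl)) | level n' f' _ (inj₁ (_ , refl)) | e = e
    Fold-distinct {k = k} zc F {i} {j} i≤k j≤k p | level n f _ (inj₁ (_ , refl)) | level .n f' _ (inj₂ (_ , q)) | refl =
      ⊥-elim (<-irrefl q (s≤s (+-mono-≤ i≤k j≤k)))
    Fold-distinct {k = k} zc F {i} {j} i≤k j≤k p | level n f _ (inj₂ (_ , q)) | level .n f' _ (inj₁ (_ , refl)) | refl =
      ⊥-elim (<-irrefl q (s≤s (+-mono-≤ j≤k i≤k)))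
    Fold-distinct zc F i≤k j≤k p | level n f _ (inj₂ (_ , q)) | level .n f' _ (inj₂ (_ , q')) | refl =
      +-cancelˡ-≡ n _ _ (trans q (sym q'))

  opaque
    -- From any level the first arrival at Z is in the class where the column started. A level
    -- common to both columns would thus identify the two starting classes.
    Fold-apart : ∀ {x y k l} → ZC x → ZC y → Fold x k → Fold y l → ¬ x ~ y →
                 ∀ {i j} → i ≤ k → j ≤ l → ¬ col x i ~ col y j
    Fold-apart {x} {y} zx zy F F' ≁ {i} {j} i≤k j≤l p with Fold⇒Level zx F i i≤k | Fold⇒Level zy F' j j≤l
    ... | level n f ln _ | level n' f' ln' _ with Fst-uniq p f f'
    ...   | refl = ≁ (~-trans (~-sym ln) (~-trans (col-cong n p (proj₂ (proj₂ f))) ln'))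

-- Counting poles

-- conn is transitivity as an induction principle; enum exhibits d + 2 poles, that is, genus 0.
record Good {m} (t : Trip m) (d : ℕ) (z₀ : Fin m) : Set₁ where
  field
    I : Inv t
  open Alg t I using (P; InZ)
  field
    conn : (Q : Fin m → Set) → (∀ x → Q x → Q (Trip.r t x)) → (∀ x → Q x → Q (Trip.g t x)) →
           (∀ x → Q x → Q (Trip.b t x)) → ∀ x y → Q x → Q y
    d≥3  : 3 ≤ d
    cyc  : iter P d z₀ ≡ z₀
    prim : ∀ i → 0 < i → i < d → iter P i z₀ ≢ z₀
    onZ  : ∀ x → InZ x → ∃ λ i → i < d × iter P i z₀ ≡ x
    enum : Enum (2 + d) (Fix t)

injective⇒surjective : ∀ {N} (σ : Fin N → Fin N) → (∀ {i j} → σ i ≡ σ j → i ≡ j) → ∀ s → ∃ λ i → σ i ≡ s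
injective⇒surjective {suc N} σ inj s with FinP.any? (λ i → σ i FinP.≟ s)
... | yes p = p
... | no ¬p = ⊥-elim (<-irrefl refl (FinP.injective⇒≤ {f = λ i → Fin.punchOut (avoid i)}
                (λ {i} {j} e → inj (FinP.punchOut-injective (avoid i) (avoid j) e))))
  where
  avoid : ∀ i → s ≢ σ i
  avoid i e = ¬p (i , sym e)

module Counting {m : ℕ} {t : Trip m} {d : ℕ} {z₀ : Fin m} (Γ : Good t d z₀) where
  open Good Γ
  open Alg t I

  z : ℕ → Fin m
  z i = iter P i z₀

  z-InZ : ∀ i → InZ (z i)
  z-InZ zero    = prim 2 (s≤s z≤n) d≥3
  z-InZ (suc i) = InZ-P (z-InZ i)

  private
    z-clash : ∀ {i j} → i < j → j < d → z i ≢ z j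
    z-clash {i} i<j j<d e with <⇒offset i<j
    ... | a , refl = prim (suc a) (s≤s z≤n) (≤-<-trans (m≤n+m (suc a) i) j<d)
                       (sym (iter-inj P-inj i (trans e (iter-+ P i (suc a) z₀))))

  opaque
    z-uniq : ∀ {i j} → i < d → j < d → z i ≡ z j → i ≡ j
    z-uniq {i} {j} i<d j<d e with <-cmp i j
    ... | tri≈ _ i≡j _ = i≡j
    ... | tri< i<j _ _ = ⊥-elim (z-clash i<j j<d e)
    ... | tri> _ _ j<i = ⊥-elim (z-clash j<i i<d (sym e))

  -- the classes reached by a vertical line that never meets a class of Z would form a Z-free component
  private
    V V⁻ : Fin m → Fin m
    V y = r (g y)
    V⁻ y = g (r y)
    module OV = Orbit V V⁻ (λ y → trans (cong r (gg (r y))) (rr y)) (λ y → trans (cong g (rr (g y))) (gg y))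

    col-even : ∀ x i → col x (i + i) ≡ iter V i x
    col-odd : ∀ x i → col x (suc (i + i)) ≡ g (iter V i x)
    col-odd x i = trans (c-swap (i + i) 0 i (+-identityʳ _) _) (cong g (col-even x i))
    col-even x zero = refl
    col-even x (suc i) = trans (cong (λ a → col x (suc a)) (+-suc i i))
      (trans (c-swap (suc (i + i)) 1 (suc i) (trans (+-comm _ 1) (cong suc (sym (+-suc i i)))) _) (cong r (col-odd x i)))

    column-meets : ∀ x p → iter V (suc p) x ≡ x → ¬ (∀ i → i < suc p → ¬ ZC (g (iter V i x)))
    column-meets x p ret nz = meets (conn Q Q-r Q-g Q-b (A 0) z₀ (0 , s≤s z≤n , inj₁ ~-refl))
      where
      A : ℕ → Fin m
      A i = g (iter V i x)
      Q : Fin m → Set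
      Q y = ∃ λ i → i < suc p × ((A i ~ y) ⊎ (r (A i) ~ y))
      Q-~ : ∀ {y w} → y ~ w → Q y → Q w
      Q-~ e (i , i<p , inj₁ q) = i , i<p , inj₁ (~-trans q e)
      Q-~ e (i , i<p , inj₂ q) = i , i<p , inj₂ (~-trans q e)
      Q-r : ∀ y → Q y → Q (r y)
      Q-r y (i , i<p , inj₁ q) = i , i<p , inj₂ (r-cong (nz i i<p) q)
      Q-r y (i , i<p , inj₂ q) = i , i<p , inj₁ (subst (_~ r y) (rr _) (r-cong (r-free (nz i i<p)) q))
      Q-g : ∀ y → Q y → Q (g y)
      Q-g y (suc i , i<p , inj₁ q) = i , ≤-trans (n≤1+n _) i<p , inj₂ (subst (_~ g y) (gg _) (g-cong q))
      Q-g y (zero , i<p , inj₁ q) = p , ≤-refl , inj₂ (~-trans (~-≡ ret) (subst (_~ g y) (gg _) (g-cong q)))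
      Q-g y (i , i<p , inj₂ q) with m≤n⇒m<n∨m≡n i<p
      ... | inj₁ si<p = suc i , si<p , inj₁ (g-cong q)
      ... | inj₂ refl = 0 , s≤s z≤n , inj₁ (subst (λ w → g w ~ g y) ret (g-cong q))
      Q-b : ∀ y → Q y → Q (b y)
      Q-b y q = Q-~ (gb~ y) (Q-g y q)
      meets : ¬ Q z₀
      meets (i , i<p , inj₁ q) = nz i i<p (z₀ , q , z-InZ 0)
      meets (i , i<p , inj₂ q) = r-free (nz i i<p) (z₀ , q , z-InZ 0)

    leastFst : ∀ x n → 1 ≤ n → ZC (col x n) → ∃ λ n → Fst x n
    leastFst x n 1≤n zc with least (λ n → (1 ≤? n) ×-dec ZC? (col x n)) n (1≤n , zc)
    ... | n' , (1≤n' , zn) , below = n' , 1≤n' , zn , λ j 1≤j j<n zj → below j j<n (1≤j , zj)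

  opaque
    reach : ∀ x → ∃ λ n → Fst x n
    reach x = search (anyUpTo? (λ i → ZC? (g (iter V i x))) (suc (OV.per x)))
      where
      search : Dec (∃ λ i → i < suc (OV.per x) × ZC (g (iter V i x))) → ∃ λ n → Fst x n
      search (yes (i , _ , zc)) = leastFst x (suc (i + i)) (s≤s z≤n) (subst ZC (sym (col-odd x i)) zc)
      search (no ¬zc) = ⊥-elim (column-meets x (OV.per x) (OV.per-ret x) (λ i i<p zc → ¬zc (i , i<p , zc)))

  -- A reflection `c k` of a class is centred either on an element, `c k y ≡ y`, or on a corner,
  -- `c k (T y) ≡ y`. For `c k = g` the latter says `b y ≡ y`, and for `c k = r` it says `P y ≡ y`.
  tag0 tag1 : ℕ → Tag
  tag0 0 = tG
  tag0 1 = tR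
  tag0 (suc (suc k)) = tag0 k
  tag1 0 = tB
  tag1 1 = tP
  tag1 (suc (suc k)) = tag1 k


  -- Positions are counted in half steps from `u`: an even `n` is an element of the class, an odd
  -- `n` the corner that follows it.
  mid : Tag → Tag → ℕ → Fin m → Tag × Fin m
  mid t0 t1 0 u = t0 , u
  mid t0 t1 1 u = t1 , u
  mid t0 t1 (suc (suc n)) u = mid t0 t1 n (T u)

  mid-even : ∀ t0 t1 i u → mid t0 t1 (i + i) u ≡ (t0 , iter T i u)
  mid-even t0 t1 zero    u = refl
  mid-even t0 t1 (suc i) u rewrite +-suc i i = trans (mid-even t0 t1 i (T u)) (cong (t0 ,_) (iter-shift T i u))

  mid-odd : ∀ t0 t1 i u → mid t0 t1 (suc (i + i)) u ≡ (t1 , iter T i u)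
  mid-odd t0 t1 zero    u = refl
  mid-odd t0 t1 (suc i) u rewrite +-suc i i = trans (mid-odd t0 t1 i (T u)) (cong (t1 ,_) (iter-shift T i u))

  -- the two centres of the reflection c k on the class of u = col x k
  record EndPt (x : Fin m) (k : ℕ) (β : Bool) (φ : Tag × Fin m) : Set where
    constructor endPt
    field
      j     : ℕ
      short : j < suc (per (col x k))
      mirr  : iter T j (col x k) ≡ c k (col x k)
      here  : φ ≡ mid (tag0 k) (tag1 k) (if β then j + suc (per (col x k)) else j) (col x k)

  opaque
    EndPt-uniq : ∀ {x k β φ φ'} → EndPt x k β φ → EndPt x k β φ' → φ ≡ φ'
    EndPt-uniq {x} {k} (endPt j j< e p) (endPt j' j'< e' p') with iter-uniq (col x k) j< j'< (trans e (sym e'))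
    ... | refl = trans p (sym p')

  private
    pick : ∀ x k {a j} → a < suc (per (col x k)) + suc (per (col x k)) → j < suc (per (col x k)) →
           iter T j (col x k) ≡ c k (col x k) → iter T a (col x k) ≡ iter T j (col x k) →
           ∀ {φ} → φ ≡ mid (tag0 k) (tag1 k) a (col x k) → ∃ λ β → EndPt x k β φ
    pick x k a< j< ej e eφ with iter-wrap (col x k) a< j< e
    ... | inj₁ refl = false , endPt _ j< ej eφ
    ... | inj₂ refl = true , endPt _ j< ej eφ

  opaque
    -- If `c k` takes the base element to position `j`, it takes position `i` to `j - i`. A fixed
    -- position satisfies `i + i = j` modulo the period, and `β` tells which of the two solutions it
    -- is.
    end-cover0 : ∀ {x k y} → Fold x k → col x k ~ y → c k y ≡ y → ∃ λ β → EndPt x k β (tag0 k , y)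
    end-cover0 {x} {k} {y} F p fx with ~-short p | ~-short (~-sym (Fold.turn F))
    ... | i , i< , refl | j , j< , ej = pick x k (+-mono-≤ i< (<⇒≤ i<)) j< ej eq (sym (mid-even _ _ i _))
      where
      u : Fin m
      u = col x k
      eq : iter T (i + i) u ≡ iter T j u
      eq = trans (iter-+ T i i u) (trans (cong (iter T i) (sym fx))
            (trans (cong (iter T i) (c-run k (λ 1≤k → Fold.free≤ F k 1≤k ≤-refl) i)) (trans (ff⁻k i _) (sym ej))))

  opaque
    end-cover1 : ∀ {x k y} → Fold x k → col x k ~ y → c k (T y) ≡ y → ∃ λ β → EndPt x k β (tag1 k , y)
    end-cover1 {x} {k} {y} F p fx with ~-short p | ~-short (~-sym (Fold.turn F))
    ... | i , i< , refl | j , j< , ej = pick x k (subst (λ a → suc a ≤ suc (per (col x k)) + suc (per (col x k))) (+-suc i i) (+-mono-≤ i< i<)) j< ej eq (sym (mid-odd _ _ i _))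
      where
      u : Fin m
      u = col x k
      eq : iter T (suc (i + i)) u ≡ iter T j u
      eq = trans (iter-+ T (suc i) i u) (trans (cong (iter T (suc i)) (sym fx))
            (trans (cong (iter T (suc i)) (c-run k (λ 1≤k → Fold.free≤ F k 1≤k ≤-refl) (suc i))) (trans (ff⁻k (suc i) _) (sym ej))))

  record Next (x : Fin m) (L : ℕ) : Set where
    constructor mkNext
    field
      hit    : InZ (iter T (suc L) x)
      before : ∀ j → j < L → ¬ InZ (iter T (suc j) x)

  opaque
    next : ∀ {x} → InZ x → ∃ λ L → Next x L
    next {x} zx with least (λ L → InZ? (iter T (suc L) x)) (per x) (subst InZ (sym (per-ret x)) zx)
    ... | L , h , be = L , mkNext h be

  opaque
    Next-uniq : ∀ {x L L'} → Next x L → Next x L' → L ≡ L'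
    Next-uniq {x} {L} {L'} (mkNext a m1) (mkNext a' m2) with <-cmp L L'
    ... | tri≈ _ e _ = e
    ... | tri< l _ _ = ⊥-elim (m2 L l a)
    ... | tri> _ _ l = ⊥-elim (m1 L' l a')

  opaque
    -- A segment from Z to Z read on its other side. There is no direction of Z in between, so `r`
    -- reverses its edges; the length is the same and the two ends are shifted by one turn of `P`.
    Next-flip : ∀ {x L} → InZ x → Next x L →
                Next (P⁻ (iter T (suc L) x)) L × iter T (suc L) (P⁻ (iter T (suc L) x)) ≡ P x
    Next-flip {x} {L} zx (mkNext zy mn) = mkNext (subst InZ (sym to) (InZ-P zx)) mn' , to
      where
      y s : Fin m
      y = iter T (suc L) x
      s = T x
      mn-s : ∀ i → i < L → ¬ InZ (iter T i s)
      mn-s i i<L = subst (¬_ ∘ InZ) (sym (iter-shift T i x)) (mn i i<L)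
      ry : ∀ i → i ≤ L → r (iter T i s) ≡ iter T⁻ i (P x)
      ry i i≤L = r-run i s (λ j j<i → mn-s j (<-≤-trans j<i i≤L))
      P⁻y : P⁻ y ≡ iter T⁻ (suc L) (P x)
      P⁻y = cong T⁻ (trans (cong r (sym (iter-shift T L x))) (ry L ≤-refl))
      to : iter T (suc L) (P⁻ y) ≡ P x
      to = trans (cong (iter T (suc L)) P⁻y) (ff⁻k (suc L) (P x))
      mn' : ∀ j → j < L → ¬ InZ (iter T (suc j) (P⁻ y))
      mn' j j<L zz with <⇒offset j<L
      ... | e , refl = mn-s e (m≤n+m (suc e) j) (subst InZ (P⁻P _) (InZ-P⁻ (subst InZ eq zz)))
        where
        eq : iter T (suc j) (P⁻ y) ≡ P (iter T e s)
        eq = trans (cong (iter T (suc j)) (trans P⁻y (iter-+ T⁻ (suc j) (suc e) (P x))))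
               (trans (ff⁻k (suc j) _) (sym (ry (suc e) (m≤n+m (suc e) j))))

  record First (i : ℕ) : Set where
    constructor mkFirst
    field
      new : ∀ j → j < i → ¬ z j ~ z i
  open First public

  opaque
    first : ∀ i → ∃ λ f → f ≤ i × First f × z f ~ z i
    first i with least (λ j → ~-dec (z j) (z i)) i ~-refl
    ... | f , p , mn = f , f≤i , mkFirst (λ j j<f q → mn j j<f (~-trans q p)) , p
      where
      f≤i : f ≤ i
      f≤i with f ≤? i
      ... | yes q = q
      ... | no q = ⊥-elim (mn i (≰⇒> q) ~-refl)

  opaque
    First-uniq : ∀ {i j} → First i → First j → z i ~ z j → i ≡ j
    First-uniq {i} {j} fi fj p with <-cmp i j
    ... | tri≈ _ e _ = e
    ... | tri< l _ _ = ⊥-elim (new fj i l p)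
    ... | tri> _ _ l = ⊥-elim (new fi j l (~-sym p))

  -- The class of a new `z (suc i)` is entered across the segment leaving `z i`. One side of that
  -- segment ends at some `z l`, the other at `z (suc i)`; these are the two directions assigned to
  -- the class.
  data Slot : ℕ → Bool → ℕ → Set where
    s00 : Slot 0 false 0
    s01 : Slot 0 true 1
    sf  : ∀ {i} → Slot (suc i) false (3 + i)
    st  : ∀ {i l L} → Next (z i) L → z l ≡ iter T (suc L) (z i) → Slot (suc i) true (2 + l)

  -- Slots 0, 1 are two extra places, slot 2 + l is the singularity direction z l.
  -- Every tagged fixed point occupies one, and there are as many fixed points as slots.
  data Hits : ℕ → Tag × Fin m → Set where
    htail : ∀ {l L φ} → Next (P⁻ (z l)) L → iter T (suc L) (P⁻ (z l)) ≡ z l →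
            φ ≡ mid tR tP L (T (P⁻ (z l))) → Hits (2 + l) φ
    hend  : ∀ {i k β s φ} → First i → Fold (z i) k → EndPt (z i) k β φ → Slot i β s → Hits s φ

  -- For `i ≤ j` the segment itself joins `z (suc j)` to the earlier `z i`; for `j < i` its other
  -- side joins `z (suc i)` to the earlier `z j`. Either way a class called new has been met before.
  st-clash : ∀ {i j L} → First (suc i) → First (suc j) → Next (z i) L → z (suc j) ≢ iter T (suc L) (z i)
  st-clash {i} {j} {L} fi fj nx e with <-cmp i j
  ... | tri< l _ _ = new fj i (m<n⇒m<1+n l) (subst (z i ~_) (sym e) (~-iter (suc L)))
  ... | tri≈ _ refl _ = new fj i ≤-refl (subst (z i ~_) (sym e) (~-iter (suc L)))
  ... | tri> _ _ l = new fi j (m<n⇒m<1+n l) (subst (z j ~_) to (~-iter (suc L)))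
    where
    to : iter T (suc L) (z j) ≡ z (suc i)
    to = trans (cong (iter T (suc L)) (trans (sym (P⁻P (z j))) (cong P⁻ e))) (proj₂ (Next-flip (z-InZ i) nx))

  -- A segment folded onto itself has both sides in one class, whereas a segment across which a new
  -- class is entered separates two classes.
  tail-clash : ∀ {i l L L'} → First (suc i) → Next (z i) L → z l ≡ iter T (suc L) (z i) →
               Next (P⁻ (z l)) L' → iter T (suc L') (P⁻ (z l)) ≢ z l
  tail-clash {i} {l} {L} {L'} fi nx el nx' e' =
    new fi i ≤-refl (subst (z i ~_) (trans (sym el) eq) (~-iter (suc L)))
    where
    fl = Next-flip (z-InZ i) nx
    eq : z l ≡ z (suc i)
    eq = trans (sym e') (trans (cong₂ (λ a w → iter T (suc a) (P⁻ w)) (Next-uniq (subst (λ w → Next (P⁻ w) L') el nx') (proj₁ fl)) el) (proj₂ fl))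

  next-first : ∀ {i L} → First (suc i) → Next (z i) L → iter T (suc L) (z i) ≢ z (suc i)
  next-first {i} {L} fi nx e = new fi i ≤-refl (subst (z i ~_) e (~-iter (suc L)))

  opaque
    Slot-uniq : ∀ {i j β γ s} → First i → First j → Slot i β s → Slot j γ s → i ≡ j × β ≡ γ
    Slot-uniq fi fj s00 s00 = refl , refl
    Slot-uniq fi fj s01 s01 = refl , refl
    Slot-uniq fi fj sf sf = refl , refl
    Slot-uniq fi fj sf (st nx e) = ⊥-elim (st-clash fj fi nx e)
    Slot-uniq fi fj (st nx e) sf = ⊥-elim (st-clash fi fj nx e)
    Slot-uniq {suc i} {suc j} fi fj (st {L = L} nx e) (st {L = L'} nx' e') = First-uniq {suc i} {suc j} fi fj (~-≡ eq) , refl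
      where
      f1 : Next (P⁻ (iter T (suc L) (z i))) L × iter T (suc L) (P⁻ (iter T (suc L) (z i))) ≡ P (z i)
      f1 = Next-flip (z-InZ i) nx
      f2 : Next (P⁻ (iter T (suc L') (z j))) L' × iter T (suc L') (P⁻ (iter T (suc L') (z j))) ≡ P (z j)
      f2 = Next-flip (z-InZ j) nx'
      ee : iter T (suc L) (z i) ≡ iter T (suc L') (z j)
      ee = trans (sym e) e'
      eq : z (suc i) ≡ z (suc j)
      eq = trans (sym (proj₂ f1)) (trans (cong₂ (λ a w → iter T (suc a) (P⁻ w))
             (Next-uniq (proj₁ f1) (subst (λ w → Next (P⁻ w) L') (sym ee) (proj₁ f2))) ee) (proj₂ f2))

  P⁻z : ∀ i → P⁻ (z (suc i)) ≡ z i
  P⁻z i = P⁻P (z i)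

  tail-end : ∀ {i l β L} → First i → Slot i β (2 + l) → Next (P⁻ (z l)) L → iter T (suc L) (P⁻ (z l)) ≢ z l
  tail-end {suc i} {L = L} fi sf nx e = next-first fi (subst (λ w → Next w L) (P⁻z i) nx) (trans (cong (iter T (suc L)) (sym (P⁻z i))) e)
  tail-end {l = l} fi (st {i} nx' el) nx e = tail-clash {i} {l} fi nx' el nx e

  Hits-fun : ∀ {s φ φ'} → Hits s φ → Hits s φ' → φ ≡ φ'
  Hits-fun (htail nx e p) (htail nx' e' p') with Next-uniq nx nx'
  ... | refl = trans p (sym p')
  Hits-fun (htail nx e p) (hend fi F ep sl) = ⊥-elim (tail-end fi sl nx e)
  Hits-fun (hend fi F ep sl) (htail nx e p) = ⊥-elim (tail-end fi sl nx e)
  Hits-fun (hend {i} fi F ep sl) (hend {j} fj F' ep' sl') with Slot-uniq fi fj sl sl'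
  ... | refl , refl with Fold-uniq (InZ⇒ZC (z-InZ i)) ~-refl F F'
  ...   | refl = EndPt-uniq ep ep'

  opaque
    slot : ∀ i β → i < d → ∃ λ s → s < 2 + d × Slot i β s
    slot zero    false _ = 0 , s≤s z≤n , s00
    slot zero    true  _ = 1 , s≤s (s≤s z≤n) , s01
    slot (suc i) false i<d = 3 + i , s≤s (s≤s i<d) , sf
    slot (suc i) true  i<d with next (z-InZ i)
    ... | L , nx with onZ _ (Next.hit nx)
    ...   | l , l<d , e = 2 + l , s≤s (s≤s l<d) , st nx e

  cover-end : ∀ {k x} → ZC x → Fold x k → ∀ {φ} →
              (∀ {x'} → x ~ x' → Fold x' k → ∃ λ β → EndPt x' k β φ) → ∃ λ s → s < 2 + d × Hits s φ
  cover-end {k} {x} (y , x~y , zy) F mk with onZ y zy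
  ... | i , i<d , refl with first i
  ...   | f , f≤i , ff , f~i with mk (~-trans x~y (~-sym f~i)) (Fold-~ (~-trans x~y (~-sym f~i)) F)
  ...     | β , ep with slot f β (≤-<-trans f≤i i<d)
  ...       | s , s< , sl = s , s< , hend ff (Fold-~ (~-trans x~y (~-sym f~i)) F) ep sl

  -- the first class of Z below e: the column through it turns at the class of e
  landing : ∀ e n → Fst e n → e ~ g e → ¬ ZC e → ∃ λ k → Fold (col e n) k × (∃ λ h → k ≡ h + h) × col (col e n) k ~ e
  landing e zero (() , _) ge nz
  landing e (suc n) F@(_ , zn , fr) ge nz with Fst-odd F
  ... | h , eq = n , turn⇒Fold x n free tn , ev , ~-trans (~-≡ (down n 1 (+-comm n 1))) (~-sym ge)
    where
    x = col e (suc n)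
    down : ∀ j l → j + l ≡ suc n → col x j ≡ col e l
    down = col-down e (suc n) h eq
    free : ∀ j → 1 ≤ j → j ≤ n → ¬ ZC (col x j)
    free j 1≤j j≤n with ≤⇒offset j≤n
    ... | l , refl = subst (¬_ ∘ ZC) (sym (down j (suc l) (+-suc j l))) (fr (suc l) (s≤s z≤n) (s≤s (+-monoˡ-≤ l 1≤j)))
    tn : col x (suc n) ~ col x n
    tn = ~-trans (~-≡ (down (suc n) 0 (+-identityʳ _))) (~-trans ge (~-≡ (sym (down n 1 (+-comm n 1)))))
    ev : ∃ λ h → n ≡ h + h
    ev = h , suc-injective eq

  -- As for `landing`, but the turn is made by `r` at `e` itself. The turning level is therefore the
  -- full odd distance `n` and not one less.
  landingR : ∀ e n → Fst e n → e ~ r e → ¬ ZC e → ∃ λ k → Fold (col e n) k × (∃ λ h → k ≡ suc (h + h)) × col (col e n) k ~ e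
  landingR e n F@(1≤n , zn , fr) re nz with Fst-odd F
  ... | h , eq = n , turn⇒Fold x n free tn , (h , eq) , ~-≡ (down n 0 (+-identityʳ n))
    where
    x = col e n
    down : ∀ j l → j + l ≡ n → col x j ≡ col e l
    down = col-down e n h eq
    free : ∀ j → 1 ≤ j → j ≤ n → ¬ ZC (col x j)
    free j 1≤j j≤n with ≤⇒offset j≤n
    ... | zero , j+l = subst (¬_ ∘ ZC) (sym (down j 0 j+l)) nz
    ... | suc l , j+l = subst (¬_ ∘ ZC) (sym (down j (suc l) j+l)) (fr (suc l) (s≤s z≤n) (subst (suc (suc l) ≤_) j+l (+-monoˡ-≤ (suc l) 1≤j)))
    od : ∀ x → c n x ≡ r x
    od x = trans (cong (λ a → c a x) eq) (c-swap (suc (h + h)) 1 (suc h) (trans (+-comm _ 1) (cong suc (sym (+-suc h h)))) x)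
    tn : col x (suc n) ~ col x n
    tn = ~-trans (~-≡ (trans (od _) (cong r (down n 0 (+-identityʳ n))))) (~-trans (~-sym re) (~-≡ (sym (down n 0 (+-identityʳ n)))))

  tags : ∀ k → ((∃ λ h → k ≡ h + h) → tag0 k ≡ tG × tag1 k ≡ tB) × ((∃ λ h → k ≡ suc (h + h)) → tag0 k ≡ tR × tag1 k ≡ tP)
  tags 0 = (λ _ → refl , refl) , λ { (_ , ()) }
  tags 1 = (λ { (suc h , e) → ⊥-elim (case-1 h (suc-injective e)) }) , λ _ → refl , refl
    where
    case-1 : ∀ h → 0 ≢ h + suc h
    case-1 h e rewrite +-suc h h with e
    ... | ()
  tags (suc (suc k)) =
    (λ { (suc h , e) → proj₁ (tags k) (h , suc-injective (trans (suc-injective e) (+-suc h h))) }) ,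
    (λ { (suc h , e) → proj₂ (tags k) (h , suc-injective (trans (suc-injective e) (cong suc (+-suc h h)))) ; (zero , ()) })

  c-g : ∀ {k} → (∃ λ h → k ≡ h + h) → ∀ x → c k x ≡ g x
  c-g (h , refl) x = c-swap (h + h) 0 h (+-identityʳ _) x

  c-r : ∀ {k} → (∃ λ h → k ≡ suc (h + h)) → ∀ x → c k x ≡ r x
  c-r (h , refl) x = c-swap (suc (h + h)) 1 (suc h) (trans (+-comm _ 1) (cong suc (sym (+-suc h h)))) x

  private
    Covered : Tag × Fin m → Set
    Covered φ = ∃ λ s → s < 2 + d × Hits s φ

    cover-at : ∀ {x k} → ZC x → Fold x k → ∀ y → col x k ~ y →
               (c k y ≡ y → Covered (tag0 k , y)) × (c k (T y) ≡ y → Covered (tag1 k , y))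
    cover-at {x} {k} zx F y p = (λ fx → cover-end zx F (λ q F' → end-cover0 F' (shift q) fx)) ,
                                (λ fx → cover-end zx F (λ q F' → end-cover1 F' (shift q) fx))
      where
      shift : ∀ {x'} → x ~ x' → col x' k ~ y
      shift q = ~-trans (~-sym (col-cong k q (λ j 1≤j j<k → Fold.free≤ F j 1≤j (<⇒≤ j<k)))) p

    cover-g : ∀ y → y ~ g y → (g y ≡ y → Covered (tG , y)) × (g (T y) ≡ y → Covered (tB , y))
    cover-g y ge = go (ZC? y)
      where
      go : Dec (ZC y) → (g y ≡ y → Covered (tG , y)) × (g (T y) ≡ y → Covered (tB , y))
      go (yes zc) = cover-at zc (turn⇒Fold y 0 (λ { (suc j) _ () }) (~-sym ge)) y ~-refl
      go (no nz) with reach y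
      ... | n , F with landing y n F ge nz
      ...   | k , Fo , ev , p with cover-at (proj₁ (proj₂ F)) Fo y p
      ...     | c0 , c1 = (λ e → subst (λ τ → Covered (τ , y)) (proj₁ (proj₁ (tags k) ev)) (c0 (trans (c-g ev y) e))) ,
                          (λ e → subst (λ τ → Covered (τ , y)) (proj₂ (proj₁ (tags k) ev)) (c1 (trans (c-g ev (T y)) e)))

    cover-r : ∀ y → ¬ ZC y → y ~ r y → (r y ≡ y → Covered (tR , y)) × (r (T y) ≡ y → Covered (tP , y))
    cover-r y nz re with reach y
    ... | n , F with landingR y n F re nz
    ...   | k , Fo , od , p with cover-at (proj₁ (proj₂ F)) Fo y p
    ...     | c0 , c1 = (λ e → subst (λ τ → Covered (τ , y)) (proj₁ (proj₂ (tags k) od)) (c0 (trans (c-r od y) e))) ,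
                        (λ e → subst (λ τ → Covered (τ , y)) (proj₂ (proj₂ (tags k) od)) (c1 (trans (c-r od (T y)) e)))

    firstInZ : ∀ {y} → ZC y → ∃ λ k → InZ (iter T k y) × (∀ j → j < k → ¬ InZ (iter T j y))
    firstInZ {y} (w , (k , e) , zw) = least (λ k → InZ? (iter T k y)) k (subst InZ (sym e) zw)

    -- The segment starts `K + 1` steps before `y` and has length `L + 1`. Its centre is `y` when
    -- `L = 2K` and the corner after `y` when `L = 2K + 1`, the two cases in which this is applied.
    cover-tail : ∀ y K L →
                 P⁻ (iter T (L ∸ K) y) ≡ iter T⁻ (suc K) y → K ≤ L →
                 InZ (iter T (L ∸ K) y) → (∀ i → i < L ∸ K → ¬ InZ (iter T i y)) →
                 (∀ e → e < K → ¬ InZ (iter T⁻ (suc e) y)) →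
                 ∀ {φ} → φ ≡ mid tR tP L (iter T⁻ K y) → Covered φ
    cover-tail y K L pw K≤L zz fr fr⁻ {φ} eφ with onZ _ zz
    ... | l , l<d , el = 2 + l , s≤s (s≤s l<d) , htail (subst (λ v → Next v L) (sym pz) nx) (trans (cong (iter T (suc L)) pz) (trans to (sym el)))
                           (trans eφ (cong (mid tR tP L) (trans (sym (TT⁻ _)) (cong T (sym pz)))))
      where
      w : Fin m
      w = iter T⁻ (suc K) y
      pz : P⁻ (z l) ≡ w
      pz = trans (cong P⁻ el) pw
      at : ∀ i → iter T (suc (i + K)) w ≡ iter T i y
      at i = trans (cong (λ a → iter T a w) (sym (+-suc i K))) (trans (iter-+ T i (suc K) w) (cong (iter T i) (ff⁻k (suc K) y)))
      to : iter T (suc L) w ≡ iter T (L ∸ K) y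
      to = trans (cong (λ a → iter T (suc a) w) (sym (m∸n+n≡m K≤L))) (at (L ∸ K))
      nx : Next w L
      nx = mkNext (subst InZ (sym to) zz) be
        where
        be : ∀ j → j < L → ¬ InZ (iter T (suc j) w)
        be j j<L with j <? K
        ... | yes j<K with <⇒offset j<K
        ...   | e , refl = subst (¬_ ∘ InZ) (sym (trans (cong (iter T (suc j)) (iter-+ T⁻ (suc j) (suc e) y)) (ff⁻k (suc j) _)))
                             (fr⁻ e (m≤n+m (suc e) j))
        be j j<L | no j≮K with ≤⇒offset (≮⇒≥ j≮K)
        ...   | i , refl = subst (¬_ ∘ InZ) (sym (trans (cong (λ a → iter T (suc a) w) (+-comm K i)) (at i)))
                             (fr i (+-cancelˡ-< K i (L ∸ K) (subst (K + i <_) (sym (m+[n∸m]≡n K≤L)) j<L)))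

    cover-tR : ∀ y → ZC y → r y ≡ y → Covered (tR , y)
    cover-tR y zc ry with firstInZ zc
    ... | k , zz , fr = cover-tail y k (k + k) (trans (cong (λ a → P⁻ (iter T a y)) L∸) pw) (m≤m+n k k)
                          (subst (λ a → InZ (iter T a y)) (sym L∸) zz) (λ i i< → fr i (subst (i <_) L∸ i<)) fr⁻
                          (sym (trans (mid-even tR tP k _) (cong (tR ,_) (ff⁻k k y))))
      where
      L∸ : k + k ∸ k ≡ k
      L∸ = m+n∸m≡n k k
      run : ∀ i → i ≤ k → r (iter T i y) ≡ iter T⁻ i y
      run i i≤k = trans (r-run i y (λ j j<i → fr j (<-≤-trans j<i i≤k))) (cong (iter T⁻ i) ry)
      pw : P⁻ (iter T k y) ≡ iter T⁻ (suc k) y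
      pw = cong T⁻ (run k ≤-refl)
      fr⁻ : ∀ e → e < k → ¬ InZ (iter T⁻ (suc e) y)
      fr⁻ e e<k zz = fr e e<k (subst InZ (P⁻P _) (InZ-P⁻ (subst InZ (sym (run (suc e) e<k)) zz)))

    cover-tP : ∀ y → ZC y → r (T y) ≡ y → Covered (tP , y)
    cover-tP y zc ry with firstInZ zc
    ... | zero , zz , fr = ⊥-elim (zz (trans (cong P ry) ry))
    ... | suc k , zz , fr = cover-tail y k (suc (k + k)) (trans (cong (λ a → P⁻ (iter T a y)) L∸) pw) (≤-trans (m≤m+n k k) (n≤1+n _))
                          (subst (λ a → InZ (iter T a y)) (sym L∸) zz) (λ i i< → fr i (subst (i <_) L∸ i<)) fr⁻
                          (sym (trans (mid-odd tR tP k _) (cong (tP ,_) (ff⁻k k y))))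
      where
      L∸ : suc (k + k) ∸ k ≡ suc k
      L∸ = trans (cong (_∸ k) (sym (+-suc k k))) (m+n∸m≡n k (suc k))
      run : ∀ i → i ≤ k → r (iter T (suc i) y) ≡ iter T⁻ i y
      run i i≤k = trans (cong r (sym (iter-shift T i y)))
        (trans (r-run i (T y) (λ j j<i → subst (¬_ ∘ InZ) (sym (iter-shift T j y)) (fr (suc j) (s≤s (<-≤-trans j<i i≤k)))))
               (cong (iter T⁻ i) ry))
      pw : P⁻ (iter T (suc k) y) ≡ iter T⁻ (suc k) y
      pw = cong T⁻ (run k ≤-refl)
      fr⁻ : ∀ e → e < k → ¬ InZ (iter T⁻ (suc e) y)
      fr⁻ e e<k zz = fr (suc e) (s≤s e<k) (subst InZ (P⁻P _) (InZ-P⁻ (subst InZ (sym (run (suc e) e<k)) zz)))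

    cover : ∀ φ → Fix t (proj₁ φ) (proj₂ φ) → Covered φ
    cover (tG , y) e = proj₁ (cover-g y (~-≡ (sym e))) e
    cover (tB , y) e = proj₂ (cover-g y (~-sym (~-trans (gb~ y) (~-≡ e)))) (trans (gT≡b y) e)
    cover (tR , y) e with ZC? y
    ... | yes zc = cover-tR y zc e
    ... | no nz = proj₁ (cover-r y nz (~-≡ (sym e))) e
    cover (tP , y) e with ZC? y
    ... | yes zc = cover-tP y zc e
    ... | no nz = proj₂ (cover-r y nz (1 , trans (sym (rr _)) (cong r e))) e

    opaque
      -- Each of the d + 2 enumerated poles chooses a slot. By `Hits-fun` the choice is injective,
      -- and an injective self-map of d + 2 places is onto.
      all-hit : ∀ s → s < 2 + d → ∃ λ φ → Hits s φ
      all-hit s s< with injective⇒surjective σ σ-inj (fromℕ< s<)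
        where
        ψ : Fin (2 + d) → Tag × Fin m
        ψ = proj₁ enum
        hit : ∀ i → Covered (ψ i)
        hit i = cover (ψ i) (proj₂ (proj₂ enum) i)
        σ : Fin (2 + d) → Fin (2 + d)
        σ i = fromℕ< (proj₁ (proj₂ (hit i)))
        σ-inj : ∀ {i j} → σ i ≡ σ j → i ≡ j
        σ-inj {i} {j} e = proj₁ (proj₂ enum) (Hits-fun (subst (λ a → Hits a (ψ i)) (trans (sym (FinP.toℕ-fromℕ< _)) (trans (cong toℕ e) (FinP.toℕ-fromℕ< _)))
                            (proj₂ (proj₂ (hit i)))) (proj₂ (proj₂ (hit j))))
      ... | i , e = _ , subst (λ a → Hits a (proj₁ enum i)) (trans (sym (FinP.toℕ-fromℕ< _)) (trans (cong toℕ e) (FinP.toℕ-fromℕ< s<)))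
                      (proj₂ (proj₂ (cover (proj₁ enum i) (proj₂ (proj₂ enum) i))))

    -- The slot reserved for the new class is filled, and the clash lemmas leave a fold of this very
    -- class as the only way to fill it.
    fold-first : ∀ f → f < d → First f → ∃ λ k → Fold (z f) k
    fold-first zero _ ff with all-hit 0 (s≤s z≤n)
    ... | φ , hend fi F ep s00 = _ , F
    fold-first (suc f) f<d ff with all-hit (3 + f) (s≤s (s≤s f<d))
    ... | φ , htail nx e _ = ⊥-elim (tail-end ff sf nx e)
    ... | φ , hend fi F ep sf = _ , F
    ... | φ , hend fi F ep (st nx e) = ⊥-elim (st-clash fi ff nx e)

  opaque
    folded : ∀ x → ZC x → ∃ λ k → Fold x k
    folded x (y , x~y , zy) with onZ y zy
    ... | i , i<d , refl with first i
    ...   | f , f≤i , ff , f~i with fold-first f (≤-<-trans f≤i i<d) ff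
    ...     | k , F = k , Fold-~ (~-trans f~i (~-sym x~y)) F

    -- The slot of the direction `P x` is filled. Were it filled by the fold of a class, the segment
    -- leaving `x` would be the one across which that class is first entered, with sides in
    -- different classes; but `x ~ P x` puts both sides in one class. So a folded segment ends at
    -- `P x`, and it is the one leaving `x`.
    star : ∀ x → InZ x → x ~ P x → ∃ λ L → Next x L × iter T (suc L) x ≡ P x
    star x zx p with onZ (P x) (InZ-P zx)
    ... | l , l<d , el with all-hit (2 + l) (s≤s (s≤s l<d))
    ...   | φ , htail {L = L} nx e _ = L , subst (λ w → Next w L) eq nx , trans (cong (iter T (suc L)) (sym eq)) (trans e el)
      where
      eq : P⁻ (z l) ≡ x
      eq = trans (cong P⁻ el) (P⁻P x)
    star x zx p | suc l , l<d , el | φ , hend fi F ep sf = ⊥-elim (new fi l ≤-refl (~-cast (trans (sym (P⁻P x)) (trans (cong P⁻ (sym el)) (P⁻z l))) (sym el) p))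
    star x zx p | l , l<d , el | φ , hend fi F ep (st {i} {L = L} nx e) =
      ⊥-elim (new fi i ≤-refl (~-trans (~-trans (~-iter (suc L)) (~-≡ (trans (sym e) el))) (~-trans (~-sym p) (~-trans (~-iter (suc L)) (~-≡ to)))))
      where
      to : iter T (suc L) x ≡ z (suc i)
      to = trans (cong (iter T (suc L)) (trans (sym (P⁻P x)) (cong P⁻ (trans (sym el) e)))) (proj₂ (Next-flip (z-InZ i) nx))

module Geometry {m : ℕ} {t : Trip m} {d : ℕ} {z₀ : Fin m} (Γ : Good t d z₀) where
  open Good Γ public
  open Alg t I public
  open Counting Γ public using (z; z-InZ; z-uniq; c-g; c-r; Next; module Next; next; P⁻z; folded; star)

-- Shears of the quotient

prodT : ∀ {m} → Trip m → Fin m → Fin m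
prodT (trip r g b) x = r (g (b x))

enum-map : ∀ {m N} (F F' : Tag → Fin m → Set) (θ θ⁻ : Tag × Fin m → Tag × Fin m) →
           (∀ φ → θ⁻ (θ φ) ≡ φ) → (∀ τ y → F τ y → F' (proj₁ (θ (τ , y))) (proj₂ (θ (τ , y)))) →
           Enum N F → Enum N F'
enum-map F F' θ θ⁻ li f (ψ , inj , fx) = θ ∘ ψ ,
  (λ {i} {j} e → inj (trans (sym (li (ψ i))) (trans (cong θ⁻ e) (li (ψ j))))) ,
  (λ i → f _ _ (fx i))

module _ {m : ℕ} {t : Trip m} {d : ℕ} {z₀ : Fin m} (Γ : Good t d z₀) where
  open Geometry Γ
  private module W = Alg (swapRB t) (inv-swap I)

  InZ-swap : ∀ {x} → InZ x → W.InZ x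
  InZ-swap {x} zx e = zx (trans (cong (P ∘ P) (sym e)) (trans (cong P (PP⁻ _)) (PP⁻ x)))

  InZ-swap⁻ : ∀ {x} → W.InZ x → InZ x
  InZ-swap⁻ {x} zx e = zx (trans (cong (P⁻ ∘ P⁻) (sym e)) (trans (cong P⁻ (P⁻P _)) (P⁻P x)))

  opaque
    -- The exchange replaces `P` by its inverse, so Z is turned around backwards and index `i`
    -- becomes `d - i`. The poles only change their names.
    good-swap : Good (swapRB t) d z₀
    good-swap = record
      { I = inv-swap I
      ; conn = λ Q qb qg qr → conn Q qr qg qb
      ; d≥3 = d≥3
      ; cyc = trans (cong (iter P⁻ d) (sym cyc)) (iter-cancel P⁻P d z₀)
      ; prim = λ i 0<i i<d e → prim i 0<i i<d (trans (cong (iter P i) (sym e)) (iter-cancel PP⁻ i z₀))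
      ; onZ = λ x zx → onZ' x (onZ x (InZ-swap⁻ zx))
      ; enum = enum-map (Fix t) (Fix (swapRB t)) θ θ θθ fx enum
      }
      where
      onZ' : ∀ x → (∃ λ i → i < d × iter P i z₀ ≡ x) → ∃ λ i → i < d × iter P⁻ i z₀ ≡ x
      onZ' x (zero , i<d , e) = 0 , i<d , e
      onZ' x (suc i , i<d , e) with ≤⇒offset (<⇒≤ i<d)
      ... | j , i+j = j , subst (j <_) i+j (s≤s (m≤n+m j i)) ,
        trans (cong (iter P⁻ j) (trans (sym cyc) (trans (cong (λ a → iter P a z₀) (trans (sym i+j) (+-comm (suc i) j))) (iter-+ P j (suc i) z₀))))
              (trans (iter-cancel P⁻P j _) e)
      θ : Tag × Fin m → Tag × Fin m
      θ (tR , y) = tB , y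
      θ (tP , y) = tP , y
      θ (tG , y) = tG , y
      θ (tB , y) = tR , y
      θθ : ∀ φ → θ (θ φ) ≡ φ
      θθ (tR , y) = refl
      θθ (tP , y) = refl
      θθ (tG , y) = refl
      θθ (tB , y) = refl
      fx : ∀ τ y → Fix t τ y → Fix (swapRB t) (proj₁ (θ (τ , y))) (proj₂ (θ (τ , y)))
      fx tR y e = e
      fx tP y e = trans (cong P⁻ (sym e)) (P⁻P y)
      fx tG y e = e
      fx tB y e = e

pick : ∀ {p} {A : Set p} {X : Set} → Dec A → X → X → X
pick (yes _) a b = a
pick (no _)  a b = b

pick-yes : ∀ {A : Set} {X : Set} (D : Dec A) {a b : X} → A → pick D a b ≡ a
pick-yes (yes _) p = refl
pick-yes (no ¬p) p = ⊥-elim (¬p p)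

pick-no : ∀ {A : Set} {X : Set} (D : Dec A) {a b : X} → ¬ A → pick D a b ≡ b
pick-no (yes p) ¬p = ⊥-elim (¬p p)
pick-no (no _)  ¬p = refl

module Twist {m : ℕ} (t : Trip m) (I : Inv t) where
  open Alg t I

  -- the s-th power of the shear of a strip that is a path
  record TwG (x₀ : Fin m) (s : ℕ) (t' : Trip m) : Set where
    field
      g-on  : ∀ {y} → x₀ ~ y → Trip.g t' y ≡ iter T s (g y)
      b-on  : ∀ {y} → x₀ ~ y → Trip.b t' y ≡ iter T s (b y)
      g-off : ∀ {y} → ¬ x₀ ~ y → Trip.g t' y ≡ g y
      b-off : ∀ {y} → ¬ x₀ ~ y → Trip.b t' y ≡ b y
      r-all : ∀ y → Trip.r t' y ≡ r y

  -- a twist of a cylinder that is folded along its red boundary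
  record TwR (x₀ : Fin m) (s : ℕ) (t' : Trip m) : Set where
    field
      r-on  : ∀ {y} → x₀ ~ y → Trip.r t' y ≡ iter T s (r y)
      r-off : ∀ {y} → ¬ x₀ ~ y → Trip.r t' y ≡ r y
      g-all : ∀ y → Trip.g t' y ≡ g y
      b-all : ∀ y → Trip.b t' y ≡ b y

  opaque
    twG : ∀ x₀ s → ∃ λ t' → TwG x₀ s t'
    twG x₀ s = trip r (λ y → pick (~-dec x₀ y) (iter T s (g y)) (g y)) (λ y → pick (~-dec x₀ y) (iter T s (b y)) (b y)) ,
      record { g-on = pick-yes (~-dec x₀ _) ; b-on = pick-yes (~-dec x₀ _) ; g-off = pick-no (~-dec x₀ _) ; b-off = pick-no (~-dec x₀ _) ; r-all = λ _ → refl }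

    twR : ∀ x₀ s → ∃ λ t' → TwR x₀ s t'
    twR x₀ s = trip (λ y → pick (~-dec x₀ y) (iter T s (r y)) (r y)) g b ,
      record { r-on = pick-yes (~-dec x₀ _) ; r-off = pick-no (~-dec x₀ _) ; g-all = λ _ → refl ; b-all = λ _ → refl }

  gTs : ∀ s y → iter T s (g (iter T s (g y))) ≡ y
  gTs s y = trans (cong (iter T s) (gTk s (g y))) (trans (ff⁻k s _) (gg y))

  module TwGFacts {x₀ s t'} (x~g : x₀ ~ g x₀) (W : TwG x₀ s t') where
    open TwG W

    g-class : ∀ {y} → x₀ ~ y → x₀ ~ g y
    g-class p = ~-trans x~g (g-cong p)

    b-class : ∀ {y} → x₀ ~ y → x₀ ~ b y
    b-class {y} p = ~-trans (g-class p) (gb~ y)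

    b-class⁻ : ∀ {y} → ¬ x₀ ~ y → ¬ x₀ ~ b y
    b-class⁻ {y} np p = np (subst (x₀ ~_) (bb y) (b-class p))

    g-class⁻ : ∀ {y} → ¬ x₀ ~ y → ¬ x₀ ~ g y
    g-class⁻ {y} np p = np (subst (x₀ ~_) (gg y) (g-class p))

    T-same : ∀ y → Trip.g t' (Trip.b t' y) ≡ T y
    T-same y with ~-dec x₀ y
    ... | yes p = trans (cong (Trip.g t') (b-on p)) (trans (g-on (~-trans (b-class p) (~-iter s)))
                    (trans (cong (iter T s) (gTk s (b y))) (ff⁻k s _)))
    ... | no np = trans (cong (Trip.g t') (b-off np)) (g-off (b-class⁻ np))

    opaque
      inv' : Inv t'
      inv' = inv rr' gg' bb'
        where
        rr' : ∀ x → Trip.r t' (Trip.r t' x) ≡ x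
        rr' x = trans (r-all _) (trans (cong r (r-all x)) (rr x))
        gg' : ∀ y → Trip.g t' (Trip.g t' y) ≡ y
        gg' y with ~-dec x₀ y
        ... | yes p = trans (cong (Trip.g t') (g-on p)) (trans (g-on (~-trans (g-class p) (~-iter s))) (gTs s y))
        ... | no np = trans (cong (Trip.g t') (g-off np)) (trans (g-off (g-class⁻ np)) (gg y))
        bb' : ∀ y → Trip.b t' (Trip.b t' y) ≡ y
        bb' y with ~-dec x₀ y
        ... | yes p = trans (cong (Trip.b t') (b-on p)) (trans (b-on (~-trans (b-class p) (~-iter s)))
                        (trans (cong (iter T s) (bTk s (b y))) (trans (ff⁻k s _) (bb y))))
        ... | no np = trans (cong (Trip.b t') (b-off np)) (trans (b-off (b-class⁻ np)) (bb y))

  module TwRFacts {x₀ s t'} (x~r : x₀ ~ r x₀) (nz : ¬ ZC x₀) (W : TwR x₀ s t') where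
    open TwR W

    r-class : ∀ {y} → x₀ ~ y → x₀ ~ r y
    r-class p = ~-trans x~r (r-cong nz p)

    r-class⁻ : ∀ {y} → ¬ x₀ ~ y → ¬ x₀ ~ r y
    r-class⁻ {y} np p = np (subst (x₀ ~_) (rr y) (r-class p))

    r-flip : ∀ {y} → x₀ ~ y → ∀ k → r (iter T k y) ≡ iter T⁻ k (r y)
    r-flip p k = rTk (¬ZC-~ p nz) k

    T-same : ∀ y → Trip.g t' (Trip.b t' y) ≡ T y
    T-same y = trans (g-all _) (cong g (b-all y))

    opaque
      inv' : Inv t'
      inv' = inv rr' (λ y → trans (g-all _) (trans (cong g (g-all y)) (gg y))) (λ y → trans (b-all _) (trans (cong b (b-all y)) (bb y)))
        where
        rr' : ∀ y → Trip.r t' (Trip.r t' y) ≡ y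
        rr' y with ~-dec x₀ y
        ... | yes p = trans (cong (Trip.r t') (r-on p)) (trans (r-on (~-trans (r-class p) (~-iter s)))
                        (trans (cong (iter T s) (r-flip (r-class p) s)) (trans (ff⁻k s _) (rr y))))
        ... | no np = trans (cong (Trip.r t') (r-off np)) (trans (r-off (r-class⁻ np)) (rr y))

prodT-iter : ∀ {m} (t t' : Trip m) {d z₀} (Γ : Good t d z₀) → (∀ x → Alg.InZ t (Good.I Γ) x → prodT t' x ≡ prodT t x) →
             ∀ i → iter (prodT t') i z₀ ≡ iter (prodT t) i z₀
prodT-iter t t' Γ pz zero = refl
prodT-iter t t' Γ pz (suc i) = trans (cong (prodT t') (prodT-iter t t' Γ pz i)) (pz _ (Geometry.z-InZ Γ i))

mkGood : ∀ {m} {t t' : Trip m} {d z₀} (Γ : Good t d z₀) (I' : Inv t') →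
         (∀ x → Alg.InZ t (Good.I Γ) x → prodT t' x ≡ prodT t x) →
         (∀ x → Alg.InZ t' I' x → Alg.InZ t (Good.I Γ) x) →
         ((Q : Fin m → Set) → (∀ x → Q x → Q (Trip.r t' x)) → (∀ x → Q x → Q (Trip.g t' x)) →
           (∀ x → Q x → Q (Trip.b t' x)) → ∀ x y → Q x → Q y) →
         Enum (2 + d) (Fix t') → Good t' d z₀
mkGood {t = t} {t'} {d} {z₀} Γ I' pz zz cn en = record
  { I = I' ; conn = cn ; d≥3 = Γ.d≥3
  ; cyc = trans (zi d) Γ.cyc
  ; prim = λ i 0<i i<d e → Γ.prim i 0<i i<d (trans (sym (zi i)) e)
  ; onZ = λ x zx → onZ' x (Γ.onZ x (zz x zx))
  ; enum = en }
  where
  module Γ = Good Γ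
  zi : ∀ i → iter (prodT t') i z₀ ≡ iter (prodT t) i z₀
  zi = prodT-iter t t' Γ pz
  onZ' : ∀ x → (∃ λ i → i < d × iter (prodT t) i z₀ ≡ x) → ∃ λ i → i < d × iter (prodT t') i z₀ ≡ x
  onZ' x (i , i<d , e) = i , i<d , trans (zi i) e

module _ {m : ℕ} {t : Trip m} {d : ℕ} {z₀ : Fin m} (Γ : Good t d z₀) where
  open Geometry Γ
  open Twist t I

  private
    closed-~ : ∀ (Q : Fin m → Set) → (∀ x → Q x → Q (T x)) → ∀ {x y} → x ~ y → Q x → Q y
    closed-~ Q qT (zero , refl) q = q
    closed-~ Q qT (suc k , refl) q = qT _ (closed-~ Q qT (k , refl) q)

  module _ {x₀ s t'} (x~g : x₀ ~ g x₀) (W : TwG x₀ s t') where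
    open TwG W
    open TwGFacts x~g W

    prodT-twG : ∀ x → prodT t' x ≡ prodT t x
    prodT-twG x = trans (r-all _) (cong r (T-same x))

    private
      FixS : ℕ → Tag → Fin m → Set
      FixS s tG y = pick (~-dec x₀ y) (iter T s (g y)) (g y) ≡ y
      FixS s tB y = pick (~-dec x₀ y) (iter T s (b y)) (b y) ≡ y
      FixS s tR y = r y ≡ y
      FixS s tP y = P y ≡ y

      -- One more unit of twist moves a centre of reflection by half a step: a fixed element of `g`
      -- turns into the corner after it, a fixed corner into the next element. Iterating this
      -- carries the list of poles along.
      θ θ⁻ : Tag × Fin m → Tag × Fin m
      θ (tG , y) = pick (~-dec x₀ y) tB tG , y
      θ (tB , y) = pick (~-dec x₀ y) tG tB , pick (~-dec x₀ y) (T y) y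
      θ (tR , y) = tR , y
      θ (tP , y) = tP , y
      θ⁻ (tB , y) = pick (~-dec x₀ y) tG tB , y
      θ⁻ (tG , y) = pick (~-dec x₀ y) tB tG , pick (~-dec x₀ y) (T⁻ y) y
      θ⁻ (tR , y) = tR , y
      θ⁻ (tP , y) = tP , y

      θθ : ∀ φ → θ⁻ (θ φ) ≡ φ
      θθ (tR , y) = refl
      θθ (tP , y) = refl
      θθ (tG , y) with ~-dec x₀ y in eq
      ... | yes p rewrite eq = refl
      ... | no np rewrite eq = refl
      θθ (tB , y) with ~-dec x₀ y in eq
      ... | yes p = cong₂ _,_ (pick-yes (~-dec x₀ (T y)) (~-trans p ~-step)) (trans (pick-yes (~-dec x₀ (T y)) (~-trans p ~-step)) (T⁻T y))
      ... | no np rewrite eq = refl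

      fix-step : ∀ s τ y → FixS s τ y → FixS (suc s) (proj₁ (θ (τ , y))) (proj₂ (θ (τ , y)))
      fix-step s tR y e = e
      fix-step s tP y e = e
      fix-step s tG y e with ~-dec x₀ y in eq
      ... | yes p rewrite eq = trans (sym (iter-shift T s (b y))) (trans (cong (iter T s ∘ g) (bb y)) e)
      ... | no np rewrite eq = e
      fix-step s tB y e with ~-dec x₀ y in eq
      ... | yes p = trans (pick-yes (~-dec x₀ (T y)) (~-trans p ~-step)) (cong T (trans (cong (iter T s) (gT≡b y)) e))
      ... | no np rewrite eq = e

      fix-0 : ∀ τ y → Fix t τ y → FixS 0 τ y
      fix-0 tR y e = e
      fix-0 tP y e = e
      fix-0 tG y e with ~-dec x₀ y
      ... | yes _ = e
      ... | no _ = e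
      fix-0 tB y e with ~-dec x₀ y
      ... | yes _ = e
      ... | no _ = e

      fix-s : ∀ τ y → FixS s τ y → Fix t' τ y
      fix-s tR y e = trans (r-all y) e
      fix-s tP y e = trans (prodT-twG y) e
      fix-s tG y e with ~-dec x₀ y
      ... | yes p = trans (g-on p) e
      ... | no np = trans (g-off np) e
      fix-s tB y e with ~-dec x₀ y
      ... | yes p = trans (b-on p) e
      ... | no np = trans (b-off np) e

      enumS : ∀ s → Enum (2 + d) (FixS s)
      enumS zero = enum-map (Fix t) (FixS 0) id id (λ _ → refl) fix-0 enum
      enumS (suc s) = enum-map (FixS s) (FixS (suc s)) θ θ⁻ θθ (fix-step s) (enumS s)

    opaque
      good-twG : Good t' d z₀
      good-twG = mkGood Γ inv' (λ x _ → prodT-twG x)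
        (λ x zx e → zx (trans (prodT-twG _) (trans (cong P (prodT-twG x)) e)))
        conn' (enum-map (FixS s) (Fix t') id id (λ _ → refl) fix-s (enumS s))
        where
        conn' : (Q : Fin m → Set) → (∀ x → Q x → Q (Trip.r t' x)) → (∀ x → Q x → Q (Trip.g t' x)) →
           (∀ x → Q x → Q (Trip.b t' x)) → ∀ x y → Q x → Q y
        conn' Q qr qg qb = conn Q (λ x q → subst Q (r-all x) (qr x q)) qg' qb'
          where
          q~ : ∀ {x y} → x ~ y → Q x → Q y
          q~ = closed-~ Q (λ x q → subst Q (T-same x) (qg _ (qb _ q)))
          qg' : ∀ x → Q x → Q (g x)
          qg' x q with ~-dec x₀ x
          ... | yes p = q~ (~-sym (~-iter s)) (subst Q (g-on p) (qg x q))
          ... | no np = subst Q (g-off np) (qg x q)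
          qb' : ∀ x → Q x → Q (b x)
          qb' x q = q~ (gb~ x) (qg' x q)

  module _ {x₀ s t'} (x~r : x₀ ~ r x₀) (nz : ¬ ZC x₀) (W : TwR x₀ s t') where
    open TwR W
    open TwRFacts x~r nz W

    prodT-off : ∀ {x} → ¬ x₀ ~ x → prodT t' x ≡ prodT t x
    prodT-off {x} np = trans (cong (Trip.r t') (T-same x)) (r-off (λ p → np (~-trans p (~-sym ~-step))))

    prodT-on : ∀ {x} → x₀ ~ x → prodT t' x ≡ iter T s (P x)
    prodT-on {x} p = trans (cong (Trip.r t') (T-same x)) (r-on (~-trans p ~-step))

    prodT-twR : ∀ x → InZ x → prodT t' x ≡ prodT t x
    prodT-twR x zx = prodT-off (λ p → nz (_ , p , zx))

    private
      FixS : ℕ → Tag → Fin m → Set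
      FixS s tG y = g y ≡ y
      FixS s tB y = b y ≡ y
      FixS s tR y = pick (~-dec x₀ y) (iter T s (r y)) (r y) ≡ y
      FixS s tP y = pick (~-dec x₀ y) (iter T s (P y)) (P y) ≡ y

      θ θ⁻ : Tag × Fin m → Tag × Fin m
      θ (tR , y) = pick (~-dec x₀ y) tP tR , y
      θ (tP , y) = pick (~-dec x₀ y) tR tP , pick (~-dec x₀ y) (T y) y
      θ (tG , y) = tG , y
      θ (tB , y) = tB , y
      θ⁻ (tP , y) = pick (~-dec x₀ y) tR tP , y
      θ⁻ (tR , y) = pick (~-dec x₀ y) tP tR , pick (~-dec x₀ y) (T⁻ y) y
      θ⁻ (tG , y) = tG , y
      θ⁻ (tB , y) = tB , y

      θθ : ∀ φ → θ⁻ (θ φ) ≡ φ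
      θθ (tG , y) = refl
      θθ (tB , y) = refl
      θθ (tR , y) with ~-dec x₀ y in eq
      ... | yes p rewrite eq = refl
      ... | no np rewrite eq = refl
      θθ (tP , y) with ~-dec x₀ y in eq
      ... | yes p = cong₂ _,_ (pick-yes (~-dec x₀ (T y)) (~-trans p ~-step)) (trans (pick-yes (~-dec x₀ (T y)) (~-trans p ~-step)) (T⁻T y))
      ... | no np rewrite eq = refl

      fix-step : ∀ s τ y → FixS s τ y → FixS (suc s) (proj₁ (θ (τ , y))) (proj₂ (θ (τ , y)))
      fix-step s tG y e = e
      fix-step s tB y e = e
      fix-step s tR y e with ~-dec x₀ y in eq
      ... | yes p rewrite eq = trans (sym (iter-shift T s (P y))) (trans (cong (iter T s) (trans (cong T (r-flip p 1)) (TT⁻ (r y)))) e)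
      ... | no np rewrite eq = e
      fix-step s tP y e with ~-dec x₀ y in eq
      ... | yes p = trans (pick-yes (~-dec x₀ (T y)) (~-trans p ~-step)) (cong T e)
      ... | no np rewrite eq = e

      fix-0 : ∀ τ y → Fix t τ y → FixS 0 τ y
      fix-0 tG y e = e
      fix-0 tB y e = e
      fix-0 tR y e with ~-dec x₀ y
      ... | yes _ = e
      ... | no _ = e
      fix-0 tP y e with ~-dec x₀ y
      ... | yes _ = e
      ... | no _ = e

      fix-s : ∀ τ y → FixS s τ y → Fix t' τ y
      fix-s tG y e = trans (g-all y) e
      fix-s tB y e = trans (b-all y) e
      fix-s tR y e with ~-dec x₀ y
      ... | yes p = trans (r-on p) e
      ... | no np = trans (r-off np) e
      fix-s tP y e with ~-dec x₀ y
      ... | yes p = trans (prodT-on p) e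
      ... | no np = trans (prodT-off np) e

      enumS : ∀ s → Enum (2 + d) (FixS s)
      enumS zero = enum-map (Fix t) (FixS 0) id id (λ _ → refl) fix-0 enum
      enumS (suc s) = enum-map (FixS s) (FixS (suc s)) θ θ⁻ θθ (fix-step s) (enumS s)

    opaque
      good-twR : Good t' d z₀
      good-twR = mkGood Γ inv' prodT-twR zz conn' (enum-map (FixS s) (Fix t') id id (λ _ → refl) fix-s (enumS s))
        where
        zz : ∀ x → Alg.InZ t' inv' x → InZ x
        zz x zx e = go (~-dec x₀ x)
          where
          go : Dec (x₀ ~ x) → ⊥
          go (no np) = zx (trans (prodT-off (λ p → np (back p))) (trans (cong P (prodT-off np)) e))
            where
            back : x₀ ~ prodT t' x → x₀ ~ x
            back p = ~-trans (subst (x₀ ~_) (rr _) (r-class (subst (x₀ ~_) (prodT-off np) p))) (~-sym ~-step)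
          -- On the twisted class the new `r` still reverses `T`, so two turns of the new `P` give
          -- the identity and no new direction of angle at least 3π appears.
          go (yes p) = zx (trans (cong (prodT t') (prodT-on p)) (trans (prodT-on (~-trans (r-class (~-trans p ~-step)) (~-iter s)))
            (trans (cong (iter T s) (trans (r-flip (r-class (~-trans p ~-step)) (suc s)) (cong T⁻ (cong (iter T⁻ s) (rr (T x))))))
              (trans (cong (iter T s) (trans (sym (iter-shift T⁻ s (T x))) (cong (iter T⁻ s) (T⁻T x)))) (ff⁻k s x)))))
        conn' : (Q : Fin m → Set) → (∀ x → Q x → Q (Trip.r t' x)) → (∀ x → Q x → Q (Trip.g t' x)) →
           (∀ x → Q x → Q (Trip.b t' x)) → ∀ x y → Q x → Q y
        conn' Q qr qg qb = conn Q qr' (λ x q → subst Q (g-all x) (qg x q)) (λ x q → subst Q (b-all x) (qb x q))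
          where
          q~ : ∀ {x y} → x ~ y → Q x → Q y
          q~ = closed-~ Q (λ x q → subst Q (T-same x) (qg _ (qb _ q)))
          qr' : ∀ x → Q x → Q (r x)
          qr' x q with ~-dec x₀ x
          ... | yes p = q~ (~-sym (~-iter s)) (subst Q (r-on p) (qr x q))
          ... | no np = subst Q (r-off np) (qr x q)

-- Lifting shears to the double cover

-- o = true names the colours (r, g, b) = (R, G, B), and o = false (r, g, b) = (B, G, R)
cr cb : Bool → Colour
cr true = R
cr false = B
cb true = B
cb false = R

moving : Bool → Colour → Bool
moving true R = false
moving true G = true
moving true B = true
moving false R = true
moving false G = true
moving false B = false

moving-G : ∀ o → moving o G ≡ true
moving-G true = refl
moving-G false = refl

moving-cb : ∀ o → moving o (cb o) ≡ true
moving-cb true = refl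
moving-cb false = refl

moving-cr : ∀ o → moving o (cr o) ≡ false
moving-cr true = refl
moving-cr false = refl

moving-other : ∀ o c → c ≢ cb o → c ≢ G → moving o c ≡ false
moving-other true R _ _ = refl
moving-other true G _ q = ⊥-elim (q refl)
moving-other true B p _ = ⊥-elim (p refl)
moving-other false R p _ = ⊥-elim (p refl)
moving-other false G _ q = ⊥-elim (q refl)
moving-other false B _ _ = refl

colours : ∀ o c → c ≡ cr o ⊎ c ≡ G ⊎ c ≡ cb o
colours true R = inj₁ refl
colours true G = inj₂ (inj₁ refl)
colours true B = inj₂ (inj₂ refl)
colours false R = inj₂ (inj₂ refl)
colours false G = inj₂ (inj₁ refl)
colours false B = inj₁ refl

cylPair : ∀ {n} o → CylPair {n} (cb o) G
cylPair true = inj₂ (inj₁ (refl , refl))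
cylPair false = inj₂ (inj₂ (inj₁ (refl , refl)))

hat : ∀ {n} → Bool → Tri n → Trip n
hat o τ = trip (τ (cr o)) (τ G) (τ (cb o))

module Strip {n : ℕ} (o : Bool) (τ : Tri n) (ττ : ∀ c y → τ c (τ c y) ≡ y) where

  hatInv : Inv (hat o τ)
  hatInv = inv (ττ (cr o)) (ττ G) (ττ (cb o))

  open Alg (hat o τ) hatInv

  InStrip : Fin n → Fin n → Set
  InStrip x y = x ~ y ⊎ x ~ g y

  InStrip? : ∀ x y → Dec (InStrip x y)
  InStrip? x y = ~-dec x y ⊎-dec ~-dec x (g y)

  strip-g : ∀ {x y} → InStrip x y → InStrip x (g y)
  strip-g {x} {y} (inj₁ p) = inj₂ (subst (x ~_) (sym (gg y)) p)
  strip-g (inj₂ p) = inj₁ p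

  strip-b : ∀ {x y} → InStrip x y → InStrip x (b y)
  strip-b (inj₁ p) = inj₂ (~-trans p ~-step)
  strip-b {x} {y} (inj₂ p) = inj₁ (~-trans p (gb~ y))

  strip-iter : ∀ {x y} k → InStrip x y → InStrip x (iter T k y)
  strip-iter zero p = p
  strip-iter (suc k) p = strip-g (strip-b (strip-iter k p))

  module Sheared (x : Fin n) where

    -- The shear replaces `b` by `g`, which is `T b`, and `g` by `g b g`, which is `T g`, and it
    -- preserves `T` on the strip. Its `s`-th power is therefore composition of both with the `s`-th
    -- power of `T`.
    sheared : ℕ → Tri n
    sheared s c y = if moving o c then pick (InStrip? x y) (iter T s (τ c y)) (τ c y) else τ c y

    on : ∀ s c {y} → moving o c ≡ true → InStrip x y → sheared s c y ≡ iter T s (τ c y)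
    on s c {y} mv p rewrite mv = pick-yes (InStrip? x y) p

    off : ∀ s c {y} → ¬ InStrip x y → sheared s c y ≡ τ c y
    off s c {y} np with moving o c
    ... | true = pick-no (InStrip? x y) np
    ... | false = refl

    still : ∀ s c y → moving o c ≡ false → sheared s c y ≡ τ c y
    still s c y mv rewrite mv = refl

    module _ (s : ℕ) (σ : Tri n) (σ≗ : ∀ c y → σ c y ≡ sheared s c y) where

      σg : ∀ {y} → InStrip x y → σ G y ≡ iter T s (g y)
      σg p = trans (σ≗ G _) (on s G (moving-G o) p)

      σb : ∀ {y} → InStrip x y → σ (cb o) y ≡ iter T s (b y)
      σb p = trans (σ≗ (cb o) _) (on s (cb o) (moving-cb o) p)

      σT : ∀ {y} → InStrip x y → σ G (σ (cb o) y) ≡ T y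
      σT {y} p = trans (cong (σ G) (σb p)) (trans (σg (strip-iter s (strip-b p)))
                   (trans (cong (iter T s) (gTk s (b y))) (ff⁻k s _)))

      σgg : ∀ {y} → InStrip x y → σ G (σ G y) ≡ y
      σgg {y} p = trans (cong (σ G) (σg p)) (trans (σg (strip-iter s (strip-g p)))
                   (trans (cong (iter T s) (gTk s (g y))) (trans (ff⁻k s _) (gg y))))

      comp⇒strip : ∀ w → All (λ c → c ≡ cb o ⊎ c ≡ G) w → InStrip x (act σ w x)
      comp⇒strip [] [] = inj₁ ~-refl
      comp⇒strip (c ∷ w) (inj₁ refl ∷ ps) = subst (InStrip x) (sym (σb ih)) (strip-iter s (strip-b ih))
        where
        ih : InStrip x (act σ w x)
        ih = comp⇒strip w ps
      comp⇒strip (c ∷ w) (inj₂ refl ∷ ps) = subst (InStrip x) (sym (σg ih)) (strip-iter s (strip-g ih))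
        where
        ih : InStrip x (act σ w x)
        ih = comp⇒strip w ps

      orbit⇒comp : ∀ k → InComp σ (cb o) G x (iter T k x)
      orbit⇒comp zero = [] , [] , refl
      orbit⇒comp (suc k) with orbit⇒comp k
      ... | w , ps , e = G ∷ cb o ∷ w , inj₂ refl ∷ inj₁ refl ∷ ps ,
              trans (cong (λ v → σ G (σ (cb o) v)) e) (σT (inj₁ (~-iter k)))

      strip⇒comp : ∀ {y} → InStrip x y → InComp σ (cb o) G x y
      strip⇒comp (inj₁ (k , refl)) = orbit⇒comp k
      strip⇒comp {y} p@(inj₂ q) with subst (x ~_) (sym (σg p)) (~-trans q (~-iter s))
      ... | k , e with orbit⇒comp k
      ...   | w , ps , e' = G ∷ w , inj₂ refl ∷ ps , trans (cong (σ G) (trans e' e)) (σgg p)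

      shear-step : ShearRel σ (cb o) G x (sheared (suc s))
      shear-step y = inside , outside , λ c c≢b c≢g → trans (still (suc s) c y (moving-other o c c≢b c≢g))
                                                       (sym (trans (σ≗ c y) (still s c y (moving-other o c c≢b c≢g))))
        where
        inside : InComp σ (cb o) G x y → sheared (suc s) (cb o) y ≡ σ G y × sheared (suc s) G y ≡ σ G (σ (cb o) (σ G y))
        inside (w , ps , refl) =
            trans (on (suc s) (cb o) (moving-cb o) p) (trans (sym (iter-shift T s (b y))) (trans (cong (iter T s ∘ g) (bb y)) (sym (σg p)))) ,
            trans (on (suc s) G (moving-G o) p) (sym (trans (cong (λ v → σ G (σ (cb o) v)) (σg p)) (σT (strip-iter s (strip-g p)))))
          where
          p : InStrip x y
          p = comp⇒strip w ps
        outside : ¬ InComp σ (cb o) G x y → sheared (suc s) (cb o) y ≡ σ (cb o) y × sheared (suc s) G y ≡ σ G y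
        outside nc = trans (off (suc s) (cb o) np) (sym (trans (σ≗ (cb o) y) (off s (cb o) np))) ,
                     trans (off (suc s) G np) (sym (trans (σ≗ G y) (off s G np)))
          where
          np : ¬ InStrip x y
          np p = nc (strip⇒comp p)

    shears : ∀ s → ShearIter (cb o) G x (suc s) τ (sheared (suc s))
    shears zero = ShearIter.step ShearIter.zero (shear-step 0 τ (λ c y → sym (sheared-0 c y)))
      where
      sheared-0 : ∀ c y → sheared 0 c y ≡ τ c y
      sheared-0 c y with moving o c
      ... | false = refl
      ... | true with InStrip? x y
      ...   | yes _ = refl
      ...   | no _ = refl
    shears (suc s) = ShearIter.step (shears s) (shear-step (suc s) (sheared (suc s)) (λ _ _ → refl))

    ShearPow : ℕ → Set
    ShearPow s = ∃ λ τ' → (∃ λ k → k ≤ 1 × ShearSeq k τ τ') ×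
                 (∀ {y} c → moving o c ≡ true → InStrip x y → τ' c y ≡ iter T s (τ c y)) ×
                 (∀ {y} c → ¬ InStrip x y → τ' c y ≡ τ c y) ×
                 (∀ c y → moving o c ≡ false → τ' c y ≡ τ c y)

    opaque
      shearPow : ∀ s → ShearPow s
      -- A power of a shear must have positive exponent, so the zeroth power is rendered by the
      -- empty sequence.
      shearPow zero = τ , (0 , z≤n , nil) , (λ _ _ _ → refl) , (λ _ _ → refl) , λ _ _ _ → refl
      shearPow (suc s) = sheared (suc s) ,
        (1 , ≤-refl , cons (cb o , G , cylPair {n} o , x , suc s , s≤s z≤n , shears s) nil) ,
        (λ c mv p → on (suc s) c mv p) , (λ c np → off (suc s) c np) , still (suc s)

-- τ is the orientation double cover of t, with sheets distinguished by A
record Cov {n m} (o : Bool) (τ : Tri n) (t : Trip m) : Set where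
  field
    π     : Fin n → Fin m
    A     : Fin n → Bool
    sec   : Fin m → Bool → Fin n
    π-sec : ∀ x β → π (sec x β) ≡ x
    A-sec : ∀ x β → A (sec x β) ≡ β
    sec-π : ∀ y → sec (π y) (A y) ≡ y
    πr    : ∀ y → π (τ (cr o) y) ≡ Trip.r t (π y)
    πg    : ∀ y → π (τ G y) ≡ Trip.g t (π y)
    πb    : ∀ y → π (τ (cb o) y) ≡ Trip.b t (π y)
    flip  : ∀ c y → A (τ c y) ≡ not (A y)

  lift-≡ : ∀ {y y'} → π y ≡ π y' → A y ≡ A y' → y ≡ y'
  lift-≡ {y} {y'} e e' = trans (sym (sec-π y)) (trans (cong₂ sec e e') (sec-π y'))

  cov-inv : Inv t → ∀ c y → τ c (τ c y) ≡ y
  cov-inv I c y = lift-≡ (base (colours o c)) (trans (flip c _) (trans (cong not (flip c y)) (not-involutive _)))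
    where
    open Inv I
    base : c ≡ cr o ⊎ c ≡ G ⊎ c ≡ cb o → π (τ c (τ c y)) ≡ π y
    base (inj₁ refl) = trans (πr _) (trans (cong (Trip.r t) (πr y)) (rr _))
    base (inj₂ (inj₁ refl)) = trans (πg _) (trans (cong (Trip.g t) (πg y)) (gg _))
    base (inj₂ (inj₂ refl)) = trans (πb _) (trans (cong (Trip.b t) (πb y)) (bb _))

-- All covers of `t` are treated at once. Moves can then be composed, and a path found from the
-- second surface can be run backwards from whatever cover of the canonical form the first one has
-- reached.
Lift : ∀ {m} → Bool → ℕ → Trip m → Trip m → Set
Lift o K t t' = ∀ {n} (τ : Tri n) → Cov o τ t → ∃ λ τ' → (∃ λ k → k ≤ K × ShearSeq k τ τ') × Cov o τ' t'

seq-++ : ∀ {n k l} {τ τ' τ'' : Tri n} → ShearSeq k τ τ' → ShearSeq l τ' τ'' → ShearSeq (k + l) τ τ''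
seq-++ nil q = q
seq-++ (cons p ps) q = cons p (seq-++ ps q)

lift-trans : ∀ {m o K L} {t t' t'' : Trip m} → Lift o K t t' → Lift o L t' t'' → Lift o (K + L) t t''
lift-trans f h τ C with f τ C
... | τ' , (k , k≤ , s) , C' with h τ' C'
...   | τ'' , (l , l≤ , s') , C'' = τ'' , (k + l , +-mono-≤ k≤ l≤ , seq-++ s s') , C''

record Link {m} (K : ℕ) (t t' : Trip m) : Set where
  constructor link
  field
    there : ∀ o → Lift o K t t'
    back  : ∀ o → Lift o K t' t

link-trans : ∀ {m K L} {t t' t'' : Trip m} → Link K t t' → Link L t' t'' → Link (K + L) t t''
link-trans {K = K} {L} {t} {t'} {t''} (link a b) (link c e) = link (λ o → lift-trans {t = t} {t'} {t''} (a o) (c o))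
  (λ o → subst (λ N → Lift o N t'' t) (+-comm L K) (lift-trans {t = t''} {t'} {t} (e o) (b o)))

link-refl : ∀ {m} {t : Trip m} → Link 0 t t
link-refl = link (λ _ τ C → τ , (0 , z≤n , nil) , C) (λ _ τ C → τ , (0 , z≤n , nil) , C)

link-≤ : ∀ {m K L} {t t' : Trip m} → K ≤ L → Link K t t' → Link L t t'
link-≤ {t = t} {t'} K≤L (link a b) = link (λ o → wk {t} {t'} o (a o)) (λ o → wk {t'} {t} o (b o))
  where
  wk : ∀ {t t'} o → Lift o _ t t' → Lift o _ t t'
  wk o f τ C with f τ C
  ... | τ' , (k , k≤ , s) , C' = τ' , (k , ≤-trans k≤ K≤L , s) , C'

cov-swap : ∀ {n m} o {τ : Tri n} {t : Trip m} → Cov o τ (swapRB t) → Cov (not o) τ t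
cov-swap true C = record { Cov C ; πr = Cov.πb C ; πb = Cov.πr C }
cov-swap false C = record { Cov C ; πr = Cov.πb C ; πb = Cov.πr C }

cov-swap⁻ : ∀ {n m} o {τ : Tri n} {t : Trip m} → Cov (not o) τ t → Cov o τ (swapRB t)
cov-swap⁻ true C = record { Cov C ; πr = Cov.πb C ; πb = Cov.πr C }
cov-swap⁻ false C = record { Cov C ; πr = Cov.πb C ; πb = Cov.πr C }

link-swap : ∀ {m K} {t t' : Trip m} → Link K t t' → Link K (swapRB t) (swapRB t')
link-swap {t = t} {t'} (link a b) = link (λ o → sw {t} {t'} o (a (not o))) (λ o → sw {t'} {t} o (b (not o)))
  where
  sw : ∀ {t t'} o → Lift (not o) _ t t' → Lift o _ (swapRB t) (swapRB t')
  sw o f τ C with f τ (cov-swap o C)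
  ... | τ' , s , C' = τ' , s , cov-swap⁻ o C'

module LiftG {m : ℕ} (t : Trip m) (I : Inv t) where
  open Alg t I
  open Twist t I

  module _ {n : ℕ} {o : Bool} {τ : Tri n} (C : Cov o τ t) where
    open Cov C
    open Strip o τ (cov-inv I)
    private module H = Alg (hat o τ) hatInv

    πT : ∀ y → π (H.T y) ≡ T (π y)
    πT y = trans (πg _) (cong g (πb y))

    πTk : ∀ k y → π (iter H.T k y) ≡ iter T k (π y)
    πTk zero y = refl
    πTk (suc k) y = trans (πT _) (cong T (πTk k y))

    AT : ∀ y → A (H.T y) ≡ A y
    AT y = trans (flip G _) (trans (cong not (flip (cb o) y)) (not-involutive _))

    ATk : ∀ k y → A (iter H.T k y) ≡ A y
    ATk zero y = refl
    ATk (suc k) y = trans (AT _) (ATk k y)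

    orbit-down : ∀ {x y} → x H.~ y → (π x ~ π y) × A y ≡ A x
    orbit-down {x} (k , refl) = (k , sym (πTk k x)) , ATk k x

    orbit-up : ∀ {x y} → π x ~ π y → A y ≡ A x → x H.~ y
    orbit-up {x} {y} (k , e) a = k , lift-≡ (trans (πTk k x) e) (trans (ATk k x) (sym a))

    true-or-flip : ∀ y → A y ≡ true ⊎ A (τ G y) ≡ true
    true-or-flip y with A y in e
    ... | true = inj₁ refl
    ... | false = inj₂ (trans (flip G y) (cong not e))

    A-shift : ∀ s c y → A (iter H.T s (τ c y)) ≡ not (A y)
    A-shift s c y = trans (ATk s _) (flip c y)

  opaque
    -- A strip that is a path has two lifted classes, exchanged by `g`. Together they form one
    -- cylinder, so one cylinder shear covers the twist.
    liftG : ∀ {x₀ s t'} → x₀ ~ g x₀ → TwG x₀ s t' → ∀ o → Lift o 1 t t'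
    liftG {x₀} {s} {t'} x~g W o {n} τ C = go (shearPow s)
      where
      open TwG W
      open TwGFacts x~g W
      open Cov C
      open Strip o τ (cov-inv I)
      x̂ : Fin n
      x̂ = sec x₀ true
      open Sheared x̂
      down : ∀ {y} → InStrip x̂ y → x₀ ~ π y
      down {y} (inj₁ p) = subst (_~ π y) (π-sec x₀ true) (proj₁ (orbit-down C p))
      down {y} (inj₂ p) = subst (x₀ ~_) (gg (π y)) (g-class (~-cast (π-sec x₀ true) (πg y) (proj₁ (orbit-down C p))))
      up : ∀ {y} → x₀ ~ π y → InStrip x̂ y
      up {y} p with true-or-flip C y
      ... | inj₁ a = inj₁ (orbit-up C (subst (_~ π y) (sym (π-sec x₀ true)) p) (trans a (sym (A-sec x₀ true))))
      ... | inj₂ a = inj₂ (orbit-up C (~-trans (~-≡ (π-sec x₀ true)) (~-trans (g-class p) (~-≡ (sym (πg y))))) (trans a (sym (A-sec x₀ true))))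
      go : ShearPow s → ∃ λ τ' → (∃ λ k → k ≤ 1 × ShearSeq k τ τ') × Cov o τ' t'
      go (τ' , sq , on' , off' , still') = τ' , sq , record
        { π = π ; A = A ; sec = sec ; π-sec = π-sec ; A-sec = A-sec ; sec-π = sec-π
        ; πr = λ y → trans (cong π (still' (cr o) y (moving-cr o))) (trans (πr y) (sym (r-all _)))
        ; πg = πg' ; πb = πb' ; flip = flip' }
        where
        πg' : ∀ y → π (τ' G y) ≡ Trip.g t' (π y)
        πg' y with ~-dec x₀ (π y)
        ... | yes p = trans (cong π (on' G (moving-G o) (up p))) (trans (πTk C s _) (trans (cong (iter T s) (πg y)) (sym (g-on p))))
        ... | no np = trans (cong π (off' G (λ q → np (down q)))) (trans (πg y) (sym (g-off np)))
        πb' : ∀ y → π (τ' (cb o) y) ≡ Trip.b t' (π y)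
        πb' y with ~-dec x₀ (π y)
        ... | yes p = trans (cong π (on' (cb o) (moving-cb o) (up p))) (trans (πTk C s _) (trans (cong (iter T s) (πb y)) (sym (b-on p))))
        ... | no np = trans (cong π (off' (cb o) (λ q → np (down q)))) (trans (πb y) (sym (b-off np)))
        flip' : ∀ c y → A (τ' c y) ≡ not (A y)
        flip' c y with ~-dec x₀ (π y) | colours o c
        ... | no np | _ = trans (cong A (off' c (λ q → np (down q)))) (flip c y)
        ... | yes p | inj₁ refl = trans (cong A (still' (cr o) y (moving-cr o))) (flip c y)
        ... | yes p | inj₂ (inj₁ refl) = trans (cong A (on' G (moving-G o) (up p))) (A-shift C s G y)
        ... | yes p | inj₂ (inj₂ refl) = trans (cong A (on' (cb o) (moving-cb o) (up p))) (A-shift C s (cb o) y)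

  -- The class of x₀ lifts to two classes exchanged by r; shearing only the strip through
  -- one of them rotates that lift, which amounts to rotating r on the class below.
  opaque
    liftR : ∀ {x₀ s t'} → x₀ ~ r x₀ → (∀ {y} → x₀ ~ y → r (T y) ≡ T⁻ (r y)) → ¬ x₀ ~ g x₀ → TwR x₀ s t' →
            ∀ o → Lift o 1 t t'
    liftR {x₀} {s₀} {t'} x~r rflip x≁g W o {n} τ C = go (shearPow s)
      where
      open TwR W
      open Cov C
      open Strip o τ (cov-inv I)
      s : ℕ
      -- Rotating the upper lift backwards by `s` composes `r` below with `T⁻` to the power `s`; for
      -- this `s` that is the desired forward rotation by `s₀`.
      s = per x₀ * s₀
      x̂ : Fin n
      x̂ = sec x₀ true
      open Sheared x̂
      module H = Alg (hat o τ) hatInv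
      rTs : ∀ {y} → x₀ ~ y → ∀ k → r (iter T k y) ≡ iter T⁻ k (r y)
      rTs p zero = refl
      rTs p (suc k) = trans (rflip (~-trans p (~-iter k))) (cong T⁻ (rTs p k))
      rTs⁻ : ∀ {y} → x₀ ~ y → ∀ k → r (iter T⁻ k y) ≡ iter T k (r y)
      rTs⁻ p k = trans (sym (ff⁻k k _)) (cong (iter T k) (trans (sym (rTs (~-trans p (~-iter⁻ k)) k)) (cong r (ff⁻k k _))))
      r-class : ∀ {y} → x₀ ~ y → x₀ ~ r y
      r-class (k , refl) = ~-trans x~r (subst (r x₀ ~_) (sym (rTs ~-refl k)) (~-iter⁻ k))
      r-class⁻ : ∀ {y} → ¬ x₀ ~ y → ¬ x₀ ~ r y
      r-class⁻ {y} np p = np (subst (x₀ ~_) (rr y) (r-class p))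
      r-on' : ∀ {y} → x₀ ~ y → Trip.r t' y ≡ iter T⁻ s (r y)
      r-on' p = trans (r-on p) (forward-as-back (r-class p) s₀)
      Up : Fin n → Set
      Up y = x₀ ~ π y × A y ≡ true
      Up? : ∀ y → Dec (Up y)
      Up? y = ~-dec x₀ (π y) ×-dec (A y Data.Bool.≟ true)
      Up-orbit : ∀ {y} → x̂ H.~ y → Up y
      Up-orbit p = ~-trans (~-≡ (sym (π-sec x₀ true))) (proj₁ (orbit-down C p)) , trans (proj₂ (orbit-down C p)) (A-sec x₀ true)
      orbit-Up : ∀ {y} → Up y → x̂ H.~ y
      orbit-Up (p , a) = orbit-up C (~-trans (~-≡ (π-sec x₀ true)) p) (trans a (sym (A-sec x₀ true)))
      π' : Fin n → Fin m
      π' y = pick (Up? y) (iter T⁻ s (π y)) (π y)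
      π'-up : ∀ {y} → Up y → π' y ≡ iter T⁻ s (π y)
      π'-up {y} u = pick-yes (Up? y) u
      π'-off : ∀ {y} → ¬ Up y → π' y ≡ π y
      π'-off {y} u = pick-no (Up? y) u
      tf : ∀ {a : Bool} → a ≡ true → a ≡ false → ⊥
      tf refl ()
      down-A : ∀ {y} → A y ≡ true → ∀ c → A (τ c y) ≡ false
      down-A a c = trans (flip c _) (cong not a)
      true-A : ∀ {y} c → A (τ c y) ≡ true → A y ≡ false
      true-A {y} c a = trans (sym (not-involutive (A y))) (cong not (trans (sym (flip c y)) a))
      go : ShearPow s → ∃ λ τ' → (∃ λ k → k ≤ 1 × ShearSeq k τ τ') × Cov o τ' t'
      go (τ' , sq , on' , off' , still') = τ' , sq , record
        { π = π' ; A = A ; sec = sec' ; π-sec = π-sec' ; A-sec = A-sec' ; sec-π = sec-π'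
        ; πr = πr' ; πg = λ y → trans (πgb' G g (moving-G o) πg (gTk) (λ {y} p → p) (λ {y} p → p) y) (sym (g-all _))
        ; πb = λ y → trans (πgb' (cb o) b (moving-cb o) πb (bTk) (λ {y} p → ~-trans p (~-sym (gb~ y))) (λ {y} p → ~-trans p (gb~ y)) y) (sym (b-all _))
        ; flip = flip' }
        where
        sec' : Fin m → Bool → Fin n
        sec' x β = pick (~-dec x₀ x ×-dec (β Data.Bool.≟ true)) (sec (iter T s x) β) (sec x β)
        π-sec' : ∀ x β → π' (sec' x β) ≡ x
        π-sec' x β with ~-dec x₀ x ×-dec (β Data.Bool.≟ true)
        ... | yes (p , a) = trans (π'-up (subst (x₀ ~_) (sym (π-sec _ β)) (~-trans p (~-iter s)) , trans (A-sec _ β) a))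
                              (trans (cong (iter T⁻ s) (π-sec _ β)) (f⁻fk s x))
        ... | no np = trans (π'-off (λ { (p , a) → np (subst (x₀ ~_) (π-sec x β) p , trans (sym (A-sec x β)) a) })) (π-sec x β)
        A-sec' : ∀ x β → A (sec' x β) ≡ β
        A-sec' x β with ~-dec x₀ x ×-dec (β Data.Bool.≟ true)
        ... | yes _ = A-sec _ β
        ... | no _ = A-sec x β
        sec-π' : ∀ y → sec' (π' y) (A y) ≡ y
        sec-π' y with Up? y
        ... | yes (p , a) = trans (pick-yes (~-dec x₀ _ ×-dec (A y Data.Bool.≟ true)) (~-trans p (~-iter⁻ s) , a))
                              (trans (cong (λ v → sec v (A y)) (ff⁻k s (π y))) (sec-π y))
        ... | no np = trans (pick-no (~-dec x₀ _ ×-dec (A y Data.Bool.≟ true)) np) (sec-π y)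
        πr' : ∀ y → π' (τ' (cr o) y) ≡ Trip.r t' (π' y)
        πr' y = trans (cong π' (still' (cr o) y (moving-cr o))) (by (Up? y) (~-dec x₀ (π y)))
          where
          by : Dec (Up y) → Dec (x₀ ~ π y) → π' (τ (cr o) y) ≡ Trip.r t' (π' y)
          by (yes u@(p , a)) _ = trans (π'-off (λ { (_ , a') → tf a' (down-A a (cr o)) })) (trans (πr y)
            (sym (trans (cong (Trip.r t') (π'-up u)) (trans (r-on' (~-trans p (~-iter⁻ s)))
              (trans (cong (iter T⁻ s) (rTs⁻ p s)) (f⁻fk s _))))))
          by (no nu) (yes p) = trans (π'-up (subst (x₀ ~_) (sym (πr y)) (r-class p) , trans (flip (cr o) y) (cong not af)))
            (trans (cong (iter T⁻ s) (πr y)) (sym (trans (cong (Trip.r t') (π'-off nu)) (r-on' p))))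
            where
            af : A y ≡ false
            af = ¬-not (λ e → nu (p , e))
          by (no nu) (no np) = trans (π'-off (λ { (p , _) → r-class⁻ np (subst (x₀ ~_) (πr y) p) })) (trans (πr y)
            (sym (trans (cong (Trip.r t') (π'-off nu)) (r-off np))))
        πgb' : ∀ c (h : Fin m → Fin m) → moving o c ≡ true → (∀ y → π (τ c y) ≡ h (π y)) → (∀ k x → h (iter T k x) ≡ iter T⁻ k (h x)) →
               (∀ {y} → x₀ ~ h y → x₀ ~ g y) → (∀ {y} → x₀ ~ g y → x₀ ~ h y) → ∀ y → π' (τ' c y) ≡ h (π' y)
        πgb' c h mv πh hT hg gh y = by (Up? y) (~-dec x₀ (g (π y))) (A y Data.Bool.≟ false)
          where
          h⁻ : ∀ k x → h (iter T⁻ k x) ≡ iter T k (h x)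
          h⁻ k x = trans (sym (ff⁻k k _)) (cong (iter T k) (trans (sym (hT k _)) (cong h (ff⁻k k x))))
          by : Dec (Up y) → Dec (x₀ ~ g (π y)) → Dec (A y ≡ false) → π' (τ' c y) ≡ h (π' y)
          by (yes u@(p , a)) _ _ = trans (cong π' (on' c mv (inj₁ (orbit-Up u))))
            (trans (π'-off (λ { (_ , a') → tf a' (trans (A-shift C s c y) (cong not a)) }))
              (trans (πTk C s _) (trans (cong (iter T s) (πh y)) (sym (trans (cong h (π'-up u)) (h⁻ s (π y)))))))
          by (no nu) (yes p) (yes af) = trans (cong π' (on' c mv (inj₂ (orbit-Up (subst (x₀ ~_) (sym (πg y)) p , trans (flip G y) (cong not af))))))
            (trans (π'-up (~-trans (gh p) (~-trans (~-iter s) (~-≡ (sym (trans (πTk C s _) (cong (iter T s) (πh y)))))) , trans (A-shift C s c y) (cong not af)))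
              (trans (cong (iter T⁻ s) (trans (πTk C s _) (cong (iter T s) (πh y)))) (trans (f⁻fk s _) (cong h (sym (π'-off nu))))))
          by (no nu) (no np) _ = out (λ p → np (hg p)) (λ u → np (subst (x₀ ~_) (πg y) (proj₁ u)))
            where
            out : ¬ x₀ ~ h (π y) → ¬ Up (τ G y) → π' (τ' c y) ≡ h (π' y)
            out nh nG = trans (cong π' (off' c (λ { (inj₁ q) → nu (Up-orbit q) ; (inj₂ q) → nG (Up-orbit q) })))
              (trans (π'-off (λ { (q , _) → nh (subst (x₀ ~_) (πh y) q) })) (trans (πh y) (cong h (sym (π'-off nu)))))
          by (no nu) (yes p) (no na) = trans (cong π' (off' c (λ { (inj₁ q) → nu (Up-orbit q) ; (inj₂ q) → na (true-A G (proj₂ (Up-orbit q))) })))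
            (trans (π'-off (λ { (_ , a) → na (true-A c a) })) (trans (πh y) (cong h (sym (π'-off nu)))))
        flip' : ∀ c y → A (τ' c y) ≡ not (A y)
        flip' c y = by (InStrip? x̂ y) (colours o c)
          where
          by : Dec (InStrip x̂ y) → c ≡ cr o ⊎ c ≡ G ⊎ c ≡ cb o → A (τ' c y) ≡ not (A y)
          by (no np) _ = trans (cong A (off' c np)) (flip c y)
          by (yes p) (inj₁ refl) = trans (cong A (still' (cr o) y (moving-cr o))) (flip c y)
          by (yes p) (inj₂ (inj₁ refl)) = trans (cong A (on' G (moving-G o) p)) (A-shift C s G y)
          by (yes p) (inj₂ (inj₂ refl)) = trans (cong A (on' (cb o) (moving-cb o) p)) (A-shift C s (cb o) y)

~-transport : ∀ {m} {t t' : Trip m} (I : Inv t) (I' : Inv t') → (∀ y → Trip.g t' (Trip.b t' y) ≡ Trip.g t (Trip.b t y)) →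
              ∀ {x y} → Orbit._~_ (Alg.T t I) (Alg.T⁻ t I) (Alg.TT⁻ t I) (Alg.T⁻T t I) x y →
              Orbit._~_ (Alg.T t' I') (Alg.T⁻ t' I') (Alg.TT⁻ t' I') (Alg.T⁻T t' I') x y
~-transport I I' e {x} (k , p) = k , trans (iter-cong e k x) p

module _ {m : ℕ} (t : Trip m) (I : Inv t) where
  open Alg t I
  open Twist t I

  opaque
    linkG : ∀ {x₀ s t'} → x₀ ~ g x₀ → TwG x₀ s t' → Link 1 t t'
    linkG {x₀} {s} {t'} x~g W = link (LiftG.liftG t I x~g W) (LiftG.liftG t' inv' x~g' back)
      where
      open TwG W
      open TwGFacts x~g W
      module D = Alg t' inv'
      s' : ℕ
      s' = per x₀ * s
      to : ∀ {x y} → x ~ y → x D.~ y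
      to = ~-transport I inv' T-same
      from : ∀ {x y} → x D.~ y → x ~ y
      from = ~-transport inv' I (λ y → sym (T-same y))
      undo : ∀ {y} → x₀ ~ y → iter D.T s' (iter T s y) ≡ y
      undo {y} p = trans (iter-cong T-same s' _) (trans (iter-swap T s' s y) (per-mult p s))
      x~g' : x₀ D.~ D.g x₀
      x~g' = to (subst (x₀ ~_) (sym (g-on ~-refl)) (~-trans x~g (~-iter s)))
      back : Twist.TwG t' inv' x₀ s' t
      back = record
        { g-on = λ p → sym (trans (cong (iter D.T s') (g-on (from p))) (undo (g-class (from p))))
        ; b-on = λ p → sym (trans (cong (iter D.T s') (b-on (from p))) (undo (b-class (from p))))
        ; g-off = λ np → sym (g-off (λ p → np (to p)))
        ; b-off = λ np → sym (b-off (λ p → np (to p)))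
        ; r-all = λ y → sym (r-all y) }

    linkR : ∀ {x₀ s t'} → x₀ ~ r x₀ → ¬ ZC x₀ → ¬ x₀ ~ g x₀ → TwR x₀ s t' → Link 1 t t'
    linkR {x₀} {s} {t'} x~r nz x≁g W =
        link (LiftG.liftR t I x~r (λ p → r-flip p 1) x≁g W) (LiftG.liftR t' inv' x~r' rflip' x≁g' back)
      where
      open TwR W
      open TwRFacts x~r nz W
      module D = Alg t' inv'
      s' : ℕ
      s' = per x₀ * s
      to : ∀ {x y} → x ~ y → x D.~ y
      to = ~-transport I inv' T-same
      from : ∀ {x y} → x D.~ y → x ~ y
      from = ~-transport inv' I (λ y → sym (T-same y))
      T⁻-same : ∀ y → D.T⁻ y ≡ T⁻ y
      T⁻-same y = trans (b-all _) (cong b (g-all y))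
      x~r' : x₀ D.~ D.r x₀
      x~r' = to (subst (x₀ ~_) (sym (r-on ~-refl)) (~-trans x~r (~-iter s)))
      x≁g' : ¬ x₀ D.~ D.g x₀
      x≁g' p = x≁g (subst (x₀ ~_) (g-all x₀) (from p))
      rflip' : ∀ {y} → x₀ D.~ y → D.r (D.T y) ≡ D.T⁻ (D.r y)
      rflip' {y} p = trans (cong D.r (T-same y)) (trans (r-on (~-trans (from p) ~-step)) (trans (cong (iter T s) (r-flip (from p) 1))
        (trans (T-past s (r y)) (trans (cong T⁻ (sym (r-on (from p)))) (sym (T⁻-same _))))))
        where
        T-past : ∀ s y → iter T s (T⁻ y) ≡ T⁻ (iter T s y)
        T-past s y = trans (sym (T⁻T _)) (cong T⁻ (trans (sym (iter-shift T s (T⁻ y))) (cong (iter T s) (TT⁻ y))))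
      back : Twist.TwR t' inv' x₀ s' t
      back = record
        { r-on = λ p → sym (trans (cong (iter D.T s') (r-on (from p))) (trans (iter-cong T-same s' _) (trans (iter-swap T s' s _) (per-mult (r-class (from p)) s))))
        ; r-off = λ np → sym (r-off (λ p → np (to p)))
        ; g-all = λ y → sym (g-all y)
        ; b-all = λ y → sym (b-all y) }

-- Joining cylinders

record Step {m} (d : ℕ) (z₀ : Fin m) (K : ℕ) (t t' : Trip m) : Set₁ where
  field
    good : Good t' d z₀
    lnk  : Link K t t'
    zs   : ∀ i → iter (prodT t') i z₀ ≡ iter (prodT t) i z₀

module _ {m : ℕ} {d : ℕ} {z₀ : Fin m} where

  step-trans : ∀ {K L} {t t' t'' : Trip m} → Step d z₀ K t t' → Step d z₀ L t' t'' → Step d z₀ (K + L) t t''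
  step-trans {t = t} {t'} {t''} S S' = record
    { good = Step.good S' ; lnk = link-trans (Step.lnk S) (Step.lnk S') ; zs = λ i → trans (Step.zs S' i) (Step.zs S i) }

  step-refl : ∀ {t : Trip m} → Good t d z₀ → Step d z₀ 0 t t
  step-refl Γ = record { good = Γ ; lnk = link-refl ; zs = λ _ → refl }

  step-≤ : ∀ {K L} {t t' : Trip m} → K ≤ L → Step d z₀ K t t' → Step d z₀ L t t'
  step-≤ K≤L S = record { good = Step.good S ; lnk = link-≤ K≤L (Step.lnk S) ; zs = Step.zs S }

  step-InZ : ∀ {K} {t t' : Trip m} (Γ : Good t d z₀) (S : Step d z₀ K t t') → ∀ {x} →
             Alg.InZ t (Good.I Γ) x → Alg.InZ t' (Good.I (Step.good S)) x
  step-InZ Γ S {x} zx with Good.onZ Γ x zx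
  ... | i , _ , e = subst (Alg.InZ _ (Good.I (Step.good S))) (trans (Step.zs S i) e) (Geometry.z-InZ (Step.good S) i)

  step-InZ⁻ : ∀ {K} {t t' : Trip m} (Γ : Good t d z₀) (S : Step d z₀ K t t') → ∀ {x} →
              Alg.InZ t' (Good.I (Step.good S)) x → Alg.InZ t (Good.I Γ) x
  step-InZ⁻ Γ S {x} zx with Good.onZ (Step.good S) x zx
  ... | i , _ , e = subst (Alg.InZ _ (Good.I Γ)) (trans (sym (Step.zs S i)) e) (Geometry.z-InZ Γ i)

  step-swap : ∀ {K} {t t' : Trip m} → Good t d z₀ → Step d z₀ K t t' → Step d z₀ K (swapRB t) (swapRB t')
  step-swap {t = t} {t'} Γ S = record
    { good = good-swap (Step.good S) ; lnk = link-swap (Step.lnk S) ; zs = zs' }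
    where
    module A = Geometry Γ
    module A' = Geometry (Step.good S)
    zs' : ∀ i → iter (prodT (swapRB t')) i z₀ ≡ iter (prodT (swapRB t)) i z₀
    zs' i with A.onZ (iter A.P⁻ i z₀) (InZ-swap⁻ Γ (Geometry.z-InZ (good-swap Γ) i))
    ... | j , _ , e = trans (cong (iter A'.P⁻ i) (sym home)) (iter-cancel A'.P⁻P i _)
      where
      home : iter A'.P i (iter A.P⁻ i z₀) ≡ z₀
      home = trans (cong (iter A'.P i) (trans (sym e) (sym (Step.zs S j))))
        (trans (sym (iter-+ A'.P i j z₀)) (trans (Step.zs S (i + j)) (trans (iter-+ A.P i j z₀)
          (trans (cong (iter A.P i) e) (iter-cancel A.PP⁻ i z₀)))))

  stepG : ∀ {t : Trip m} (Γ : Good t d z₀) {x₀ s t'} → let open Geometry Γ in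
          x₀ ~ g x₀ → Twist.TwG t I x₀ s t' → Step d z₀ 1 t t'
  stepG {t} Γ x~g W = record
    { good = good-twG Γ x~g W ; lnk = linkG t (Good.I Γ) x~g W ; zs = λ i → iter-cong (prodT-twG Γ x~g W) i z₀ }

  stepR : ∀ {t : Trip m} (Γ : Good t d z₀) {x₀ s t'} → let open Geometry Γ in
          x₀ ~ r x₀ → ¬ ZC x₀ → Twist.TwR t I x₀ s t' → Step d z₀ 1 t t'
  stepR {t} Γ {x₀} {t' = t'} x~r nz W = record
    { good = good-twR Γ x~r nz W ; lnk = linkR t I x~r nz x≁g W ; zs = prodT-iter t t' Γ (prodT-twR Γ x~r nz W) }
    where
    open Geometry Γ
    x≁g : ¬ x₀ ~ g x₀
    -- A class closed under `r` and `g` is the whole surface and would contain `z₀`.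
    x≁g x~g = nz (z₀ , conn (x₀ ~_) (λ x p → ~-trans x~r (r-cong nz p)) (λ x p → ~-trans x~g (g-cong p))
                   (λ x p → ~-trans (~-trans x~g (g-cong p)) (gb~ x)) x₀ z₀ ~-refl , z-InZ 0)

-- f' is f followed by a permutation h of E; E is one h-cycle meeting every f-cycle at most once,
-- so the f-cycles through E are joined into one.
module Merge {n : ℕ} (f f⁻ : Fin n → Fin n) (ff⁻ : ∀ x → f (f⁻ x) ≡ x) (f⁻f : ∀ x → f⁻ (f x) ≡ x)
             (f' f'⁻ : Fin n → Fin n) (f'f'⁻ : ∀ x → f' (f'⁻ x) ≡ x) (f'⁻f' : ∀ x → f'⁻ (f' x) ≡ x)
             (h : Fin n → Fin n) (E : Fin n → Set) (E? : ∀ x → Dec (E x)) where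
  private
    module O = Orbit f f⁻ ff⁻ f⁻f
    module O' = Orbit f' f'⁻ f'f'⁻ f'⁻f'

  module _ (hit : ∀ {e e'} → E e → E e' → e O.~ e' → e ≡ e')
           (on : ∀ {y} → E (f y) → f' y ≡ h (f y)) (off : ∀ {y} → ¬ E (f y) → f' y ≡ f y)
           (hE : ∀ {e} → E e → E (h e)) (one : ∀ {e e'} → E e → E e' → ∃ λ k → iter h k e ≡ e') where

    private
      follow : ∀ {e} → E e → ∀ j → j ≤ O.per e → iter f' j e ≡ iter f j e
      follow Ee zero _ = refl
      follow {e} Ee (suc j) j< = trans (cong f' (follow Ee j (<⇒≤ j<)))
        (off (λ E' → O.per-min e j j< (sym (hit Ee E' (O.~-iter (suc j))))))

      to-h : ∀ {e} → E e → e O'.~ h e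
      to-h {e} Ee = suc (O.per e) , trans (cong f' (follow Ee (O.per e) ≤-refl))
        (trans (on (subst E (sym (O.per-ret e)) Ee)) (cong h (O.per-ret e)))

      to-hk : ∀ {e} k → E e → E (iter h k e) × e O'.~ iter h k e
      to-hk zero Ee = Ee , O'.~-refl
      to-hk (suc k) Ee with to-hk k Ee
      ... | Ek , p = hE Ek , O'.~-trans p (to-h Ek)

    opaque
      merge-E : ∀ {e e'} → E e → E e' → e O'.~ e'
      merge-E Ee Ee' with one Ee Ee'
      ... | k , refl = proj₂ (to-hk k Ee)

      merge-class : ∀ {e y} → E e → e O.~ y → e O'.~ y
      merge-class Ee p with O.~-short p
      ... | k , s≤s k≤ , refl = k , follow Ee k k≤

      merge-~ : ∀ {x y} → x O.~ y → x O'.~ y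
      merge-~ {x} p = go (FinP.any? (λ e → E? e ×-dec O.~-dec e x)) p
        where
        go : Dec (∃ λ e → E e × e O.~ x) → ∀ {y} → x O.~ y → x O'.~ y
        go (yes (e , Ee , q)) p = O'.~-trans (O'.~-sym (merge-class Ee q)) (merge-class Ee (O.~-trans q p))
        go (no ne) (k , refl) = k , same k
          where
          same : ∀ k → iter f' k x ≡ iter f k x
          same zero = refl
          same (suc k) = trans (cong f' (same k)) (off (λ E' → ne (_ , E' , O.~-sym (O.~-iter (suc k)))))

      merge-⊆ : ∀ {e y} → E e → e O'.~ y → ∃ λ e' → E e' × e' O.~ y
      merge-⊆ {e} Ee (zero , refl) = e , Ee , O.~-refl
      merge-⊆ {e} Ee (suc k , refl) with merge-⊆ Ee (k , refl)
      ... | e' , Ee' , p = go (E? _)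
        where
        go : Dec (E (f (iter f' k e))) → ∃ λ e' → E e' × e' O.~ f' (iter f' k e)
        go (yes q) = _ , hE q , O.~-≡ (sym (on q))
        go (no q) = e' , Ee' , O.~-trans p (O.~-trans O.~-step (O.~-≡ (sym (off q))))

module _ {m : ℕ} {t : Trip m} {d : ℕ} {z₀ : Fin m} (Γ : Good t d z₀) where
  open Geometry Γ

  -- A single twist at the far end of the folded cylinder makes the column over `x` come down along
  -- the column over `y`. For `y = x` the column returns through its own triangles, not merely
  -- through its own classes.
  record Aligned (x y : Fin m) : Set₁ where
    field
      {t'}   : Trip m
      stp    : Step d z₀ 1 t t'
    open Step stp public
    private module D = Geometry good
    field
      k      : ℕ
      fld    : Fold x k
      T-same : ∀ w → D.T w ≡ T w
      c-off  : ∀ j {w} → ¬ col x k ~ w → D.c j w ≡ c j w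
      r-keep : ∀ {w} → ZC w → D.r w ≡ r w
      b-off  : ∀ {w} → ¬ col x k ~ w → D.b w ≡ b w
      turn'  : D.c k (col x k) ≡ col y k

    ~→ : ∀ {a a'} → a ~ a' → a D.~ a'
    ~→ = ~-transport I D.I T-same

    ~← : ∀ {a a'} → a D.~ a' → a ~ a'
    ~← = ~-transport D.I I (λ w → sym (T-same w))

    ZC→ : ∀ {a} → ZC a → D.ZC a
    ZC→ (w , p , zw) = w , ~→ p , step-InZ Γ stp zw

    ZC← : ∀ {a} → D.ZC a → ZC a
    ZC← (w , p , zw) = w , ~← p , step-InZ⁻ Γ stp zw

  opaque
    align : ∀ x y → ZC x → x ~ y → Aligned x y
    align x y zx x~y with folded x zx
    ... | k , F with ~-trans (Fold.turn F) u~v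
      where
      u~v : col x k ~ col y k
      u~v = col-cong k x~y (λ j 1≤j j<k → Fold.free≤ F j 1≤j (<⇒≤ j<k))
    ...   | s , es with parity k
    ...     | inj₁ ev = record
                { stp = stepG Γ u~g W ; k = k ; fld = F ; T-same = T-same ; c-off = off ; r-keep = λ _ → r-all _ ; b-off = b-off
                ; turn' = trans (Geometry.c-g (good-twG Γ u~g W) ev u) (trans (g-on ~-refl) (trans (cong (iter T s) (sym (c-g ev u))) es)) }
      where
      u : Fin m
      u = col x k
      u~g : u ~ g u
      u~g = ~-trans (~-sym (Fold.turn F)) (~-≡ (c-g ev u))
      W : Twist.TwG t I u s (proj₁ (Twist.twG t I u s))
      W = proj₂ (Twist.twG t I u s)
      open Twist.TwG W
      open Twist.TwGFacts t I u~g W using (T-same)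
      off : ∀ j {w} → ¬ u ~ w → Geometry.c (good-twG Γ u~g W) j w ≡ c j w
      off 0 np = g-off np
      off 1 np = r-all _
      off (suc (suc j)) np = off j np
    ...     | inj₂ od = record
                { stp = stepR Γ u~r nz W ; k = k ; fld = F ; T-same = T-same ; c-off = off
                ; r-keep = λ zw → r-off (λ p → nz (ZC-~ (~-sym p) zw)) ; b-off = λ _ → b-all _
                ; turn' = trans (Geometry.c-r (good-twR Γ u~r nz W) od u) (trans (r-on ~-refl) (trans (cong (iter T s) (sym (c-r od u))) es)) }
      where
      u : Fin m
      u = col x k
      u~r : u ~ r u
      u~r = ~-trans (~-sym (Fold.turn F)) (~-≡ (c-r od u))
      nz : ¬ ZC u
      nz = Fold.free≤ F k (subst (1 ≤_) (sym (proj₂ od)) (s≤s z≤n)) ≤-refl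
      W : Twist.TwR t I u s (proj₁ (Twist.twR t I u s))
      W = proj₂ (Twist.twR t I u s)
      open Twist.TwR W
      open Twist.TwRFacts t I u~r nz W using (T-same)
      off : ∀ j {w} → ¬ u ~ w → Geometry.c (good-twR Γ u~r nz W) j w ≡ c j w
      off 0 np = g-all _
      off 1 np = r-off np
      off (suc (suc j)) np = off j np

  module AlignedFacts {x y} (zx : ZC x) (x~y : x ~ y) (al : Aligned x y) where
    open Aligned al
    private module D = Geometry good

    u~v : ∀ j → j ≤ suc k → col x j ~ col y j
    u~v j j≤ = col-cong j x~y (λ i 1≤i i<j → Fold.free≤ fld i 1≤i (≤-pred (≤-trans i<j j≤)))

    -- Only the top level is twisted, and by `Fold-distinct` the lower levels are different classes.
    same-u : ∀ j → j ≤ k → D.col x j ≡ col x j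
    same-u zero _ = refl
    same-u (suc j) j<k = trans (cong (D.c j) (same-u j (<⇒≤ j<k)))
      (c-off j (λ p → <-irrefl (sym (Fold-distinct zx fld ≤-refl (<⇒≤ j<k) p)) j<k))

    same-v : ∀ j → j ≤ k → D.col y j ≡ col y j
    same-v zero _ = refl
    same-v (suc j) j<k = trans (cong (D.c j) (same-v j (<⇒≤ j<k)))
      (c-off j (λ p → <-irrefl (sym (Fold-distinct zx fld ≤-refl (<⇒≤ j<k)
        (~-trans p (~-sym (u~v j (≤-trans (<⇒≤ j<k) (n≤1+n k))))))) j<k))

    top-u : D.col x (suc k) ≡ D.col y k
    top-u = trans (cong (D.c k) (same-u k ≤-refl)) (trans turn' (sym (same-v k ≤-refl)))

    top-v : D.col y (suc k) ≡ D.col x k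
    top-v = D.c-inj k (trans (D.cc k _) (sym top-u))

    free-u : ∀ j → 1 ≤ j → j ≤ k → ¬ D.ZC (D.col x j)
    free-u j 1≤j j≤k zc = Fold.free≤ fld j 1≤j j≤k (ZC← (subst D.ZC (same-u j j≤k) zc))

    free-v : ∀ j → 1 ≤ j → j ≤ k → ¬ D.ZC (D.col y j)
    free-v j 1≤j j≤k zc = Fold.free≤ fld j 1≤j j≤k
      (ZC-~ (~-sym (u~v j (≤-trans j≤k (n≤1+n k)))) (ZC← (subst D.ZC (same-v j j≤k) zc)))

    fld' : D.Fold x k
    fld' = D.turn⇒Fold x k free-u (D.~-trans (D.~-≡ top-u)
      (D.~-cast (sym (same-v k ≤-refl)) (sym (same-u k ≤-refl)) (~→ (~-sym (u~v k (n≤1+n k))))))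

  g-nbr : ∀ x j → (g (col x j) ≡ col x (suc j)) ⊎ (∃ λ i → j ≡ suc i × g (col x j) ≡ col x i)
  g-nbr x j with parity j
  ... | inj₁ ev = inj₁ (sym (c-g ev _))
  ... | inj₂ (h , refl) = inj₂ (h + h , refl , trans (cong g (c-g (h , refl) _)) (gg _))

  r-nbr : ∀ x j → j ≡ 0 ⊎ (r (col x j) ≡ col x (suc j)) ⊎ (∃ λ i → j ≡ suc i × r (col x j) ≡ col x i)
  r-nbr x j with parity j
  ... | inj₂ od = inj₂ (inj₁ (sym (c-r od _)))
  ... | inj₁ (zero , refl) = inj₁ refl
  ... | inj₁ (suc h , refl) = inj₂ (inj₂ (h + suc h , refl ,
          trans (cong r (c-r (h , +-suc h h) _)) (rr _)))

  Rung : Fin m → ℕ → Fin m → Set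
  Rung x k w = ∃ λ j → j ≤ k × w ≡ col x j

  -- two columns joined by r at the bottom, each leading at its top into one of the two
  module Ladder {x y k l} (ry : r x ≡ y) (top : Rung x k (col x (suc k)) ⊎ Rung y l (col x (suc k)))
                (top' : Rung x k (col y (suc l)) ⊎ Rung y l (col y (suc l))) where

    InL : Fin m → Set
    InL w = Rung x k w ⊎ Rung y l w

    private
      stepU : ∀ {w} j → j ≤ k → w ≡ col x (suc j) → InL w
      stepU j j≤k refl with m≤n⇒m<n∨m≡n j≤k
      ... | inj₁ j<k = inj₁ (suc j , j<k , refl)
      ... | inj₂ refl = top
      stepV : ∀ {w} j → j ≤ l → w ≡ col y (suc j) → InL w
      stepV j j≤l refl with m≤n⇒m<n∨m≡n j≤l
      ... | inj₁ j<l = inj₂ (suc j , j<l , refl)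
      ... | inj₂ refl = top'

    L-g : ∀ {w} → InL w → InL (g w)
    L-g (inj₁ (j , j≤ , refl)) with g-nbr x j
    ... | inj₁ e = stepU j j≤ e
    ... | inj₂ (i , refl , e) = inj₁ (i , <⇒≤ j≤ , e)
    L-g (inj₂ (j , j≤ , refl)) with g-nbr y j
    ... | inj₁ e = stepV j j≤ e
    ... | inj₂ (i , refl , e) = inj₂ (i , <⇒≤ j≤ , e)

    L-r : ∀ {w} → InL w → InL (r w)
    L-r (inj₁ (j , j≤ , refl)) with r-nbr x j
    ... | inj₁ refl = inj₂ (0 , z≤n , ry)
    ... | inj₂ (inj₁ e) = stepU j j≤ e
    ... | inj₂ (inj₂ (i , refl , e)) = inj₁ (i , <⇒≤ j≤ , e)
    L-r (inj₂ (j , j≤ , refl)) with r-nbr y j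
    ... | inj₁ refl = inj₁ (0 , z≤n , trans (cong r (sym ry)) (rr x))
    ... | inj₂ (inj₁ e) = stepV j j≤ e
    ... | inj₂ (inj₂ (i , refl , e)) = inj₂ (i , <⇒≤ j≤ , e)

    private module V = Alg (swapRB t) (inv-swap I)

    L-orbit : ∀ {w} → x V.~ w → InL w
    L-orbit (zero , refl) = inj₁ (0 , z≤n , refl)
    L-orbit (suc i , refl) = L-g (L-r (L-orbit (i , refl)))

  private module V = Alg (swapRB t) (inv-swap I)

  -- A column that turns at an element retraces itself and arrives at `x` by a `g`-step. The
  -- vertical strip through `x` is then a path, which is the form that can be twisted by `twG`.
  straight-loop : ∀ x k → col x (suc k) ≡ col x k → x V.~ g x
  straight-loop x k e = ~back (iter-g (home k 0 refl))
    where
    home : ∀ j i → i + j ≡ k → col x (j + suc k) ≡ col x i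
    home zero i p rewrite trans (sym (+-identityʳ i)) p = e
    home (suc j) i p = trans (cong (c (j + suc k)) (home j (suc i) (trans (sym (+-suc i j)) p)))
      (trans (c-swap (j + suc k) i k (trans (cong (_+ i) (+-suc j k)) (trans (+-comm (suc (j + k)) i)
        (trans (+-suc i (j + k)) (trans (cong suc (sym (+-assoc i j k))) (cong (_+ k) (trans (sym (+-suc i j)) p)))))) _) (cc i _))
    col-V : ∀ i → col x (i + i) ≡ iter V.T⁻ i x
    col-V zero = refl
    col-V (suc i) = trans (cong (λ a → col x (suc a)) (+-suc i i))
      (trans (c-r (i , refl) _) (cong r (trans (c-g (i , refl) _) (cong g (col-V i)))))
    iter-g : col x (k + suc k) ≡ x → iter V.T⁻ k x ≡ g x
    iter-g p = trans (sym (gg _)) (cong g (trans (cong g (sym (col-V k))) (trans (sym (c-g (k , refl) _)) (trans (cong (col x) (sym (+-suc k k))) p))))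
    ~back : iter V.T⁻ k x ≡ g x → x V.~ g x
    ~back p = V.~-trans (V.~-iter⁻ k) (V.~-≡ p)

module VTwist {m : ℕ} {t : Trip m} {d : ℕ} {z₀ : Fin m} (Γ : Good t d z₀) (x₀ : Fin m)
              (loop : Alg._~_ (swapRB t) (Good.I (good-swap Γ)) x₀ (Trip.g t x₀)) where
  open Geometry Γ
  private module V = Alg (swapRB t) (Good.I (good-swap Γ))

  private
    tw = Twist.twG (swapRB t) (Good.I (good-swap Γ)) x₀ 1
    t'' : Trip m
    t'' = proj₁ tw
    W : Twist.TwG (swapRB t) (Good.I (good-swap Γ)) x₀ 1 t''
    W = proj₂ tw
  open Twist.TwG W

  sheared : Trip m
  sheared = swapRB t''

  stp : Step d z₀ 1 t sheared
  stp = step-swap (good-swap Γ) (stepG (good-swap Γ) loop W)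

  private module D = Geometry (Step.good stp)

  E : Fin m → Set
  E w = x₀ V.~ w

  E-base : E x₀
  E-base = V.~-refl

  E-g : ∀ {w} → E w → E (g w)
  E-g p = V.~-trans loop (V.g-cong p)

  E-r : ∀ {w} → E w → E (r w)
  E-r {w} p = V.~-trans (E-g p) (V.gb~ w)

  Dg-on : ∀ {w} → E w → D.g w ≡ V.T (g w)
  Dg-on = g-on
  Dg-off : ∀ {w} → ¬ E w → D.g w ≡ g w
  Dg-off = g-off
  Dr-off : ∀ {w} → ¬ E w → D.r w ≡ r w
  Dr-off = b-off
  Db : ∀ w → D.b w ≡ b w
  Db = r-all

  -- The vertical shear composes horizontal translation with `V.T` on the shorn path, on which `V.T`
  -- is one cycle: exactly the situation of `Merge`.
  DT-on : ∀ {y} → E (T y) → D.T y ≡ V.T (T y)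
  DT-on {y} p = trans (cong D.g (Db y)) (Dg-on (subst E (gg (b y)) (E-g p)))

  DT-off : ∀ {y} → ¬ E (T y) → D.T y ≡ T y
  DT-off {y} np = trans (cong D.g (Db y)) (Dg-off (λ p → np (E-g p)))

  module Joined (hit : ∀ {e e'} → E e → E e' → e ~ e' → e ≡ e') where
    private module M = Merge T T⁻ TT⁻ T⁻T D.T D.T⁻ D.TT⁻ D.T⁻T V.T E (V.~-dec x₀)
    private
      hE : ∀ {e} → E e → E (V.T e)
      hE p = V.~-trans p V.~-step
      one : ∀ {e e'} → E e → E e' → ∃ λ k → iter V.T k e ≡ e'
      one p q = V.~-trans (V.~-sym p) q

    opaque
      join-E : ∀ {e e'} → E e → E e' → e D.~ e'
      join-E = M.merge-E hit DT-on DT-off hE one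

      join-class : ∀ {e y} → E e → e ~ y → e D.~ y
      join-class = M.merge-class hit DT-on DT-off hE one

      join-~ : ∀ {x y} → x ~ y → x D.~ y
      join-~ = M.merge-~ hit DT-on DT-off hE one

      join-⊆ : ∀ {e y} → E e → e D.~ y → ∃ λ e' → E e' × e' ~ y
      join-⊆ = M.merge-⊆ hit DT-on DT-off hE one

      join-closed : ∀ {w} → x₀ D.~ w → x₀ D.~ D.g w
      join-closed {w} p = go (join-⊆ V.~-refl p) (V.~-dec x₀ w)
        where
        go : (∃ λ e' → E e' × e' ~ w) → Dec (E w) → x₀ D.~ D.g w
        go _ (yes q) = D.~-trans (join-E V.~-refl (V.~-trans (E-g q) V.~-step)) (D.~-≡ (sym (Dg-on q)))
        go (e' , Ee' , e~w) (no q) = D.~-trans (join-E V.~-refl (E-g Ee'))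
          (D.~-trans (join-class (E-g Ee') (g-cong e~w)) (D.~-≡ (sym (Dg-off q))))

module _ {m : ℕ} {t : Trip m} {d : ℕ} {z₀ : Fin m} (Γ : Good t d z₀) where
  open Geometry Γ

  record Merged (x : Fin m) : Set₁ where
    field
      {t'}   : Trip m
      stp    : Step d z₀ 3 t t'
    private module D = Geometry (Step.good stp)
    field
      keep~  : ∀ {a b} → a ~ b → a D.~ b
      joined : x D.~ r x
      closed : ∀ {w} → x D.~ w → x D.~ D.g w

  opaque
    -- straighten the columns over x and r x into one vertical path and shear it
    merge-across : ∀ x → ZC x → ¬ x ~ r x → Merged x
    merge-across x zx x≁y = record
      { stp = step-trans (step-trans A₁.stp A₂.stp) X.stp
      ; keep~ = λ p → J.join-~ (A₂.~→ (A₁.~→ p))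
      ; joined = J.join-E X.E-base (subst X.E r₂x (X.E-r X.E-base))
      ; closed = J.join-closed }
      where
      y : Fin m
      y = r x
      al₁ : Aligned Γ x x
      al₁ = align Γ x x zx ~-refl
      module A₁ = Aligned al₁
      module B₁ = AlignedFacts Γ zx ~-refl al₁
      module D₁ = Geometry A₁.good
      k : ℕ
      k = A₁.k
      zx₁ : D₁.ZC x
      zx₁ = A₁.ZC→ zx
      zy₁ : D₁.ZC y
      zy₁ = A₁.ZC→ (r-ZC zx)
      al₂ : Aligned A₁.good y y
      al₂ = align A₁.good y y zy₁ D₁.~-refl
      module A₂ = Aligned al₂
      module B₂ = AlignedFacts A₁.good zy₁ D₁.~-refl al₂
      module D₂ = Geometry A₂.good
      l : ℕ
      l = A₂.k
      -- The second alignment must leave the first column straight. The two folded cylinders start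
      -- in different classes, so they share none.
      apart₁ : ∀ {j} → j ≤ k → ¬ D₁.col y l D₁.~ D₁.col x j
      apart₁ j≤k p = D₁.Fold-apart zx₁ zy₁ B₁.fld' A₂.fld (λ q → x≁y (A₁.~← q)) j≤k ≤-refl (D₁.~-sym p)
      same₂ : ∀ j → j ≤ k → D₂.col x j ≡ D₁.col x j
      same₂ zero _ = refl
      same₂ (suc j) j<k = trans (cong (D₂.c j) (same₂ j (<⇒≤ j<k))) (A₂.c-off j (apart₁ (<⇒≤ j<k)))
      top₂ : D₂.col x (suc k) ≡ D₂.col x k
      top₂ = trans (cong (D₂.c k) (same₂ k ≤-refl)) (trans (A₂.c-off k (apart₁ ≤-refl)) (trans B₁.top-u (sym (same₂ k ≤-refl))))
      Fx₂ : D₂.Fold x k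
      Fx₂ = D₂.turn⇒Fold x k (λ j 1≤j j≤k zc → B₁.free-u j 1≤j j≤k (subst D₁.ZC (same₂ j j≤k) (A₂.ZC← zc))) (D₂.~-≡ top₂)
      Fy₂ : D₂.Fold y l
      Fy₂ = B₂.fld'
      r₂x : D₂.r x ≡ y
      r₂x = trans (A₂.r-keep zx₁) (A₁.r-keep zx)
      zx₂ : D₂.ZC x
      zx₂ = A₂.ZC→ zx₁
      zy₂ : D₂.ZC y
      zy₂ = A₂.ZC→ zy₁
      x≁y₂ : ¬ x D₂.~ y
      x≁y₂ p = x≁y (A₁.~← (A₂.~← p))
      module L = Ladder A₂.good {x} {y} {k} {l} r₂x (inj₁ (k , ≤-refl , top₂)) (inj₂ (l , ≤-refl , B₂.top-u))
      module X = VTwist A₂.good x (straight-loop A₂.good x k top₂)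
      hit : ∀ {e e'} → X.E e → X.E e' → e D₂.~ e' → e ≡ e'
      hit p q s = by (L.L-orbit p) (L.L-orbit q) s
        where
        by : ∀ {e e'} → L.InL e → L.InL e' → e D₂.~ e' → e ≡ e'
        by (inj₁ (i , i≤ , refl)) (inj₁ (j , j≤ , refl)) s = cong (D₂.col x) (D₂.Fold-distinct zx₂ Fx₂ i≤ j≤ s)
        by (inj₂ (i , i≤ , refl)) (inj₂ (j , j≤ , refl)) s = cong (D₂.col y) (D₂.Fold-distinct zy₂ Fy₂ i≤ j≤ s)
        by (inj₁ (i , i≤ , refl)) (inj₂ (j , j≤ , refl)) s = ⊥-elim (D₂.Fold-apart zx₂ zy₂ Fx₂ Fy₂ x≁y₂ i≤ j≤ s)
        by (inj₂ (i , i≤ , refl)) (inj₁ (j , j≤ , refl)) s = ⊥-elim (D₂.Fold-apart zx₂ zy₂ Fx₂ Fy₂ x≁y₂ j≤ i≤ (D₂.~-sym s))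
      module J = X.Joined hit

-- Reduction to a single horizontal strip

Transitive : ∀ {m} → Trip m → Set
Transitive {m} t = ∀ x y → ∃ λ k → iter (λ v → Trip.g t (Trip.b t v)) k x ≡ y

module _ {m : ℕ} {d : ℕ} {z₀ : Fin m} where

  -- By `r-ZC`, `r` permutes the classes that meet Z. If there is only one, it is closed under `r`;
  -- being closed under `g` too, it is everything.
  all-joined : ∀ {t : Trip m} (Γ : Good t d z₀) → let open Geometry Γ in
               (∀ j → j < d → z j ~ z 0) → (∀ {w} → z 0 ~ w → z 0 ~ g w) → Transitive t
  all-joined Γ zs cl x y = ~-trans (~-sym (all x)) (all y)
    where
    open Geometry Γ
    to0 : ∀ {w} → ZC w → z 0 ~ w
    to0 (v , w~v , zv) with onZ v zv
    ... | j , j<d , refl = ~-trans (~-sym (zs j j<d)) (~-sym w~v)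
    all : ∀ x → z 0 ~ x
    all x = conn (z 0 ~_) (λ w p → to0 (r-ZC (ZC-~ p (InZ⇒ZC (z-InZ 0))))) (λ w p → cl p)
              (λ w p → ~-trans (cl p) (gb~ w)) (z 0) x ~-refl

  Reduced : ℕ → Trip m → Set₁
  Reduced K t = ∃ λ t' → Step d z₀ K t t' × Transitive t'

  private opaque
    -- Since `r (T (z i)) = P (z i) = z (suc i)`, merging across the red edge `T (z i)` joins
    -- precisely the classes of two consecutive directions.
    join-next : ∀ {t : Trip m} (Γ : Good t d z₀) i → let open Geometry Γ in
                (∀ j → j ≤ i → z j ~ z 0) → ¬ z (suc i) ~ z 0 →
                ∃ λ t' → Σ (Step d z₀ 3 t t') λ S → let module D = Geometry (Step.good S) in
                  (∀ j → j ≤ suc i → D.z j D.~ D.z 0) × (∀ {w} → D.z 0 D.~ w → D.z 0 D.~ D.g w)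
    join-next Γ i zs nz = M.t' , M.stp , zs' , cl'
      where
      open Geometry Γ
      Tz~ : z i ~ T (z i)
      Tz~ = ~-step
      module M = Merged (merge-across Γ (T (z i)) (ZC-~ Tz~ (InZ⇒ZC (z-InZ i)))
                   (λ p → nz (~-trans (~-sym p) (~-trans (~-sym Tz~) (zs i ≤-refl)))))
      module D = Geometry (Step.good M.stp)
      zs' : ∀ j → j ≤ suc i → D.z j D.~ D.z 0
      zs' j j≤ with m≤n⇒m<n∨m≡n j≤
      ... | inj₁ (s≤s j≤i) = D.~-trans (D.~-≡ (Step.zs M.stp j)) (M.keep~ (zs j j≤i))
      ... | inj₂ refl = D.~-trans (D.~-≡ (Step.zs M.stp j)) (D.~-trans (D.~-sym M.joined) (M.keep~ (~-trans (~-sym Tz~) (zs i ≤-refl))))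
      0~T : z 0 ~ T (z i)
      0~T = ~-trans (~-sym (zs i ≤-refl)) Tz~
      cl' : ∀ {w} → D.z 0 D.~ w → D.z 0 D.~ D.g w
      cl' p = D.~-trans (M.keep~ 0~T) (M.closed (D.~-trans (D.~-sym (M.keep~ 0~T)) p))

  private opaque
    join-rest : ∀ e {t : Trip m} (Γ : Good t d z₀) i → i + suc e ≡ d → let open Geometry Γ in
                (∀ j → j ≤ i → z j ~ z 0) → (∀ {w} → z 0 ~ w → z 0 ~ g w) → Reduced (e * 3) t
    join-rest zero {t} Γ i eq zs cl = t , step-refl Γ ,
      all-joined Γ (λ j j<d → zs j (≤-pred (subst (j <_) (trans (sym eq) (+-comm i 1)) j<d))) cl
    join-rest (suc e) {t} Γ i eq zs cl = go (~-dec (z (suc i)) (z 0))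
      where
      open Geometry Γ
      eq' : suc i + suc e ≡ d
      eq' = trans (sym (+-suc i (suc e))) eq
      go : Dec (z (suc i) ~ z 0) → Reduced (suc e * 3) t
      go (yes p) with join-rest e Γ (suc i) eq' zs' cl
        where
        zs' : ∀ j → j ≤ suc i → z j ~ z 0
        zs' j j≤ with m≤n⇒m<n∨m≡n j≤
        ... | inj₁ (s≤s j≤i) = zs j j≤i
        ... | inj₂ refl = p
      ... | t' , S , tr = t' , step-≤ (m≤n+m (e * 3) 3) S , tr
      go (no np) with join-next Γ i zs np
      ... | t₁ , S₁ , zs₁ , cl₁ with join-rest e (Step.good S₁) (suc i) eq' zs₁ cl₁
      ...   | t' , S , tr = t' , step-trans S₁ S , tr

  opaque
    -- At least one direction must lie outside the class of `z 0`: it is a merge that makes the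
    -- class closed under `g`, and later merges preserve this.
    join-all : ∀ {t : Trip m} (Γ : Good t d z₀) → let open Geometry Γ in
               (∃ λ j → j < d × ¬ z j ~ z 0) → Reduced (d * 3) t
    join-all {t} Γ (j , j<d , nj) = go (least (λ j → ¬? (~-dec (z j) (z 0))) j nj)
      where
      open Geometry Γ
      go : (∃ λ k → ¬ z k ~ z 0 × (∀ j → j < k → ¬ ¬ z j ~ z 0)) → Reduced (d * 3) t
      go (zero , n0 , _) = ⊥-elim (n0 ~-refl)
      go (suc i , ni , below) with suc i <? d
      ... | no i≮d = ⊥-elim (below j (<-≤-trans j<d (≮⇒≥ i≮d)) nj)
      ... | yes i<d with join-next Γ i (λ j j≤i → decidable-stable (~-dec (z j) (z 0)) (below j (s≤s j≤i))) ni | <⇒offset i<d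
      ...   | t₁ , S₁ , zs₁ , cl₁ | e , eq with join-rest e (Step.good S₁) (suc i) eq zs₁ cl₁
      ...     | t' , S , tr = t' , step-≤ (subst (λ a → 3 + e * 3 ≤ a * 3) eq (*-monoˡ-≤ 3 (m≤n+m (suc e) (suc i)))) (step-trans S₁ S) , tr

  opaque
    -- a column through z₀ closed up by r meets Z at most in z₀ and r z₀
    separate : ∀ {t : Trip m} (Γ : Good t d z₀) → let open Geometry Γ in (∀ j → j < d → z j ~ z 0) →
               ∃ λ t' → Σ (Step d z₀ 1 t t') λ S → let module V = Geometry (good-swap (Step.good S)) in
                 ∃ λ j → j < d × ¬ V.z j V.~ V.z 0
    separate {t} Γ zs = A.t' , A.stp , answer (V.~-dec (V.z 1) z₀)
      where
      open Geometry Γ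
      zz : ZC z₀
      zz = InZ⇒ZC (z-InZ 0)
      z~r : z₀ ~ r z₀
      z~r with r-ZC zz
      ... | v , rz~v , zv with onZ v zv
      ...   | j , j<d , refl = ~-trans (~-sym (zs j j<d)) (~-sym rz~v)
      module A = Aligned (align Γ z₀ (r z₀) zz z~r)
      module F = AlignedFacts Γ zz z~r (align Γ z₀ (r z₀) zz z~r)
      module D = Geometry A.good
      module V = Geometry (good-swap A.good)
      module L = Ladder A.good {z₀} {r z₀} {A.k} {A.k} (A.r-keep zz) (inj₂ (A.k , ≤-refl , F.top-u)) (inj₁ (A.k , ≤-refl , F.top-v))
      only : ∀ {w} → D.InZ w → z₀ V.~ w → w ≡ z₀ ⊎ w ≡ r z₀
      only zw p with L.L-orbit p
      ... | inj₁ (zero , _ , e) = inj₁ e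
      ... | inj₂ (zero , _ , e) = inj₂ e
      ... | inj₁ (suc j , j≤ , refl) = ⊥-elim (F.free-u (suc j) (s≤s z≤n) j≤ (D.InZ⇒ZC zw))
      ... | inj₂ (suc j , j≤ , refl) = ⊥-elim (F.free-v (suc j) (s≤s z≤n) j≤ (D.InZ⇒ZC zw))
      at : ∀ i → 0 < i → i < d → V.z i V.~ z₀ → V.z i ≡ r z₀
      at i 0<i i<d p with only (InZ-swap⁻ A.good (V.z-InZ i)) (V.~-sym p)
      ... | inj₁ e = ⊥-elim (V.prim i 0<i i<d e)
      ... | inj₂ e = e
      2<d : 2 < d
      2<d = d≥3
      1<d : 1 < d
      1<d = ≤-trans (n≤1+n 2) d≥3
      answer : Dec (V.z 1 V.~ z₀) → ∃ λ j → j < d × ¬ V.z j V.~ V.z 0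
      answer (no np) = 1 , 1<d , np
      answer (yes p) = 2 , 2<d , λ q → 1≢2 (V.z-uniq 1<d 2<d (trans (at 1 (s≤s z≤n) 1<d p) (sym (at 2 (s≤s z≤n) 2<d q))))
        where
        1≢2 : 1 ≢ 2
        1≢2 ()

  opaque
    -- One shear separates the vertical classes of Z, which makes `join-all` available in the
    -- exchanged surface.
    flip-join : ∀ {t : Trip m} (Γ : Good t d z₀) → let open Geometry Γ in (∀ j → j < d → z j ~ z 0) →
                Reduced (1 + d * 3) (swapRB t)
    flip-join Γ zs with separate Γ zs
    ... | t₁ , S₁ , nj with join-all (good-swap (Step.good S₁)) nj
    ...   | t₂ , S₂ , tr = t₂ , step-trans (step-swap Γ S₁) S₂ , tr

  opaque
    -- When all directions already share a class, the first exchange ends with one vertical strip.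
    -- This again puts all directions into one class, so a second exchange applies and ends with one
    -- horizontal strip.
    reduce : ∀ {t : Trip m} (Γ : Good t d z₀) → Reduced ((1 + d * 3) + (1 + d * 3)) t
    reduce {t} Γ = go (anyUpTo? (λ j → ¬? (~-dec (z j) (z 0))) d)
      where
      open Geometry Γ
      go : Dec (∃ λ j → j < d × ¬ z j ~ z 0) → Reduced ((1 + d * 3) + (1 + d * 3)) t
      go (yes nj) with join-all Γ nj
      ... | t' , S , tr = t' , step-≤ (≤-trans (n≤1+n _) (m≤m+n (1 + d * 3) (1 + d * 3))) S , tr
      go (no all) with flip-join Γ (λ j j<d → decidable-stable (~-dec (z j) (z 0)) (λ q → all (j , j<d , q)))
      ... | t₁ , S₁ , tr₁ with flip-join (Step.good S₁) (λ j _ → tr₁ _ _)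
      ...   | t₂ , S₂ , tr₂ = t₂ , step-trans (step-swap (good-swap Γ) S₁) S₂ , tr₂

-- Shortening a segment of the star

step-P : ∀ {m d} {z₀ : Fin m} {K} {t t' : Trip m} (Γ : Good t d z₀) → Step d z₀ K t t' → ∀ {x} →
         Alg.InZ t (Good.I Γ) x → prodT t' x ≡ prodT t x
step-P {t = t} {t'} Γ S {x} zx with Good.onZ Γ x zx
... | i , _ , refl = trans (cong (prodT t') (sym (Step.zs S i))) (Step.zs S (suc i))

-- A class whose only members in Z are a and e = T a; r reverses the rest of it.
module Tail {m : ℕ} {t : Trip m} {d : ℕ} {z₀ : Fin m} (Γ : Good t d z₀) (a e : Fin m)
            (za : Alg.InZ t (Good.I Γ) a) (Ta : Alg.T t (Good.I Γ) a ≡ e) (Pe : Alg.P t (Good.I Γ) e ≡ a)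
            (only : ∀ {w} → Alg._~_ t (Good.I Γ) a w → Alg.InZ t (Good.I Γ) w → w ≡ a ⊎ w ≡ e) where
  open Geometry Γ

  ze : InZ e
  ze = subst InZ (trans (cong P⁻ (sym Pe)) (P⁻P e)) (InZ-P⁻ za)

  e~a : e ~ a
  e~a = ~-sym (1 , Ta)

  private
    nx : ∃ λ n → Next e n
    nx = next ze

  n : ℕ
  n = proj₁ nx

  last : iter T (suc n) e ≡ a
  last with only (~-trans (~-sym e~a) (~-iter (suc n))) (Next.hit (proj₂ nx))
  ... | inj₁ p = p
  ... | inj₂ p = ⊥-elim (early n refl (trans (sym (T⁻T _)) (trans (cong T⁻ (trans p (sym Ta))) (T⁻T a))))
    where
    early : ∀ n' → n' ≡ n → iter T n' e ≢ a
    early zero _ q = za (trans (cong P (trans (cong P (sym q)) Pe)) (trans (cong P (sym q)) Pe))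
    early (suc n') eq q = Next.before (proj₂ nx) n' (subst (n' <_) eq ≤-refl) (subst InZ (sym q) za)

  tail : ℕ → Fin m
  tail j = iter T (suc j) e

  r-tail : ∀ j → j ≤ n → r (tail j) ≡ iter T⁻ j a
  r-tail j j≤n = trans (cong r (sym (iter-shift T j e)))
    (trans (r-run j (T e) (λ i i<j → subst (¬_ ∘ InZ) (sym (iter-shift T i e)) (Next.before (proj₂ nx) i (<-≤-trans i<j j≤n))))
           (cong (iter T⁻ j) Pe))

  -- The equation `P e ≡ a` says that `r` exchanges the first and the last element of the tail. No
  -- direction of Z comes before its end, so the reversal extends inwards and the tail is folded
  -- onto itself.
  r-mirror : ∀ j l → j + l ≡ n → r (tail j) ≡ tail l
  r-mirror j l eq = trans (r-tail j (subst (j ≤_) eq (m≤m+n j l)))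
    (trans (cong (iter T⁻ j) (trans (sym last) (trans (cong (λ i → iter T i e) (trans (cong suc (sym eq)) (sym (+-suc j l)))) (iter-+ T j (suc l) e))))
           (f⁻fk j _))

  members : ∀ {w} → e ~ w → w ≡ e ⊎ ∃ λ j → j ≤ n × w ≡ tail j
  members (zero , refl) = inj₁ refl
  members (suc k , refl) with members (k , refl)
  ... | inj₁ p = inj₂ (0 , z≤n , cong T p)
  ... | inj₂ (j , j≤n , p) with m≤n⇒m<n∨m≡n j≤n
  ...   | inj₁ j<n = inj₂ (suc j , j<n , cong T p)
  ...   | inj₂ refl = inj₁ (trans (cong T (trans p last)) Ta)

  tail~a : ∀ j → a ~ tail j
  tail~a j = ~-trans (~-sym e~a) (~-iter (suc j))

  -- the centre of the tail, on which r is a point or an edge reflection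
  centre : ∃ λ x → a ~ x × (r x ≡ x ⊎ (r x ≡ T x × ¬ InZ x))
  centre with parity n
  ... | inj₁ (h , eq) = tail h , tail~a h , inj₁ (r-mirror h h (sym eq))
  ... | inj₂ (h , eq) = tail h , tail~a h , inj₂ (r-mirror h (suc h) (trans (+-suc h h) (sym eq)) ,
          Next.before (proj₂ nx) h (subst (h <_) (sym eq) (s≤s (m≤m+n h h))))

  r-stays : ∀ {w} → a ~ w → w ≢ e → a ~ r w
  r-stays p w≢e with members (~-trans e~a p)
  ... | inj₁ q = ⊥-elim (w≢e q)
  ... | inj₂ (j , j≤n , refl) = subst (a ~_) (sym (r-tail j j≤n)) (~-iter⁻ j)

even? : ℕ → Bool
even? zero = true
even? (suc n) = not (even? n)


module Core {m : ℕ} {t : Trip m} {d : ℕ} {z₀ : Fin m} (Γ : Good t d z₀) (a e : Fin m)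
            (za : Alg.InZ t (Good.I Γ) a) (Ta : Alg.T t (Good.I Γ) a ≡ e) (Pe : Alg.P t (Good.I Γ) e ≡ a)
            (only : ∀ {w} → Alg._~_ t (Good.I Γ) a w → Alg.InZ t (Good.I Γ) w → w ≡ a ⊎ w ≡ e)
            (P≢a : Alg.P t (Good.I Γ) a ≢ a) (P≢e : Alg.P t (Good.I Γ) a ≢ e) where
  open Geometry Γ
  open Tail Γ a e za Ta Pe only

  re : r e ≡ P a
  re = cong r (sym Ta)

  r-out : ¬ a ~ r e
  r-out p with only p (subst InZ (sym re) (InZ-P za))
  ... | inj₁ q = P≢a (trans (sym re) q)
  ... | inj₂ q = P≢e (trans (sym re) q)

  InU : Fin m → ℕ → Fin m → Set
  InU x k w = ∃ λ j → j ≤ k × col x j ~ w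

  -- The levels of the folded cylinder over `a` are fused into one strip that is a path, so that one
  -- more twist can move a pole of `b` to `a`. The fields `off` and `DTa` keep the rest of the
  -- surface and the step from `a` to `e` in place.
  record Joining : Set₁ where
    field
      {t'} : Trip m
      stp  : Step d z₀ 2 t t'
    private module D = Geometry (Step.good stp)
    field
      x    : Fin m
      a~x  : a ~ x
      k    : ℕ
      fld  : Fold x k
      U→   : ∀ {w} → InU x k w → a D.~ w
      U←   : ∀ {w} → a D.~ w → InU x k w
      Dg   : ∀ {w} → a D.~ w → a D.~ D.g w
      off  : ∀ {w} → ¬ InU x k w → D.r w ≡ r w × D.g w ≡ g w × D.b w ≡ b w
      DTa  : D.T a ≡ e

  private
    centre-≢e : ∀ {x} → a ~ x → a ~ r x → x ≢ e
    centre-≢e p q refl = r-out q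

    -- `r` fixes `x` at the bottom, and the alignment turns the column back at the top. The vertical
    -- strip through `x` is thus one column, which meets every level once.
    joining-even : ∀ x → a ~ x → r x ≡ x → Joining
    joining-even x a~x rx = record
      { stp = step-trans A.stp X.stp ; x = x ; a~x = a~x ; k = A.k ; fld = A.fld
      ; U→ = U→ ; U← = U← ; Dg = λ p → D.~-trans a~x₃ (J.join-closed (D.~-trans (D.~-sym a~x₃) p))
      ; off = λ nu → trans (X.Dr-off (λ q → nu (E⊆U q))) (A.c-off 1 (λ q → nu (A.k , ≤-refl , q))) ,
                     trans (X.Dg-off (λ q → nu (E⊆U q))) (A.c-off 0 (λ q → nu (A.k , ≤-refl , q))) ,
                     trans (X.Db _) (A.b-off (λ q → nu (A.k , ≤-refl , q)))
      ; DTa = trans (X.DT-off (λ q → e∉E (subst X.E (trans (A.T-same a) Ta) q))) (trans (A.T-same a) Ta) }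
      where
      zx : ZC x
      zx = ZC-~ a~x (InZ⇒ZC za)
      al : Aligned Γ x x
      al = align Γ x x zx ~-refl
      module A = Aligned al
      module F = AlignedFacts Γ zx ~-refl al
      module D₁ = Geometry A.good
      rx₁ : D₁.r x ≡ x
      rx₁ = trans (A.r-keep zx) rx
      module L = Ladder A.good {x} {x} {A.k} {A.k} rx₁ (inj₁ (A.k , ≤-refl , F.top-u)) (inj₁ (A.k , ≤-refl , F.top-u))
      module X = VTwist A.good x (straight-loop A.good x A.k F.top-u)
      module D = Geometry (Step.good X.stp)
      rung : ∀ {w} → L.InL w → ∃ λ j → j ≤ A.k × w ≡ col x j
      rung (inj₁ (j , j≤ , p)) = j , j≤ , trans p (F.same-u j j≤)
      rung (inj₂ (j , j≤ , p)) = j , j≤ , trans p (F.same-u j j≤)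
      hit : ∀ {w w'} → X.E w → X.E w' → w D₁.~ w' → w ≡ w'
      hit p q s with rung (L.L-orbit p) | rung (L.L-orbit q)
      ... | i , i≤ , refl | j , j≤ , refl = cong (col x) (Fold-distinct zx A.fld i≤ j≤ (A.~← s))
      module J = X.Joined hit
      E⊆U : ∀ {w} → X.E w → InU x A.k w
      E⊆U p with rung (L.L-orbit p)
      ... | j , j≤ , refl = j , j≤ , ~-refl
      E-col : ∀ j → X.E (D₁.col x j)
      E-col zero = X.E-base
      E-col (suc j) with D₁.c-kind j
      ... | inj₁ q = subst X.E (sym (q _)) (X.E-g (E-col j))
      ... | inj₂ (_ , q) = subst X.E (sym (q _)) (X.E-r (E-col j))
      a~x₃ : a D.~ x
      a~x₃ = J.join-~ (A.~→ a~x)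
      U→ : ∀ {w} → InU x A.k w → a D.~ w
      U→ (j , j≤ , p) = D.~-trans a~x₃ (D.~-trans (J.join-E X.E-base (subst X.E (F.same-u j j≤) (E-col j)))
                          (J.join-class (subst X.E (F.same-u j j≤) (E-col j)) (A.~→ p)))
      U← : ∀ {w} → a D.~ w → InU x A.k w
      U← {w} p = go (J.join-⊆ X.E-base (D.~-trans (D.~-sym a~x₃) p))
        where
        go : (∃ λ w' → X.E w' × w' D₁.~ w) → InU x A.k w
        go (w' , Ew' , q) with rung (L.L-orbit Ew')
        ... | j , j≤ , refl = j , j≤ , A.~← q
      e∉E : ¬ X.E e
      e∉E p with rung (L.L-orbit p)
      ... | zero , _ , q = centre-≢e a~x (subst (a ~_) (sym rx) a~x) (sym q)
      ... | suc j , j≤ , q = Fold.free≤ A.fld (suc j) (s≤s z≤n) j≤ (subst ZC q (InZ⇒ZC ze))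

    -- Here the columns over `x` and `T x` form a ladder that meets every level twice. The vertical
    -- orbit of `x` takes the even rungs of one column and the odd rungs of the other, hence each
    -- level once. It avoids Z and is folded by `b`, so the twist is a `TwR` of the exchanged
    -- surface.
    joining-odd : ∀ x → a ~ x → r x ≡ T x → ¬ InZ x → Joining
    joining-odd x a~x rx ¬zx = record
      { stp = step-trans A.stp stp₂ ; x = x ; a~x = a~x ; k = A.k ; fld = A.fld
      ; U→ = U→ ; U← = U← ; Dg = Dg'
      ; off = λ nu → trans (TwR.b-all W _) (A.c-off 1 (λ q → nu (A.k , ≤-refl , q))) ,
                     trans (TwR.g-all W _) (A.c-off 0 (λ q → nu (A.k , ≤-refl , q))) ,
                     trans (TwR.r-off W (λ q → nu (E⊆U q))) (A.b-off (λ q → nu (A.k , ≤-refl , q)))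
      ; DTa = trans (off₂ (λ q → e∉E₂ (subst E₂ (trans (A.T-same a) Ta) q))) (trans (A.T-same a) Ta) }
      where
      zx : ZC x
      zx = ZC-~ a~x (InZ⇒ZC za)
      y : Fin m
      y = T x
      al : Aligned Γ x y
      al = align Γ x y zx ~-step
      module A = Aligned al
      module F = AlignedFacts Γ zx ~-step al
      module D₁ = Geometry A.good
      rx₁ : D₁.r x ≡ y
      rx₁ = trans (A.r-keep zx) rx
      module V = Alg (swapRB A.t') (Good.I (good-swap A.good))
      module Tw = Twist (swapRB A.t') (Good.I (good-swap A.good))
      open Tw using (TwR; module TwR; module TwRFacts)

      PL : Bool → Fin m → Set
      PL β w = (∃ λ j → j ≤ A.k × even? j ≡ β × w ≡ D₁.col x j) ⊎ (∃ λ j → j ≤ A.k × even? j ≡ not β × w ≡ D₁.col y j)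

      even-next : ∀ {j β} → even? j ≡ β → even? (suc j) ≡ not β
      even-next p = cong not p
      even-prev : ∀ {j β} → even? (suc j) ≡ β → even? j ≡ not β
      even-prev {j} p = trans (sym (not-involutive (even? j))) (cong not p)

      stepU : ∀ {β w} j → j ≤ A.k → even? j ≡ β → w ≡ D₁.col x (suc j) → PL (not β) w
      stepU {β} j j≤k ev q with m≤n⇒m<n∨m≡n j≤k
      ... | inj₁ j<k = inj₁ (suc j , j<k , even-next {j} ev , q)
      ... | inj₂ refl = inj₂ (j , ≤-refl , trans ev (sym (not-involutive β)) , trans q F.top-u)
      stepV : ∀ {β w} j → j ≤ A.k → even? j ≡ not β → w ≡ D₁.col y (suc j) → PL (not β) w
      stepV {β} j j≤k ev q with m≤n⇒m<n∨m≡n j≤k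
      ... | inj₁ j<k = inj₂ (suc j , j<k , even-next {j} ev , q)
      ... | inj₂ refl = inj₁ (j , ≤-refl , ev , trans q F.top-v)

      PL-g : ∀ {β w} → PL β w → PL (not β) (D₁.g w)
      PL-g (inj₁ (j , j≤ , ev , refl)) with g-nbr A.good x j
      ... | inj₁ q = stepU j j≤ ev q
      ... | inj₂ (i , refl , q) = inj₁ (i , <⇒≤ j≤ , even-prev {i} ev , q)
      PL-g {β} (inj₂ (j , j≤ , ev , refl)) with g-nbr A.good y j
      ... | inj₁ q = stepV j j≤ ev q
      ... | inj₂ (i , refl , q) = inj₂ (i , <⇒≤ j≤ , even-prev {i} ev , q)

      PL-r : ∀ {β w} → PL β w → PL (not β) (D₁.r w)
      PL-r {β} (inj₁ (j , j≤ , ev , refl)) with r-nbr A.good x j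
      ... | inj₁ refl = inj₂ (0 , z≤n , trans ev (sym (not-involutive β)) , rx₁)
      ... | inj₂ (inj₁ q) = stepU j j≤ ev q
      ... | inj₂ (inj₂ (i , refl , q)) = inj₁ (i , <⇒≤ j≤ , even-prev {i} ev , q)
      PL-r {β} (inj₂ (j , j≤ , ev , refl)) with r-nbr A.good y j
      ... | inj₁ refl = inj₁ (0 , z≤n , ev , trans (cong D₁.r (sym rx₁)) (D₁.rr x))
      ... | inj₂ (inj₁ q) = stepV j j≤ ev q
      ... | inj₂ (inj₂ (i , refl , q)) = inj₂ (i , <⇒≤ j≤ , even-prev {i} ev , q)

      E₁ : Fin m → Set
      E₁ w = x V.~ w

      PL-orbit : ∀ {w} → E₁ w → PL true w
      PL-orbit (zero , refl) = inj₁ (0 , z≤n , refl , refl)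
      PL-orbit (suc i , refl) = PL-g (PL-r (PL-orbit (i , refl)))

      rung : ∀ {β w} → PL β w → ∃ λ j → j ≤ A.k × col x j ~ w
      rung (inj₁ (j , j≤ , _ , p)) = j , j≤ , ~-≡ (sym (trans p (F.same-u j j≤)))
      rung (inj₂ (j , j≤ , _ , p)) = j , j≤ , ~-trans (F.u~v j (≤-trans j≤ (n≤1+n _))) (~-≡ (sym (trans p (F.same-v j j≤))))

      E⊆U : ∀ {w} → E₁ w → InU x A.k w
      E⊆U p = rung (PL-orbit p)

      PL-hit : ∀ {w w'} → PL true w → PL true w' → w ~ w' → w ≡ w'
      PL-hit p q s with rung p | rung q
      PL-hit (inj₁ (i , i≤ , _ , p)) (inj₁ (j , j≤ , _ , q)) s | _ | _ =
        trans p (trans (cong (D₁.col x) (Fold-distinct zx A.fld i≤ j≤ (~-trans (~-≡ (sym (trans p (F.same-u i i≤)))) (~-trans s (~-≡ (trans q (F.same-u j j≤))))))) (sym q))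
      PL-hit (inj₂ (i , i≤ , _ , p)) (inj₂ (j , j≤ , _ , q)) s | _ , _ , i~ | _ , _ , j~ =
        trans p (trans (cong (D₁.col y) (Fold-distinct zx A.fld i≤ j≤
          (~-trans (F.u~v i (≤-trans i≤ (n≤1+n _))) (~-trans (~-≡ (sym (trans p (F.same-v i i≤)))) (~-trans s (~-trans (~-≡ (trans q (F.same-v j j≤))) (~-sym (F.u~v j (≤-trans j≤ (n≤1+n _))))))))))
          (sym q))
      PL-hit (inj₁ (i , i≤ , ei , p)) (inj₂ (j , j≤ , ej , q)) s | _ | _ with Fold-distinct zx A.fld i≤ j≤
          (~-trans (~-≡ (sym (trans p (F.same-u i i≤)))) (~-trans s (~-trans (~-≡ (trans q (F.same-v j j≤))) (~-sym (F.u~v j (≤-trans j≤ (n≤1+n _)))))))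
      ... | refl with trans (sym ei) ej
      ...   | ()
      PL-hit (inj₂ (i , i≤ , ei , p)) (inj₁ (j , j≤ , ej , q)) s | _ | _ with Fold-distinct zx A.fld i≤ j≤
          (~-trans (F.u~v i (≤-trans i≤ (n≤1+n _))) (~-trans (~-≡ (sym (trans p (F.same-v i i≤)))) (~-trans s (~-≡ (trans q (F.same-u j j≤))))))
      ... | refl with trans (sym ei) ej
      ...   | ()

      PL-free : ∀ {w} → PL true w → ¬ D₁.InZ w
      PL-free (inj₁ (zero , _ , _ , refl)) zw = ¬zx (step-InZ⁻ Γ A.stp zw)
      PL-free (inj₁ (suc j , j≤ , _ , refl)) zw = F.free-u (suc j) (s≤s z≤n) j≤ (D₁.InZ⇒ZC zw)
      PL-free (inj₂ (zero , _ , () , _)) zw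
      PL-free (inj₂ (suc j , j≤ , _ , refl)) zw = F.free-v (suc j) (s≤s z≤n) j≤ (D₁.InZ⇒ZC zw)

      x~b : x V.~ V.r x
      x~b = 1 , trans (cong D₁.g rx₁) (trans (cong D₁.g (sym (A.T-same x))) (D₁.gT≡b x))

      nz : ¬ V.ZC x
      nz (w , p , zw) = PL-free (PL-orbit p) (InZ-swap⁻ A.good zw)

      t₂ : Trip m
      t₂ = proj₁ (Tw.twR x 1)
      W : TwR x 1 t₂
      W = proj₂ (Tw.twR x 1)
      open TwRFacts x~b nz W using (r-class; r-class⁻)

      stp₂ : Step d z₀ 1 A.t' (swapRB t₂)
      stp₂ = step-swap (good-swap A.good) (stepR (good-swap A.good) x~b nz W)
      module D = Geometry (Step.good stp₂)

      -- Only `b` is twisted. The new translation is therefore `T` followed by the conjugate of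
      -- `V.T` by `g`, which is `V.T⁻`, on the image of the orbit under `g`.
      E₂ : Fin m → Set
      E₂ w = E₁ (D₁.g w)

      b⇒E : ∀ {w} → E₁ (D₁.b w) → E₁ w
      b⇒E {w} p = subst E₁ (D₁.bb w) (r-class p)

      on₂ : ∀ {w} → E₂ (D₁.T w) → D.T w ≡ V.T⁻ (D₁.T w)
      on₂ {w} p = trans (TwR.g-all W _) (trans (cong D₁.g (TwR.r-on W (b⇒E (subst E₁ (D₁.gg _) p)))) (V.gT (D₁.b w)))

      off₂ : ∀ {w} → ¬ E₂ (D₁.T w) → D.T w ≡ D₁.T w
      off₂ {w} np = trans (TwR.g-all W _) (cong D₁.g (TwR.r-off W (λ p → np (subst E₁ (sym (D₁.gg _)) (r-class p)))))

      hE : ∀ {w} → E₂ w → E₂ (V.T⁻ w)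
      hE {w} p = V.~-trans p (1 , trans (cong (V.T ∘ D₁.g) (sym (V.TT⁻ w))) (trans (cong V.T (V.gT (V.T⁻ w))) (V.TT⁻ _)))

      one : ∀ {w w'} → E₂ w → E₂ w' → ∃ λ k → iter V.T⁻ k w ≡ w'
      one {w} {w'} p q with V.~-trans (V.~-sym p) q
      ... | k , s = k , trans (cong (iter V.T⁻ k) (sym (D₁.gg w))) (trans (sym (V.gTk k _)) (trans (cong D₁.g s) (D₁.gg w')))

      hit₂ : ∀ {w w'} → E₂ w → E₂ w' → w D₁.~ w' → w ≡ w'
      hit₂ p q s = D₁.g-inj (PL-hit (PL-orbit p) (PL-orbit q) (A.~← (D₁.g-cong s)))

      module M = Merge D₁.T D₁.T⁻ D₁.TT⁻ D₁.T⁻T D.T D.T⁻ D.TT⁻ D.T⁻T V.T⁻ E₂ (λ w → V.~-dec x (D₁.g w))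

      E-even : ∀ h → E₁ (D₁.col x (h + h))
      E-even zero = V.~-refl
      E-even (suc h) = subst (λ j → E₁ (D₁.col x (suc j))) (sym (+-suc h h))
        (V.~-trans (E-even h) (V.~-trans V.~-step⁻ (V.~-≡ (sym (trans (D₁.c-r (h , refl) _) (cong D₁.r (D₁.c-g (h , refl) _)))))))

      E-odd : ∀ h → E₁ (D₁.col y (suc (h + h)))
      E-odd zero = 1 , cong D₁.g rx₁
      E-odd (suc h) = subst (λ j → E₁ (D₁.col y (suc (suc j)))) (sym (+-suc h h))
        (V.~-trans (E-odd h) (1 , sym (trans (D₁.c-g (h , refl) _) (cong D₁.g (D₁.c-r (h , refl) _)))))

      rep : ∀ j → j ≤ A.k → ∃ λ w → E₂ w × col x j ~ w
      rep j j≤ with parity j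
      ... | inj₁ (h , refl) = D₁.col y (h + h) , subst E₁ (D₁.c-g (h , refl) _) (E-odd h) ,
              ~-trans (F.u~v (h + h) (≤-trans j≤ (n≤1+n _))) (~-≡ (sym (F.same-v (h + h) j≤)))
      ... | inj₂ (h , refl) = D₁.col x (suc (h + h)) , subst E₁ (sym (trans (cong D₁.g (D₁.c-g (h , refl) _)) (D₁.gg _))) (E-even h) ,
              ~-≡ (sym (F.same-u (suc (h + h)) j≤))

      a~₂ : ∀ {w} → a ~ w → a D.~ w
      a~₂ p = M.merge-~ hit₂ on₂ off₂ hE one (A.~→ p)

      U→ : ∀ {w} → InU x A.k w → a D.~ w
      U→ {w} (j , j≤ , p) = go (rep j j≤) (rep 0 z≤n)
        where
        go : (∃ λ w' → E₂ w' × col x j ~ w') → (∃ λ w₀ → E₂ w₀ × col x 0 ~ w₀) → a D.~ w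
        go (w' , Ew , q) (w₀ , Ew₀ , q₀) = D.~-trans (a~₂ (~-trans a~x q₀)) (D.~-trans (M.merge-E hit₂ on₂ off₂ hE one Ew₀ Ew)
              (M.merge-class hit₂ on₂ off₂ hE one Ew (A.~→ (~-trans (~-sym q) p))))

      E₂⊆PL : ∀ {w} → E₂ w → PL false w
      E₂⊆PL {w} p = subst (PL false) (D₁.gg w) (PL-g (PL-orbit p))

      U← : ∀ {w} → a D.~ w → InU x A.k w
      U← {w} p = go (rep 0 z≤n)
        where
        fin : (∃ λ w' → E₂ w' × w' D₁.~ w) → InU x A.k w
        fin (w' , Ew' , q) with rung (E₂⊆PL Ew')
        ... | j , j≤ , s = j , j≤ , ~-trans s (A.~← q)
        go : (∃ λ w₀ → E₂ w₀ × col x 0 ~ w₀) → InU x A.k w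
        go (w₀ , Ew₀ , q₀) = fin (M.merge-⊆ hit₂ on₂ off₂ hE one Ew₀ (D.~-trans (D.~-sym (a~₂ (~-trans a~x q₀))) p))

      Dg' : ∀ {w} → a D.~ w → a D.~ D.g w
      Dg' {w} p = go (U← p)
        where
        go : InU x A.k w → a D.~ D.g w
        go (j , j≤ , s) with rung (PL-g (inj₁ (j , j≤ , refl , refl)))
        ... | i , i≤ , q = U→ (i , i≤ , ~-trans q (~-trans (A.~← (D₁.g-cong (A.~→ (~-trans (~-≡ (F.same-u j j≤)) s)))) (~-≡ (sym (TwR.g-all W w)))))

      e∉E₂ : ¬ E₂ e
      e∉E₂ p with E₂⊆PL p
      ... | inj₁ (zero , _ , _ , q) = centre-≢e a~x (subst (a ~_) (sym rx) (~-trans a~x ~-step)) (sym q)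
      ... | inj₂ (zero , _ , _ , q) = centre-≢e (~-trans a~x ~-step) (subst (a ~_) (trans (sym (rr x)) (cong r rx)) a~x) (sym q)
      ... | inj₁ (suc j , j≤ , _ , q) = F.free-u (suc j) (s≤s z≤n) j≤ (subst D₁.ZC q (A.ZC→ (InZ⇒ZC ze)))
      ... | inj₂ (suc j , j≤ , _ , q) = F.free-v (suc j) (s≤s z≤n) j≤ (subst D₁.ZC q (A.ZC→ (InZ⇒ZC ze)))

  opaque
    joining : Joining
    joining with centre
    ... | x , a~x , inj₁ rx = joining-even x a~x rx
    ... | x , a~x , inj₂ (rx , ¬zx) = joining-odd x a~x rx ¬zx

module Finish {m : ℕ} {t : Trip m} {d : ℕ} {z₀ : Fin m} (Γ : Good t d z₀) (a e : Fin m)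
            (za : Alg.InZ t (Good.I Γ) a) (Ta : Alg.T t (Good.I Γ) a ≡ e) (Pe : Alg.P t (Good.I Γ) e ≡ a)
            (only : ∀ {w} → Alg._~_ t (Good.I Γ) a w → Alg.InZ t (Good.I Γ) w → w ≡ a ⊎ w ≡ e)
            (P≢a : Alg.P t (Good.I Γ) a ≢ a) (P≢e : Alg.P t (Good.I Γ) a ≢ e)
            (vtrans : Transitive (swapRB t))
            (J : Core.Joining Γ a e za Ta Pe only P≢a P≢e) where
  open Geometry Γ
  open Core Γ a e za Ta Pe only P≢a P≢e using (re; r-out; InU; module Joining)
  open Tail Γ a e za Ta Pe only using (ze; e~a; r-stays)
  open Joining J
  private module D = Geometry (Step.good stp)

  U : Fin m → Set
  U = InU x k

  U-Z : ∀ {w} → U w → InZ w → w ≡ a ⊎ w ≡ e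
  U-Z (zero , _ , p) zw = only (~-trans a~x p) zw
  U-Z (suc j , j≤ , p) zw = ⊥-elim (Fold.free≤ fld (suc j) (s≤s z≤n) j≤ (_ , p , zw))

  U-~ : ∀ {w w'} → w ~ w' → U w → U w'
  U-~ p (j , j≤ , q) = j , j≤ , ~-trans q p

  a∈U : ∀ {w} → a ~ w → U w
  a∈U p = 0 , z≤n , ~-trans (~-sym a~x) p

  private
    U-up : ∀ j → j ≤ k → U (col x (suc j))
    U-up j j≤k with m≤n⇒m<n∨m≡n j≤k
    ... | inj₁ j<k = suc j , j<k , ~-refl
    ... | inj₂ refl = k , ≤-refl , ~-sym (Fold.turn fld)

  U-g : ∀ {w} → U w → U (g w)
  U-g (j , j≤ , p) with g-nbr Γ x j
  ... | inj₁ q = U-~ (~-trans (~-≡ (sym q)) (g-cong p)) (U-up j j≤)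
  ... | inj₂ (i , refl , q) = i , <⇒≤ j≤ , ~-trans (~-≡ (sym q)) (g-cong p)

  U-r : ∀ {w} → U w → w ≢ e → U (r w)
  U-r (zero , j≤ , p) w≢e = a∈U (r-stays (~-trans a~x p) w≢e)
  U-r (suc j , j≤ , p) w≢e with r-nbr Γ x (suc j)
  ... | inj₂ (inj₁ q) = U-~ (~-trans (~-≡ (sym q)) (r-cong (Fold.free≤ fld (suc j) (s≤s z≤n) j≤) p)) (U-up (suc j) j≤)
  ... | inj₂ (inj₂ (i , refl , q)) = i , <⇒≤ j≤ , ~-trans (~-≡ (sym q)) (r-cong (Fold.free≤ fld (suc j) (s≤s z≤n) j≤) p)

  c₀ : Fin m
  c₀ = r e

  c∉U : ¬ U c₀
  c∉U u with U-Z u (subst InZ (sym re) (InZ-P za))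
  ... | inj₁ q = P≢a (trans (sym re) q)
  ... | inj₂ q = P≢e (trans (sym re) q)

  a~ga : a D.~ D.g a
  a~ga = Dg D.~-refl

  private
    ba~a : D.b a D.~ a
    ba~a = D.~-sym (D.~-trans a~ga (D.gb~ a))
    s : ℕ
    -- This amount of twist brings `b a` back to `a`; since `T a ≡ e` survives the twist, `g a ≡ e`
    -- follows.
    s = proj₁ ba~a
    tw = Twist.twG t' (Good.I (Step.good stp)) a s

  t″ : Trip m
  t″ = proj₁ tw
  private
    W : Twist.TwG t' (Good.I (Step.good stp)) a s t″
    W = proj₂ tw
  open Twist.TwG W
  open Twist.TwGFacts t' (Good.I (Step.good stp)) a~ga W using (T-same)

  stp″ : Step d z₀ 3 t t″
  stp″ = step-trans stp (stepG (Step.good stp) a~ga W)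

  ba : Trip.b t″ a ≡ a
  ba = trans (b-on D.~-refl) (proj₂ ba~a)

  ga : Trip.g t″ a ≡ e
  ga = trans (cong (Trip.g t″) (sym ba)) (trans (T-same a) DTa)

  b-keep : ∀ {w} → InZ w → w ≢ a → w ≢ e → Trip.b t″ w ≡ b w
  b-keep {w} zw w≢a w≢e = trans (b-off (λ p → nu (U← p))) (proj₂ (proj₂ (off nu)))
    where
    nu : ¬ U w
    nu u with U-Z u zw
    ... | inj₁ q = w≢a q
    ... | inj₂ q = w≢e q

  private
    I″ : Inv t″
    I″ = Good.I (Step.good stp″)
    module V = Alg (swapRB t″) (inv-swap I″)

    V-≡ : ∀ {w w'} → V.T w ≡ w' → w V.~ w'
    V-≡ p = 1 , p

    r-off″ : ∀ {w} → ¬ U w → Trip.r t″ w ≡ r w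
    r-off″ nu = trans (r-all _) (proj₁ (off nu))

    g-off″ : ∀ {w} → ¬ U w → Trip.g t″ w ≡ g w
    g-off″ nu = trans (g-off (λ p → nu (U← p))) (proj₁ (proj₂ (off nu)))

    za' : D.InZ a
    za' = step-InZ Γ stp za
    Pe' : D.P e ≡ a
    Pe' = trans (step-P Γ stp ze) Pe
    only' : ∀ {w} → a D.~ w → D.InZ w → w ≡ a ⊎ w ≡ e
    only' p zw = U-Z (U← p) (step-InZ⁻ Γ stp zw)

    module L = Tail (Step.good stp) a e za' DTa Pe' only'

    gT⁻ : ∀ j → D.g (iter D.T⁻ j a) ≡ iter D.T j (D.g a)
    gT⁻ j = trans (sym (D.ff⁻k j _)) (cong (iter D.T j) (trans (sym (D.gTk j _)) (cong D.g (D.ff⁻k j a))))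

    -- Inside the fused class both factors are reflections: `r` takes `tail j` to the element `j`
    -- steps before `a`, and the twisted `g`, which exchanges `a` and `e`, takes that to the element
    -- `j` steps after `e`. So a vertical step is one horizontal step back.
    back-one : ∀ j → j ≤ L.n → V.T (L.tail j) ≡ iter D.T j e
    back-one j j≤ = trans (cong (Trip.g t″) (trans (r-all _) (L.r-tail j j≤)))
      (trans (g-on (D.~-iter⁻ j)) (trans (cong (iter D.T s) (gT⁻ j)) (trans (iter-swap D.T s j _)
        (cong (iter D.T j) (trans (sym (g-on D.~-refl)) ga)))))

    sweep : ∀ i j → j + i ≡ suc L.n → a V.~ iter D.T j e
    sweep zero j eq = V.~-≡ (sym (trans (cong (λ n → iter D.T n e) (trans (sym (+-identityʳ j)) eq)) L.last))
    sweep (suc i) j eq = V.~-trans (sweep i (suc j) (trans (sym (+-suc j i)) eq))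
      (V-≡ (back-one j (≤-pred (subst (suc j ≤_) (trans (sym (+-suc j i)) eq) (m≤m+n (suc j) i)))))

    U-swept : ∀ {w} → U w → a V.~ w
    U-swept u with L.members (D.~-trans L.e~a (U→ u))
    ... | inj₁ refl = sweep (suc L.n) 0 refl
    ... | inj₂ (j , j≤ , refl) with ≤⇒offset j≤
    ...   | i , eq = sweep i (suc j) (cong suc eq)

    ge : Trip.g t″ e ≡ a
    ge = trans (cong (Trip.g t″) (sym ga)) (Inv.gg I″ a)

    rc : Trip.r t″ c₀ ≡ e
    rc = trans (r-off″ c∉U) (rr e)

    re″ : Trip.r t″ e ≡ c₀
    re″ = trans (cong (Trip.r t″) (sym rc)) (Inv.rr I″ c₀)

    eU : U e
    eU = a∈U (~-sym e~a)

    -- The old vertical line leaves `U` only from `e`, through `c₀`, and enters it only at `c₀`.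
    -- Outside `U` the new line from `e` therefore follows the old one, which visited everything.
    orbit : ∀ i → let w = iter (λ v → g (r v)) i e in U w ⊎ (e V.~ w)
    orbit zero = inj₁ eU
    orbit (suc i) with orbit i | U? (iter (λ v → g (r v)) i e)
      where
      U? : ∀ w → Dec (U w)
      U? w = map′ U← U→ (D.~-dec a w)
    ... | _ | yes u = inU _ u (_ FinP.≟ e)
      where
      inU : ∀ w → U w → Dec (w ≡ e) → U (g (r w)) ⊎ (e V.~ g (r w))
      inU w u (yes refl) = inj₂ (V-≡ (trans (cong (Trip.g t″) re″) (g-off″ c∉U)))
      inU w u (no w≢e) = inj₁ (U-g (U-r u w≢e))
    ... | inj₁ u | no nu = ⊥-elim (nu u)
    ... | inj₂ p | no nu = outU _ nu p (_ FinP.≟ c₀)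
      where
      outU : ∀ w → ¬ U w → e V.~ w → Dec (w ≡ c₀) → U (g (r w)) ⊎ (e V.~ g (r w))
      outU w nu p (yes refl) = inj₁ (U-g (subst U (sym (rr e)) eU))
      outU w nu p (no w≢c) = inj₂ (V.~-trans p (V-≡ (trans (cong (Trip.g t″) (r-off″ nu)) (g-off″ nr))))
        where
        nr : ¬ U (r w)
        nr u = nu (subst U (rr w) (U-r u (λ q → w≢c (trans (sym (rr w)) (cong r q)))))

    reach-out : ∀ {w} → ¬ U w → e V.~ w
    reach-out {w} nu with vtrans e w
    ... | i , refl with orbit i
    ...   | inj₁ u = ⊥-elim (nu u)
    ...   | inj₂ p = p

    reach-a : e V.~ a
    reach-a = V.~-trans (reach-out c∉U) (V-≡ (trans (cong (Trip.g t″) rc) ge))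

    reach-any : ∀ w → e V.~ w
    reach-any w with D.~-dec a w
    ... | yes p = V.~-trans reach-a (U-swept (U← p))
    ... | no np = reach-out (λ u → np (U→ u))

  opaque
    vtrans″ : Transitive (swapRB t″)
    vtrans″ x y = V.~-trans (V.~-sym (reach-any x)) (reach-any y)

opaque
  straighten : ∀ {m} {t : Trip m} {d : ℕ} {z₀ : Fin m} (Γ : Good t d z₀) (a e : Fin m) → let open Geometry Γ in
    InZ a → T a ≡ e → P e ≡ a → (∀ {w} → a ~ w → InZ w → w ≡ a ⊎ w ≡ e) → P a ≢ a → P a ≢ e →
    Transitive (swapRB t) →
    ∃ λ t″ → Step d z₀ 3 t t″ × Transitive (swapRB t″) × Trip.b t″ a ≡ a ×
      (∀ {w} → InZ w → w ≢ a → w ≢ e → Trip.b t″ w ≡ b w)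
  straighten Γ a e za Ta Pe only P≢a P≢e vt = F.t″ , F.stp″ , F.vtrans″ , F.ba , F.b-keep
    where
    module F = Finish Γ a e za Ta Pe only P≢a P≢e vt (Core.joining Γ a e za Ta Pe only P≢a P≢e)

-- Shrinking the star to its canonical form

module _ {m : ℕ} {t : Trip m} {d : ℕ} {z₀ : Fin m} (Γ : Good t d z₀) (tr : Transitive t) where
  open Geometry Γ
  private module V = Geometry (good-swap Γ)

  -- With the vertical folding aligned, the two intervals ending at z (i+1) and z (i+2) are a union of vertical classes.
  opaque
    two-intervals : ∀ i → g (r (z (suc i))) ≡ z (2 + i) → ∀ {w} → z (suc i) V.~ w → InZ w → w ≡ z (suc i) ⊎ w ≡ z (2 + i)
    two-intervals i align p zw with star (z i) (z-InZ i) (tr _ _) | star (z (suc i)) (z-InZ (suc i)) (tr _ _)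
    ... | L₁ , N₁ , e₁ | L₂ , N₂ , e₂ = seg-Z (seg-orbit p) zw
      where
      s₀ : Fin m
      s₀ = T (z i)
      at₁ : ∀ j → iter T j s₀ ≡ iter T (suc j) (z i)
      at₁ j = iter-shift T j (z i)
      at₂ : ∀ j → iter T (L₁ + suc j) s₀ ≡ iter T (suc j) (z (suc i))
      at₂ j = trans (cong (λ n → iter T n s₀) (+-comm L₁ (suc j))) (trans (iter-+ T (suc j) L₁ s₀)
                (cong (iter T (suc j)) (trans (at₁ L₁) e₁)))
      Seg : Fin m → Set
      Seg w = ∃ λ p → ∃ λ q → p + q ≡ L₁ + suc L₂ × w ≡ iter T p s₀
      end : iter T (L₁ + suc L₂) s₀ ≡ z (2 + i)
      end = trans (at₂ L₂) e₂
      split : ∀ p → (∃ λ q → p + q ≡ L₁) ⊎ (∃ λ p' → p ≡ L₁ + suc p')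
      split p with p ≤? L₁
      ... | yes p≤ = inj₁ (≤⇒offset p≤)
      ... | no p≰ with <⇒offset (≰⇒> p≰)
      ...   | p' , eq = inj₂ (p' , sym eq)
      -- By `star` each of the two segments is folded onto itself, so `r` reverses each of them
      -- separately.
      r₁ : ∀ p q → p + q ≡ L₁ → r (iter T p s₀) ≡ iter T q s₀
      r₁ p q eq = trans (r-run p s₀ (λ j j<p → subst (¬_ ∘ InZ) (sym (at₁ j)) (Next.before N₁ j (<-≤-trans j<p (subst (p ≤_) eq (m≤m+n p q))))))
        (trans (cong (iter T⁻ p) (trans (sym e₁) (trans (sym (at₁ L₁)) (trans (cong (λ n → iter T n s₀) (sym eq)) (iter-+ T p q s₀))))) (f⁻fk p _))
      r₂ : ∀ p q → p + q ≡ L₂ → r (iter T (suc p) (z (suc i))) ≡ iter T (suc q) (z (suc i))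
      r₂ p q eq = trans (cong r (sym (iter-shift T p _)))
        (trans (r-run p (T (z (suc i))) (λ j j<p → subst (¬_ ∘ InZ) (sym (iter-shift T j _)) (Next.before N₂ j (<-≤-trans j<p (subst (p ≤_) eq (m≤m+n p q))))))
          (trans (cong (iter T⁻ p) (trans (sym e₂) (trans (cong (λ n → iter T n (z (suc i))) (trans (cong suc (sym eq)) (sym (+-suc p q)))) (iter-+ T p (suc q) _)))) (f⁻fk p _)))
      seg-r : ∀ {w} → Seg w → Seg (r w)
      seg-r (p , q , eq , refl) with split p
      ... | inj₁ (q' , eq') = q' , p + suc L₂ , trans (sym (+-assoc q' p (suc L₂))) (cong (_+ suc L₂) (trans (+-comm q' p) eq')) , r₁ p q' eq'
      ... | inj₂ (p' , refl) = L₁ + suc q , p' , trans (+-assoc L₁ (suc q) p') (cong (λ n → L₁ + suc n) (trans (+-comm q p') pq)) ,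
              trans (cong r (at₂ p')) (trans (r₂ p' q pq) (sym (at₂ q)))
        where
        pq : p' + q ≡ L₂
        pq = suc-injective (+-cancelˡ-≡ L₁ _ _ (trans (sym (+-assoc L₁ (suc p') q)) eq))
      -- `s₀` is `r (z (suc i))`, so the alignment says that `g` takes one end of the union to the
      -- other and hence reverses the union as a whole.
      seg-g : ∀ {w} → Seg w → Seg (g w)
      seg-g (p , q , eq , refl) = q , p , trans (+-comm q p) eq ,
        trans (gTk p s₀) (trans (cong (iter T⁻ p) (trans (cong g (sym (rP (z i)))) (trans align (trans (sym end)
          (trans (cong (λ n → iter T n s₀) (sym eq)) (iter-+ T p q s₀)))))) (f⁻fk p _))
      seg-orbit : ∀ {w} → z (suc i) V.~ w → Seg w
      seg-orbit (zero , refl) = L₁ , suc L₂ , refl , sym (trans (at₁ L₁) e₁)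
      seg-orbit (suc n , refl) = seg-g (seg-r (seg-orbit (n , refl)))
      seg-Z : ∀ {w} → Seg w → InZ w → w ≡ z (suc i) ⊎ w ≡ z (2 + i)
      seg-Z (p , q , eq , refl) zw with split p
      ... | inj₁ (zero , eq') = inj₁ (trans (cong (λ n → iter T n s₀) (trans (sym (+-identityʳ p)) eq')) (trans (at₁ L₁) e₁))
      ... | inj₁ (suc q' , eq') = ⊥-elim (Next.before N₁ p (subst (p <_) eq' (subst (_≤ p + suc q') (+-comm p 1) (+-monoʳ-≤ p (s≤s z≤n)))) (subst InZ (at₁ p) zw))
      ... | inj₂ (p' , refl) with m≤n⇒m<n∨m≡n (subst (p' ≤_) pq (m≤m+n p' q))
        where
        pq : p' + q ≡ L₂
        pq = suc-injective (+-cancelˡ-≡ L₁ _ _ (trans (sym (+-assoc L₁ (suc p') q)) eq))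
      ...   | inj₁ p'<L₂ = ⊥-elim (Next.before N₂ p' p'<L₂ (subst InZ (at₂ p') zw))
      ...   | inj₂ refl = inj₂ (trans (at₂ p') e₂)

  -- When `2 + i` equals `d` the second endpoint is `z 0` again, whence the extra condition on `j`
  -- in that case.
  z-apart : ∀ i j → suc i < d → j < d → j ≢ suc i → (suc (suc i) ≡ d → 1 ≤ j) → suc (suc i) ≢ j → z j ≢ z (suc i) × z j ≢ z (2 + i)
  z-apart i j i<d j<d j≢ wrap j≢' = (λ q → j≢ (z-uniq j<d i<d q)) , far (m≤n⇒m<n∨m≡n i<d)
    where
    far : 2 + i < d ⊎ 2 + i ≡ d → z j ≢ z (2 + i)
    far (inj₁ lt) q = j≢' (sym (z-uniq j<d lt q))
    far (inj₂ eq) q = prim j (wrap eq) j<d (trans q (trans (cong (λ n → iter P n z₀) eq) cyc))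

  module _ (i : ℕ) (i<d : suc i < d) (align : g (r (z (suc i))) ≡ z (2 + i)) where

    -- In the exchanged surface `P` runs backwards, so `a = z (suc i)` and `e = z (2 + i)` satisfy
    -- `P e ≡ a`, and `b` there is `r` here. The single strip required of the other direction is the
    -- hypothesis `tr`.
    straighten-aligned : ∃ λ t″ → Step d z₀ 3 t t″ × Transitive t″ × Trip.r t″ (z (suc i)) ≡ z (suc i) ×
                         (∀ j → 1 ≤ j → j < suc i → Trip.r t″ (z j) ≡ r (z j))
    straighten-aligned = unswap (straighten (good-swap Γ) (z (suc i)) (z (2 + i)) (InZ-swap Γ (z-InZ (suc i))) align (P⁻z (suc i))
        (λ p zw → two-intervals i align p (InZ-swap⁻ Γ zw)) (λ q → proj₁ apart (trans (sym (P⁻z i)) q)) (λ q → proj₂ apart (trans (sym (P⁻z i)) q)) tr)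
      where
      unswap : (∃ λ q″ → Step d z₀ 3 (swapRB t) q″ × Transitive (swapRB q″) × Trip.b q″ (z (suc i)) ≡ z (suc i) ×
                 (∀ {w} → V.InZ w → w ≢ z (suc i) → w ≢ z (2 + i) → Trip.b q″ w ≡ r w)) →
               ∃ λ t″ → Step d z₀ 3 t t″ × Transitive t″ × Trip.r t″ (z (suc i)) ≡ z (suc i) ×
                 (∀ j → 1 ≤ j → j < suc i → Trip.r t″ (z j) ≡ r (z j))
      unswap (q″ , S , tr″ , fx , kp) = swapRB q″ , step-swap (good-swap Γ) S , tr″ , fx , λ j 1≤j j<i →
        let ap = z-apart i j i<d (<-trans j<i i<d) (<⇒≢ j<i) (λ _ → 1≤j) (λ q → <-irrefl (sym q) (<-trans j<i (n<1+n _)))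
        in kp (InZ-swap Γ (z-InZ j)) (proj₁ ap) (proj₂ ap)
      apart : z i ≢ z (suc i) × z i ≢ z (2 + i)
      apart = z-apart i i i<d (<-trans (n<1+n i) i<d) (<⇒≢ (n<1+n i)) (λ eq → ≤-pred (≤-pred (subst (3 ≤_) (sym eq) d≥3)))
                (λ q → <-irrefl (sym q) (<-trans (n<1+n i) (n<1+n (suc i))))

module _ {m : ℕ} {d : ℕ} {z₀ : Fin m} where

  -- As `r (z j)` is `T (z (j - 1))`, a fixed `z j` means that the segment leaving `z (j - 1)` has
  -- length 1.
  record Fixing (i : ℕ) {t : Trip m} (Γ : Good t d z₀) : Set where
    constructor fixing
    field
      trn : Transitive t
      fixed : ∀ j → 1 ≤ j → j ≤ i → Trip.r t (Geometry.z Γ j) ≡ Geometry.z Γ j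

  retwist : ∀ {t : Trip m} (Γ : Good t d z₀) → Transitive t → ∀ x s → let open Geometry Γ in
            ∃ λ t' → Step d z₀ 1 t t' × Twist.TwG t I x s t' × Transitive t'
  retwist {t} Γ tr x s = t' , stepG Γ x~g W , W , λ a c → let (n , q) = tr a c in n , trans (iter-cong T-same n a) q
    where
    open Geometry Γ
    x~g : x ~ g x
    x~g = tr _ _
    t' : Trip m
    t' = proj₁ (Twist.twG t I x s)
    W : Twist.TwG t I x s t'
    W = proj₂ (Twist.twG t I x s)
    open Twist.TwGFacts t I x~g W using (T-same)

  opaque
    -- One twist of the single strip produces the alignment and three shears straighten. The unit
    -- segments already obtained survive because their directions are not ends of the pair being
    -- changed.
    fix-next : ∀ i {t : Trip m} (Γ : Good t d z₀) → suc i < d → Fixing i Γ →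
               ∃ λ t' → Σ (Step d z₀ 4 t t') λ S → Fixing (suc i) (Step.good S)
    fix-next i {t} Γ i<d (fixing tr fx) with tr (Trip.g t (Trip.r t (Geometry.z Γ (suc i)))) (Geometry.z Γ (2 + i))
    ... | s , es with retwist Γ tr (Trip.r t (Geometry.z Γ (suc i))) s
    ...   | t₁ , S₁ , W₁ , tr₁ = go (straighten-aligned (Step.good S₁) tr₁ i i<d al)
      where
      open Geometry Γ
      module D = Geometry (Step.good S₁)
      al : D.g (D.r (D.z (suc i))) ≡ D.z (2 + i)
      al = trans (cong (λ w → D.g (D.r w)) (Step.zs S₁ (suc i))) (trans (cong D.g (Twist.TwG.r-all W₁ _))
             (trans (Twist.TwG.g-on W₁ ~-refl) (trans es (sym (Step.zs S₁ (2 + i))))))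
      go : (∃ λ t″ → Step d z₀ 3 t₁ t″ × Transitive t″ × Trip.r t″ (D.z (suc i)) ≡ D.z (suc i) ×
             (∀ j → 1 ≤ j → j < suc i → Trip.r t″ (D.z j) ≡ D.r (D.z j))) →
           ∃ λ t' → Σ (Step d z₀ 4 t t') λ S → Fixing (suc i) (Step.good S)
      go (t″ , S₂ , tr₂ , fx₂ , kp) = t″ , step-trans S₁ S₂ , fixing tr₂ fixed'
        where
        fixed' : ∀ j → 1 ≤ j → j ≤ suc i → Trip.r t″ (iter (prodT t″) j z₀) ≡ iter (prodT t″) j z₀
        fixed' j 1≤j j≤ with m≤n⇒m<n∨m≡n j≤
        ... | inj₂ refl = trans (cong (Trip.r t″) (Step.zs S₂ (suc i))) (trans fx₂ (sym (Step.zs S₂ (suc i))))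
        ... | inj₁ j<i = trans (cong (Trip.r t″) (Step.zs S₂ j)) (trans (kp j 1≤j j<i)
                (trans (cong D.r (Step.zs S₁ j)) (trans (Twist.TwG.r-all W₁ _) (trans (fx j 1≤j (≤-pred j<i)) (sym (trans (Step.zs S₂ j) (Step.zs S₁ j)))))))

  fix-upto : ∀ i {t : Trip m} (Γ : Good t d z₀) → i < d → Transitive t →
             ∃ λ t' → Σ (Step d z₀ (i * 4) t t') λ S → Fixing i (Step.good S)
  fix-upto zero {t} Γ _ tr = t , step-refl Γ , fixing tr (λ { zero () _ ; (suc j) _ () })
  fix-upto (suc i) Γ i<d tr = go (fix-upto i Γ (<-trans (n<1+n i) i<d) tr)
    where
    go : (∃ λ t' → Σ (Step d z₀ (i * 4) _ t') λ S → Fixing i (Step.good S)) →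
         ∃ λ t' → Σ (Step d z₀ (suc i * 4) _ t') λ S → Fixing (suc i) (Step.good S)
    go (t₁ , S₁ , F₁) = go' (fix-next i (Step.good S₁) i<d F₁)
      where
      go' : (∃ λ t' → Σ (Step d z₀ 4 t₁ t') λ S → Fixing (suc i) (Step.good S)) →
            ∃ λ t' → Σ (Step d z₀ (suc i * 4) _ t') λ S → Fixing (suc i) (Step.good S)
      go' (t₂ , S₂ , F₂) = t₂ , step-≤ (≤-reflexive (+-comm (i * 4) 4)) (step-trans S₁ S₂) , F₂

  record Canonical {t : Trip m} (Γ : Good t d z₀) : Set where
    open Geometry Γ
    field
      trn   : Transitive t
      fixed : ∀ j → 1 ≤ j → j < d → r (z j) ≡ z j
      bz₀   : b z₀ ≡ z₀

  opaque
    canonise : ∀ {t : Trip m} (Γ : Good t d z₀) →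
               ∃ λ t' → Σ (Step d z₀ ((1 + d * 3) + (1 + d * 3) + (d * 4 + 1)) t t') λ S → Canonical (Step.good S)
    canonise {t} Γ with reduce Γ
    ... | t₁ , S₁ , tr₁ with fix-upto (d ∸ 1) (Step.good S₁) (d-1< (Good.d≥3 Γ)) tr₁
      where
      d-1< : ∀ {d} → 3 ≤ d → d ∸ 1 < d
      d-1< (s≤s _) = ≤-refl
    ...   | t₂ , S₂ , fixing tr₂ fx₂ with tr₂ (Trip.b t₂ z₀) z₀
    -- What remains free is the position of the reflection `b` along the single strip; it is now
    -- centred at `z₀`.
    ...     | s , es with retwist (Step.good S₂) tr₂ z₀ s
    ...       | t₃ , S₃ , W , tr₃ = t₃ , step-trans S₁ (step-≤ bound (step-trans S₂ S₃)) , record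
        { trn = tr₃
        ; fixed = λ j 1≤j j<d → trans (cong (Trip.r t₃) (Step.zs S₃ j)) (trans (Twist.TwG.r-all W _)
                    (trans (fx₂ j 1≤j (le j<d)) (sym (Step.zs S₃ j))))
        ; bz₀ = trans (Twist.TwG.b-on W (0 , refl)) es }
      where
      le : ∀ {j d} → j < d → j ≤ d ∸ 1
      le (s≤s p) = p
      bound : (d ∸ 1) * 4 + 1 ≤ d * 4 + 1
      bound = +-monoˡ-≤ 1 (*-monoˡ-≤ 4 (pred≤ d))
        where
        pred≤ : ∀ d → d ∸ 1 ≤ d
        pred≤ zero = z≤n
        pred≤ (suc d) = n≤1+n d

-- Uniqueness of the canonical form

-- In canonical form t is a cyclic order with base point z₀, on which b is the reflection fixing z₀
-- and r fixes z 1, …, z (d-1) and reverses the complementary interval; so t is determined by m and d.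
module Uniqueness {m : ℕ} {d : ℕ} {t t' : Trip m} {z₀ z₀' : Fin m} {Γ : Good t d z₀} {Γ' : Good t' d z₀'}
                  (K : Canonical Γ) (K' : Canonical Γ') where
  private
    module A = Geometry Γ
    module B = Geometry Γ'
    module K = Canonical K
    module K' = Canonical K'

  period : ∀ {t : Trip m} (I : Inv t) (z : Fin m) → Transitive t → suc (Orbit.per (Alg.T t I) (Alg.T⁻ t I) (Alg.TT⁻ t I) (Alg.T⁻T t I) z) ≡ m
  period {t} I z tr = ≤-antisym (FinP.injective⇒≤ {f = λ i → iter T (toℕ i) z} inj) (FinP.injective⇒≤ {f = dist} dist-inj)
    where
    open Alg t I
    inj : ∀ {i j : Fin (suc (per z))} → iter T (toℕ i) z ≡ iter T (toℕ j) z → i ≡ j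
    inj {i} {j} e = FinP.toℕ-injective (iter-uniq z (FinP.toℕ<n i) (FinP.toℕ<n j) e)
    dist : Fin m → Fin (suc (per z))
    dist x = fromℕ< (proj₁ (proj₂ (~-short (tr z x))))
    dist-at : ∀ x → iter T (toℕ (dist x)) z ≡ x
    dist-at x = trans (cong (λ k → iter T k z) (FinP.toℕ-fromℕ< (proj₁ (proj₂ (~-short (tr z x)))))) (proj₂ (proj₂ (~-short (tr z x))))
    dist-inj : ∀ {x y} → dist x ≡ dist y → x ≡ y
    dist-inj {x} {y} e = trans (sym (dist-at x)) (trans (cong (λ i → iter T (toℕ i) z) e) (dist-at y))

  opaque
    at : ∀ x → ∃ λ k → k < suc (A.per z₀) × iter A.T k z₀ ≡ x
    at x = A.~-short (K.trn z₀ x)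

  σ : Fin m → Fin m
  σ x = iter B.T (proj₁ (at x)) z₀'

  σ-at : ∀ k → k < suc (A.per z₀) → σ (iter A.T k z₀) ≡ iter B.T k z₀'
  σ-at k k< = cong (λ n → iter B.T n z₀') (A.iter-uniq z₀ (proj₁ (proj₂ (at _))) k< (proj₂ (proj₂ (at _))))

  σz : σ z₀ ≡ z₀'
  σz = σ-at 0 (s≤s z≤n)

  σT : ∀ x → σ (A.T x) ≡ B.T (σ x)
  σT x with at x
  ... | k , k< , refl with m≤n⇒m<n∨m≡n k<
  ...   | inj₁ sk< = σ-at (suc k) sk<
  ...   | inj₂ refl = trans (cong σ (A.per-ret z₀)) (trans σz (sym (trans (cong (λ n → iter B.T n z₀')
                        (trans (period A.I z₀ K.trn) (sym (period B.I z₀' K'.trn)))) (B.per-ret z₀'))))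

  σTk : ∀ k x → σ (iter A.T k x) ≡ iter B.T k (σ x)
  σTk zero x = refl
  σTk (suc k) x = trans (σT _) (cong B.T (σTk k x))

  σT⁻k : ∀ k x → σ (iter A.T⁻ k x) ≡ iter B.T⁻ k (σ x)
  σT⁻k k x = trans (sym (B.f⁻fk k _)) (cong (iter B.T⁻ k) (trans (sym (σTk k _)) (cong σ (A.ff⁻k k x))))

  σb : ∀ x → σ (A.b x) ≡ B.b (σ x)
  σb x with K.trn z₀ x
  ... | k , refl = trans (cong σ (trans (A.bTk k z₀) (cong (iter A.T⁻ k) K.bz₀))) (trans (σT⁻k k z₀)
        (sym (trans (cong B.b (trans (σTk k z₀) (cong (iter B.T k) σz))) (trans (B.bTk k z₀') (cong (iter B.T⁻ k) (trans K'.bz₀ (sym σz)))))))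

  σg : ∀ x → σ (A.g x) ≡ B.g (σ x)
  σg x = trans (cong (σ ∘ A.g) (sym (A.bb x))) (trans (σT (A.b x)) (trans (cong B.T (σb x)) (cong B.g (B.bb (σ x)))))

  z-next : ∀ i → suc i < d → A.T (A.z i) ≡ A.z (suc i)
  z-next i i<d = trans (sym (A.rP (A.z i))) (K.fixed (suc i) (s≤s z≤n) i<d)

  z-next' : ∀ i → suc i < d → B.T (B.z i) ≡ B.z (suc i)
  z-next' i i<d = trans (sym (B.rP (B.z i))) (K'.fixed (suc i) (s≤s z≤n) i<d)

  σ-z : ∀ i → i < d → σ (A.z i) ≡ B.z i
  σ-z zero _ = σz
  σ-z (suc i) i<d = trans (cong σ (sym (z-next i i<d))) (trans (σT _) (trans (cong B.T (σ-z i (<-trans (n<1+n i) i<d))) (z-next' i i<d)))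

  private
    last : ∃ λ e → suc e ≡ d
    last = pred-of A.d≥3
      where
      pred-of : ∀ {d} → 3 ≤ d → ∃ λ e → suc e ≡ d
      pred-of {suc e} _ = e , refl

  e₀ : ℕ
  e₀ = proj₁ last

  e₀<d : e₀ < d
  e₀<d = ≤-reflexive (proj₂ last)

  module _ (F : ∃ λ L → A.Next (A.z e₀) L × iter A.T (suc L) (A.z e₀) ≡ A.P (A.z e₀))
           (F' : ∃ λ L → B.Next (B.z e₀) L × iter B.T (suc L) (B.z e₀) ≡ B.P (B.z e₀)) where
    private
      L L' : ℕ
      L = proj₁ F
      L' = proj₁ F'
      Pz : A.P (A.z e₀) ≡ z₀
      Pz = trans (cong (λ n → iter A.P n z₀) (proj₂ last)) A.cyc
      Pz' : B.P (B.z e₀) ≡ z₀'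
      Pz' = trans (cong (λ n → iter B.P n z₀') (proj₂ last)) B.cyc
      L≤L' : L ≤ L'
      L≤L' with L ≤? L'
      ... | yes p = p
      ... | no p = ⊥-elim (A.Next.before (proj₁ (proj₂ F)) L' (≰⇒> p) (subst A.InZ (sym hit) (A.z-InZ 0)))
        where
        σ-inj : ∀ {x} → σ x ≡ z₀' → x ≡ z₀
        σ-inj {x} q with at x in eq
        ... | zero , _ , p = sym p
        ... | suc k , s≤s k< , p = ⊥-elim (B.per-min z₀' k (subst (k <_) (suc-injective (trans (period A.I z₀ K.trn) (sym (period B.I z₀' K'.trn)))) k<) q)
        hit : iter A.T (suc L') (A.z e₀) ≡ z₀
        hit = σ-inj (trans (σTk (suc L') _) (trans (cong (iter B.T (suc L')) (σ-z e₀ e₀<d)) (trans (proj₂ (proj₂ F')) Pz')))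

      tailA : ∀ j → j ≤ L → A.r (iter A.T (suc j) (A.z e₀)) ≡ iter A.T⁻ j z₀
      tailA j j≤ = trans (cong A.r (sym (iter-shift A.T j _))) (trans (A.r-run j _ (λ i i<j → subst (¬_ ∘ A.InZ) (sym (iter-shift A.T i _))
        (A.Next.before (proj₁ (proj₂ F)) i (<-≤-trans i<j j≤)))) (cong (iter A.T⁻ j) Pz))
      tailB : ∀ j → j ≤ L' → B.r (iter B.T (suc j) (B.z e₀)) ≡ iter B.T⁻ j z₀'
      tailB j j≤ = trans (cong B.r (sym (iter-shift B.T j _))) (trans (B.r-run j _ (λ i i<j → subst (¬_ ∘ B.InZ) (sym (iter-shift B.T i _))
        (B.Next.before (proj₁ (proj₂ F')) i (<-≤-trans i<j j≤)))) (cong (iter B.T⁻ j) Pz'))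

      Kind : Fin m → Set
      Kind x = (∃ λ i → 1 ≤ i × i < d × x ≡ A.z i) ⊎ (∃ λ j → j ≤ L × x ≡ iter A.T (suc j) (A.z e₀))

      z₀-kind : Kind z₀
      z₀-kind = inj₂ (L , ≤-refl , sym (trans (proj₂ (proj₂ F)) Pz))

      kind-z : ∀ i → i < d → Kind (A.T (A.z i))
      kind-z i i<d with m≤n⇒m<n∨m≡n i<d
      ... | inj₁ si<d = inj₁ (suc i , s≤s z≤n , si<d , z-next i si<d)
      ... | inj₂ si≡d = inj₂ (0 , z≤n , cong (A.T ∘ A.z) (suc-injective (trans si≡d (sym (proj₂ last)))))

      kind : ∀ k → Kind (iter A.T k z₀)
      kind zero = z₀-kind
      kind (suc k) with kind k
      ... | inj₁ (i , _ , i<d , e) = subst (Kind ∘ A.T) (sym e) (kind-z i i<d)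
      ... | inj₂ (j , j≤ , e) with m≤n⇒m<n∨m≡n j≤
      ...   | inj₁ j<L = inj₂ (suc j , j<L , cong A.T e)
      ...   | inj₂ refl = subst (Kind ∘ A.T) (sym (trans e (trans (proj₂ (proj₂ F)) Pz))) (kind-z 0 (≤-trans (s≤s z≤n) A.d≥3))

    σr-from : ∀ x → σ (A.r x) ≡ B.r (σ x)
    σr-from x with K.trn z₀ x
    ... | k , refl with kind k
    ...   | inj₁ (i , 1≤i , i<d , e) = trans (cong (σ ∘ A.r) e) (trans (cong σ (K.fixed i 1≤i i<d)) (trans (σ-z i i<d)
            (sym (trans (cong (B.r ∘ σ) e) (trans (cong B.r (σ-z i i<d)) (K'.fixed i 1≤i i<d))))))
    ...   | inj₂ (j , j≤ , e) = trans (cong (σ ∘ A.r) e) (trans (cong σ (tailA j j≤)) (trans (σT⁻k j z₀) (trans (cong (iter B.T⁻ j) σz)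
            (sym (trans (cong (B.r ∘ σ) e) (trans (cong B.r (trans (σTk (suc j) _) (cong (iter B.T (suc j)) (σ-z e₀ e₀<d)))) (tailB j (≤-trans j≤ L≤L'))))))))

  σr : ∀ x → σ (A.r x) ≡ B.r (σ x)
  σr = σr-from (A.star _ (A.z-InZ e₀) (K.trn _ _)) (B.star _ (B.z-InZ e₀) (K'.trn _ _))

opaque
  canonical-unique : ∀ {m d} {t t' : Trip m} {z₀ z₀' : Fin m} {Γ : Good t d z₀} {Γ' : Good t' d z₀'} →
    Canonical Γ → Canonical Γ' → ∀ {n o} {τ : Tri n} → Cov o τ t → Cov o τ t'
  canonical-unique {m} {t = t} {t'} {z₀} {z₀'} {Γ} {Γ'} K K' C = record
    { π = λ y → U.σ (π y) ; A = A ; sec = λ x β → sec (U'.σ x) β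
    ; π-sec = λ x β → trans (cong U.σ (π-sec _ β)) (inv₂ x)
    ; A-sec = λ x β → A-sec _ β
    ; sec-π = λ y → trans (cong (λ x → sec x (A y)) (inv₁ (π y))) (sec-π y)
    ; πr = λ y → trans (cong U.σ (πr y)) (U.σr _)
    ; πg = λ y → trans (cong U.σ (πg y)) (U.σg _)
    ; πb = λ y → trans (cong U.σ (πb y)) (U.σb _)
    ; flip = flip }
    where
    open Cov C
    module U = Uniqueness K K'
    module U' = Uniqueness K' K
    module A₁ = Alg t (Good.I Γ)
    module B₁ = Alg t' (Good.I Γ')
    inv₁ : ∀ x → U'.σ (U.σ x) ≡ x
    inv₁ x with Canonical.trn K z₀ x
    ... | k , refl = trans (cong U'.σ (trans (U.σTk k z₀) (cong (iter B₁.T k) U.σz))) (trans (U'.σTk k z₀') (cong (iter A₁.T k) U'.σz))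
    inv₂ : ∀ x → U.σ (U'.σ x) ≡ x
    inv₂ x with Canonical.trn K' z₀' x
    ... | k , refl = trans (cong U.σ (trans (U'.σTk k z₀') (cong (iter A₁.T k) U'.σz))) (trans (U.σTk k z₀) (cong (iter B₁.T k) U.σz))

-- A double cover with labelled sheets is determined by its base, because every colour exchanges the
-- sheets.
cov-iso : ∀ {n m o} {τ τ' : Tri n} {t : Trip m} → Cov o τ t → Cov o τ' t → Iso τ τ'
cov-iso {o = o} {τ} {τ'} {t} C C' = (λ y → C'.sec (C.π y) (C.A y)) , (λ y → C.sec (C'.π y) (C'.A y)) ,
    (λ y → trans (cong₂ C.sec (C'.π-sec _ _) (C'.A-sec _ _)) (C.sec-π y)) ,
    (λ y → trans (cong₂ C'.sec (C.π-sec _ _) (C.A-sec _ _)) (C'.sec-π y)) ,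
    (λ c y → C'.lift-≡ (base c y (colours o c)) (trans (C'.flip c _) (trans (cong not (C'.A-sec _ _)) (trans (sym (C.flip c y)) (sym (C'.A-sec _ _))))))
  where
  module C = Cov C
  module C' = Cov C'
  base : ∀ c y → c ≡ cr o ⊎ c ≡ G ⊎ c ≡ cb o → C'.π (τ' c (C'.sec (C.π y) (C.A y))) ≡ C'.π (C'.sec (C.π (τ c y)) (C.A (τ c y)))
  base c y (inj₁ refl) = trans (C'.πr _) (trans (cong (Trip.r t) (C'.π-sec _ _)) (trans (sym (C.πr y)) (sym (C'.π-sec _ _))))
  base c y (inj₂ (inj₁ refl)) = trans (C'.πg _) (trans (cong (Trip.g t) (C'.π-sec _ _)) (trans (sym (C.πg y)) (sym (C'.π-sec _ _))))
  base c y (inj₂ (inj₂ refl)) = trans (C'.πb _) (trans (cong (Trip.b t) (C'.π-sec _ _)) (trans (sym (C.πb y)) (sym (C'.π-sec _ _))))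

opaque
  -- both surfaces are sheared to the canonical form, and the second path is traversed backwards
  connect : ∀ {n m d} {τ τ' : Tri n} {t t' : Trip m} {z₀ z₀' : Fin m} → Good t d z₀ → Good t' d z₀' →
            Cov true τ t → Cov true τ' t' →
            let N = (1 + d * 3) + (1 + d * 3) + (d * 4 + 1) in ConnectedWithin (N + N) τ τ'
  connect {τ = τ} {τ'} {t} {t'} Γ Γ' C C' with canonise Γ | canonise Γ'
  ... | q , S , K | q' , S' , K' with Link.there (Step.lnk S) true τ C
  ...   | τ₁ , (k , k≤ , seq) , C₁ with Link.back (Step.lnk S') true τ₁ (canonical-unique K K' C₁)
  ...     | τ₂ , (l , l≤ , seq') , C₂ = k + l , τ₂ , +-mono-≤ k≤ l≤ , seq-++ seq seq' , cov-iso C₂ C'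

-- The quotient by the hyperelliptic involution

-- orbitLen runs a local search; this is the same search with all parameters free.
searchReturn : ∀ {n} (p : Fin n → Fin n) (x : Fin n) → ℕ → Fin n → ℕ → ℕ
searchReturn p x m y zero = m
searchReturn p x m y (suc f) with y FinP.≟ x
... | yes _ = m
... | no _ = searchReturn p x (suc m) (p y) f

-- The left side, found by unification in orbitLen-search, is the local search of orbitLen.
search-agree : ∀ n (p : Fin n → Fin n) (x : Fin n) (m : ℕ) (y : Fin n) (f : ℕ) → _ ≡ searchReturn p x m y f

orbitLen-search : ∀ {n} (p : Fin n → Fin n) x → orbitLen p x ≡ searchReturn p x 1 (p x) n
orbitLen-search {suc k} p x with p x FinP.≟ x
... | yes e = refl
... | no _ with k | suc k | p | x | 2 | p (p x)
... | f | n | p' | x' | m | y = search-agree n p' x' m y f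

search-agree n p x m y zero = refl
search-agree n p x m y (suc f) with y FinP.≟ x
... | yes _ = refl
... | no _ = search-agree n p x (suc m) (p y) f

module _ {n : ℕ} (p p⁻ : Fin n → Fin n) (pp⁻ : ∀ x → p (p⁻ x) ≡ x) (p⁻p : ∀ x → p⁻ (p x) ≡ x) where
  open Orbit p p⁻ pp⁻ p⁻p

  per<n : ∀ x → suc (per x) ≤ n
  per<n x = FinP.injective⇒≤ {f = λ (i : Fin (suc (per x))) → iter p (toℕ i) x}
    (λ {i} {j} e → FinP.toℕ-injective (iter-uniq x (FinP.toℕ<n i) (FinP.toℕ<n j) e))

  private
    search-per : ∀ x f m y → y ≡ iter p (suc m) x → m ≤ per x → per x ≤ m + f →
                 searchReturn p x (suc m) y f ≡ suc (per x)
    search-per x zero m y _ m≤ ≤m = cong suc (≤-antisym m≤ (subst (per x ≤_) (+-identityʳ m) ≤m))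
    search-per x (suc f) m y e m≤ ≤m with y FinP.≟ x | m≤n⇒m<n∨m≡n m≤
    ... | yes q | inj₂ refl = refl
    ... | yes q | inj₁ m< = ⊥-elim (per-min x m m< (trans (sym e) q))
    ... | no q | inj₂ refl = ⊥-elim (q (trans e (per-ret x)))
    ... | no q | inj₁ m< = search-per x f (suc m) (p y) (cong p e) m< (subst (per x ≤_) (+-suc m f) ≤m)

  opaque
    orbitLen-per : ∀ x → orbitLen p x ≡ suc (per x)
    orbitLen-per x = trans (orbitLen-search p x) (search-per x n 0 (p x) refl z≤n (≤-trans (n≤1+n _) (per<n x)))

module Count {n : ℕ} {Q : Fin n → Set} (Q? : ∀ x → Dec (Q x)) where

  count : ℕ
  count = length (filter Q? (allFin n))

  opaque
    inj≤count : ∀ {K} (f : Fin K → Fin n) → (∀ {i j} → f i ≡ f j → i ≡ j) → (∀ i → Q (f i)) → K ≤ count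
    inj≤count f inj q = FinP.injective⇒≤ {f = λ i → index (mem i)} (λ {i} {j} e →
        inj (trans (lookup-index (mem i)) (trans (cong (lookup (filter Q? (allFin n))) e) (sym (lookup-index (mem j))))))
      where
      mem : ∀ i → f i ∈ filter Q? (allFin n)
      mem i = ∈-filter⁺ Q? (∈-allFin (f i)) (q i)

  elements : Fin count → Fin n
  elements = lookup (filter Q? (allFin n))

  opaque
    elements-Q : ∀ i → Q (elements i)
    elements-Q i = proj₂ (∈-filter⁻ Q? {xs = allFin n} (∈-lookup i))

  opaque
    elements-inj : ∀ {i j} → elements i ≡ elements j → i ≡ j
    elements-inj = lookup-inj (filter⁺ Q? (allFin⁺ n))
      where
      lookup-inj : ∀ {xs : List (Fin n)} → Unique xs → ∀ {i j} → lookup xs i ≡ lookup xs j → i ≡ j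
      lookup-inj (px ∷ u) {fzero} {fzero} e = refl
      lookup-inj (px ∷ u) {fzero} {fsuc j} e = ⊥-elim (All.lookup px (∈-lookup j) e)
      lookup-inj (px ∷ u) {fsuc i} {fzero} e = ⊥-elim (All.lookup px (∈-lookup i) (sym e))
      lookup-inj (px ∷ u) {fsuc i} {fsuc j} e = cong fsuc (lookup-inj u e)

  opaque
    count-full : ∀ {K} (f : Fin K → Fin n) → (∀ {i j} → f i ≡ f j → i ≡ j) → (∀ i → Q (f i)) → count ≤ K →
                 ∀ y → Q y → ∃ λ i → f i ≡ y
    count-full {K} f inj q c≤K y qy with FinP.any? (λ i → f i FinP.≟ y)
    ... | yes r = r
    ... | no nr = ⊥-elim (<-irrefl refl (≤-trans (inj≤count f' inj' q') c≤K))
      where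
      f' : Fin (suc K) → Fin n
      f' fzero = y
      f' (fsuc i) = f i
      inj' : ∀ {i j} → f' i ≡ f' j → i ≡ j
      inj' {fzero} {fzero} e = refl
      inj' {fzero} {fsuc j} e = ⊥-elim (nr (j , sym e))
      inj' {fsuc i} {fzero} e = ⊥-elim (nr (i , e))
      inj' {fsuc i} {fsuc j} e = cong fsuc (inj e)
      q' : ∀ i → Q (f' i)
      q' fzero = qy
      q' (fsuc i) = q i

  opaque
    count-none : (∀ x → ¬ Q x) → count ≡ 0
    count-none none with count | elements | elements-Q
    ... | zero | _ | _ = refl
    ... | suc c | el | eq = ⊥-elim (none (el fzero) (eq fzero))

  opaque
    count-some : ∀ y → Q y → 1 ≤ count
    count-some y q = inj≤count (λ (_ : Fin 1) → y) (λ { {fzero} {fzero} _ → refl }) (λ _ → q)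

  opaque
    inhabited : 1 ≤ count → ∃ Q
    inhabited 1≤c = elements (fromℕ< 1≤c) , elements-Q (fromℕ< 1≤c)

  opaque
    count≤ : ∀ {K} (f : Fin K → Fin n) → (∀ y → Q y → ∃ λ i → f i ≡ y) → count ≤ K
    count≤ f cov = FinP.injective⇒≤ {f = λ i → proj₁ (at i)} (λ {i} {j} e →
        elements-inj (trans (sym (proj₂ (at i))) (trans (cong f e) (proj₂ (at j)))))
      where
      at : ∀ i → ∃ λ j → f j ≡ elements i
      at i = cov _ (elements-Q i)

opaque
  glue : ∀ {Y : Set} {a b} (f : Fin a → Y) (h : Fin b → Y) → (∀ {i j} → f i ≡ f j → i ≡ j) → (∀ {i j} → h i ≡ h j → i ≡ j) →
         (∀ i j → f i ≢ h j) → (F : Y → Set) → (∀ i → F (f i)) → (∀ i → F (h i)) →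
         Σ (Fin (a + b) → Y) λ ψ → (∀ {i j} → ψ i ≡ ψ j → i ≡ j) × (∀ i → F (ψ i))
  glue {Y} {a} {b} f h fi hi dis F Ff Fh = ψ , (λ {i} {j} → inj i j) , Fψ
    where
    ψ : Fin (a + b) → Y
    ψ i = [ f , h ]′ (Fin.splitAt a i)
    inj : ∀ i j → ψ i ≡ ψ j → i ≡ j
    inj i j e = trans (sym (FinP.join-splitAt a b i)) (trans (cong (Fin.join a b) (same (Fin.splitAt a i) (Fin.splitAt a j) e)) (FinP.join-splitAt a b j))
      where
      same : ∀ s s' → [ f , h ]′ s ≡ [ f , h ]′ s' → s ≡ s'
      same (inj₁ i) (inj₁ j) e = cong inj₁ (fi e)
      same (inj₂ i) (inj₂ j) e = cong inj₂ (hi e)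
      same (inj₁ i) (inj₂ j) e = ⊥-elim (dis i j e)
      same (inj₂ i) (inj₁ j) e = ⊥-elim (dis j i (sym e))
    Fψ : ∀ i → F (ψ i)
    Fψ i = at (Fin.splitAt a i)
      where
      at : ∀ s → F ([ f , h ]′ s)
      at (inj₁ i) = Ff i
      at (inj₂ i) = Fh i

sumTo : (ℕ → ℤ) → ℕ → ℤ
sumTo f n = foldr ℤ._+_ (+ 0) (applyUpTo f n)

sum-zero : ∀ f n → (∀ j → j < n → f j ≡ + 0) → sumTo f n ≡ + 0
sum-zero f zero _ = refl
sum-zero f (suc n) z = trans (cong₂ ℤ._+_ (z 0 (s≤s z≤n)) (sum-zero (f ∘ suc) n (λ j j<n → z (suc j) (s≤s j<n)))) refl

sum-one : ∀ f n k → k < n → (∀ j → j < n → j ≢ k → f j ≡ + 0) → sumTo f n ≡ f k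
sum-one f (suc n) zero _ z = trans (cong (λ v → f 0 ℤ.+ v) (sum-zero (f ∘ suc) n (λ j j<n → z (suc j) (s≤s j<n) (λ ())))) (ℤP.+-identityʳ _)
sum-one f (suc n) (suc k) (s≤s k<n) z = trans (cong₂ ℤ._+_ (z 0 (s≤s z≤n) (λ ()))
  (sum-one (f ∘ suc) n k k<n (λ j j<n ne → z (suc j) (s≤s j<n) (λ e → ne (suc-injective e))))) (ℤP.+-identityˡ _)

sum-nonneg : ∀ f n → (∀ j → + 0 ℤ.≤ f j) → + 0 ℤ.≤ sumTo f n
sum-nonneg f zero _ = ℤP.≤-refl
sum-nonneg f (suc n) nn = ℤP.+-mono-≤ (nn 0) (sum-nonneg (f ∘ suc) n (λ j → nn (suc j)))

module _ {m : ℕ} (ρ : Tri m) where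

  weight : ℕ → ℤ
  weight j = (+ cycCount (prod ρ) (suc j)) ℤ.* ((+ suc j) ℤ.- + 2)

  euler-sum : euler ρ ≡ sumTo weight m ℤ.- + fixCount ρ
  euler-sum = cong (λ l → foldr ℤ._+_ (+ 0) l ℤ.- + fixCount ρ) (map-upTo weight m)

  -- Only cycles of length 1 and fixed points contribute negatively, whereas the total for genus 0
  -- is -4.
  genus0⇒poles : HasGenus ρ 0 → ¬ (cycCount (prod ρ) 1 ≡ 0 × fixCount ρ ≡ 0)
  genus0⇒poles hg (c0 , f0) = absurd (subst (+ 0 ℤ.≤_) (trans (sym (ℤP.+-identityʳ _)) (trans (cong (λ k → sumTo weight m ℤ.- + k) (sym f0)) (trans (sym euler-sum) hg)))
      (sum-nonneg weight m nn))
    where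
    absurd : ¬ (+ 0 ℤ.≤ -[1+ 3 ])
    absurd ()
    nn : ∀ j → + 0 ℤ.≤ weight j
    nn zero rewrite c0 = ℤP.≤-refl
    nn (suc j) = subst (+ 0 ℤ.≤_) (ℤP.pos-* (cycCount (prod ρ) (suc (suc j))) j) (ℤ.+≤+ z≤n)

  -- Cycles of length 2 have weight 0, so the Euler formula reads `-a + (d - 2) - k = -4`, with `a`
  -- poles at vertices and `k` at midpoints of edges.
  genus0⇒count : ∀ {d} → 3 ≤ d → d ≤ m → HasGenus ρ 0 → cycCount (prod ρ) d ≡ 1 →
                 (∀ j → j ≢ 1 → j ≢ 2 → j ≢ d → cycCount (prod ρ) j ≡ 0) →
                 2 + d ≡ cycCount (prod ρ) 1 + fixCount ρ
  genus0⇒count {suc (suc (suc e))} (s≤s (s≤s (s≤s _))) d≤m hg cd cj = ℤP.+-injective final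
    where
    a k : ℕ
    a = cycCount (prod ρ) 1
    k = fixCount ρ
    split : ∀ m → suc (suc (suc e)) ≤ m → sumTo weight m ≡ weight 0 ℤ.+ + (suc e)
    split (suc m') (s≤s d≤) = cong (λ v → weight 0 ℤ.+ v) (trans (sum-one (weight ∘ suc) m' (suc e) d≤ others)
        (trans (cong (λ c → + c ℤ.* + suc e) cd) (ℤP.*-identityˡ _)))
      where
      others : ∀ j → j < m' → j ≢ suc e → weight (suc j) ≡ + 0
      others zero _ _ = ℤP.*-zeroʳ (+ cycCount (prod ρ) 2)
      others (suc j) _ ne rewrite cj (suc (suc (suc j))) (λ ()) (λ ()) (λ q → ne (suc-injective (suc-injective q))) = refl
    w0 : weight 0 ≡ ℤ.- + a
    w0 = trans (ℤP.*-comm (+ a) (-[1+ 0 ])) (ℤP.-1*i≡-i (+ a))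
    eq : (ℤ.- + a ℤ.+ + suc e) ℤ.- + k ≡ -[1+ 3 ]
    eq = trans (cong (ℤ._- + k) (trans (cong (ℤ._+ + suc e) (sym w0)) (sym (split m d≤m)))) (trans (sym euler-sum) hg)
    ring : ∀ x y v → ((ℤ.- x ℤ.+ y) ℤ.- v) ℤ.+ (x ℤ.+ v) ≡ y
    ring = ℤ-solve-∀
    ring' : ∀ x → + 4 ℤ.+ (-[1+ 3 ] ℤ.+ x) ≡ x
    ring' x = trans (sym (ℤP.+-assoc (+ 4) -[1+ 3 ] x)) (ℤP.+-identityˡ x)
    final : + (2 + suc (suc (suc e))) ≡ + (a + k)
    final = trans (cong (λ v → + 4 ℤ.+ v) (trans (sym (ring (+ a) (+ suc e) (+ k))) (cong (ℤ._+ (+ a ℤ.+ + k)) eq)))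
              (ring' (+ a ℤ.+ + k))

module Quotient {n : ℕ} (τ : Tri n) (ττ : ∀ c x → τ c (τ c x) ≡ x) (word : ∀ x y → ∃ λ w → act τ w x ≡ y)
                (A : Fin n → Bool) (flip : ∀ c x → A (τ c x) ≡ not (A x))
                (α : Fin n → Fin n) (αα : ∀ x → α (α x) ≡ x) (α-τ : ∀ c x → α (τ c x) ≡ τ c (α x))
                {m : ℕ} (π : Fin n → Fin m) (ρ : Tri m) (quot : IsQuotient τ α π ρ) (hg : HasGenus ρ 0) where

  private
    surj : ∀ z → ∃ λ x → π x ≡ z
    surj = proj₁ quot
    ker : ∀ x y → π x ≡ π y → y ≡ x ⊎ y ≡ α x
    ker x y = Equivalence.to (proj₁ (proj₂ quot) x y)
    πα : ∀ x → π (α x) ≡ π x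
    πα x = sym (Equivalence.from (proj₁ (proj₂ quot) x (α x)) (inj₂ refl))
    eqv : ∀ c x → ρ c (π x) ≡ π (τ c x)
    eqv = proj₂ (proj₂ quot)

    along : (Q : Fin n → Set) → (∀ c x → Q x → Q (τ c x)) → ∀ x y → Q x → Q y
    along Q cl x y q with word x y
    ... | w , refl = go w
      where
      go : ∀ w → Q (act τ w x)
      go [] = q
      go (c ∷ w) = cl c _ (go w)

    ρρ : ∀ c z → ρ c (ρ c z) ≡ z
    ρρ c z with surj z
    ... | x , refl = trans (cong (ρ c) (eqv c x)) (trans (eqv c _) (cong π (ττ c x)))

  p̂ p̂⁻ : Fin n → Fin n
  p̂ = prod τ
  p̂⁻ x = τ B (τ G (τ R x))

  private
    pp̂⁻ : ∀ x → p̂ (p̂⁻ x) ≡ x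
    pp̂⁻ x = trans (cong (τ R ∘ τ G) (ττ B _)) (trans (cong (τ R) (ττ G _)) (ττ R x))
    p̂⁻p : ∀ x → p̂⁻ (p̂ x) ≡ x
    p̂⁻p x = trans (cong (τ B ∘ τ G) (ττ R _)) (trans (cong (τ B) (ττ G _)) (ττ B x))
  module O = Orbit p̂ p̂⁻ pp̂⁻ p̂⁻p

  t : Trip m
  t = trip (ρ R) (ρ G) (ρ B)
  I : Inv t
  I = inv (ρρ R) (ρρ G) (ρρ B)
  open Alg t I using (P; P⁻; PP⁻; P⁻P; P-inj; InZ; InZ?; ¬InZ)
  private module Q = Orbit P P⁻ PP⁻ P⁻P

  len : ∀ x → orbitLen P x ≡ suc (Q.per x)
  len = orbitLen-per P P⁻ PP⁻ P⁻P

  lenτ : ∀ y → orbitLen p̂ y ≡ suc (O.per y)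
  lenτ = orbitLen-per p̂ p̂⁻ pp̂⁻ p̂⁻p

  πp : ∀ y → π (p̂ y) ≡ P (π y)
  πp y = sym (trans (cong (ρ R ∘ ρ G) (eqv B y)) (trans (cong (ρ R) (eqv G _)) (eqv R _)))

  πpk : ∀ k y → π (iter p̂ k y) ≡ iter P k (π y)
  πpk zero y = refl
  πpk (suc k) y = trans (πp _) (cong P (πpk k y))

  αp : ∀ y → α (p̂ y) ≡ p̂ (α y)
  αp y = trans (α-τ R _) (cong (τ R) (trans (α-τ G _) (cong (τ G) (α-τ B y))))

  αpk : ∀ k y → α (iter p̂ k y) ≡ iter p̂ k (α y)
  αpk = iter-reflect αp

  private
    Ap : ∀ y → A (p̂ y) ≡ not (A y)
    Ap y = trans (flip R _) (cong not (trans (flip G _) (trans (cong not (flip B y)) (not-involutive _))))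

    len1 : ∀ x → orbitLen P x ≡ 1 → P x ≡ x
    len1 x e = trans (cong (λ k → iter P k x) (sym (trans (sym (len x)) e))) (Q.per-ret x)

    -- otherwise the quotient would itself be Abelian, hence without poles
    not-same : ¬ (∀ x → A (α x) ≡ A x)
    not-same same = genus0⇒poles ρ hg
        (trans (n/1≡n _) (Count.count-none (λ x → orbitLen P x ≟ 1) (λ x e → no-P x (len1 x e))) ,
         cong₂ _+_ (cong₂ _+_ (no-fix R) (no-fix G)) (no-fix B))
      where
      flipped : ∀ (h : Fin n → Fin n) x → A (h x) ≡ not (A x) → π (h x) ≢ π x
      flipped h x fl e with ker x (h x) (sym e)
      ... | inj₁ q = not-¬ {A x} refl (sym (trans (sym fl) (cong A q)))
      ... | inj₂ q = not-¬ {A x} refl (sym (trans (sym fl) (trans (cong A q) (same x))))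
      no-P : ∀ z → P z ≢ z
      no-P z e with surj z
      ... | x , refl = flipped p̂ x (Ap x) (trans (πp x) e)
      no-fix : ∀ c → length (filter (λ x → ρ c x FinP.≟ x) (allFin m)) ≡ 0
      no-fix c = Count.count-none (λ x → ρ c x FinP.≟ x) none
        where
        none : ∀ z → ρ c z ≢ z
        none z e with surj z
        ... | x , refl = flipped (τ c) x (flip c x) (trans (sym (eqv c x)) e)

  -- `α` commutes with all colours, so by connectedness it preserves the sheet of every triangle or
  -- of none; `not-same` excludes the former.
  α-flip : ∀ x → A (α x) ≡ not (A x)
  α-flip x = ¬-not (λ e → not-same (λ y → along (λ y → A (α y) ≡ A y)
    (λ c y q → trans (cong A (α-τ c y)) (trans (flip c _) (trans (cong not q) (sym (flip c y))))) x y e))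

  cov : Cov true τ t
  cov = record
    { π = π ; A = A ; sec = sec ; π-sec = π-sec ; A-sec = A-sec ; sec-π = sec-π
    ; πr = λ y → sym (eqv R y) ; πg = λ y → sym (eqv G y) ; πb = λ y → sym (eqv B y) ; flip = flip }
    where
    sec : Fin m → Bool → Fin n
    sec z β = pick (A (proj₁ (surj z)) Data.Bool.≟ β) (proj₁ (surj z)) (α (proj₁ (surj z)))
    π-sec : ∀ z β → π (sec z β) ≡ z
    π-sec z β with A (proj₁ (surj z)) Data.Bool.≟ β
    ... | yes _ = proj₂ (surj z)
    ... | no _ = trans (πα _) (proj₂ (surj z))
    A-sec : ∀ z β → A (sec z β) ≡ β
    A-sec z β with A (proj₁ (surj z)) Data.Bool.≟ β
    ... | yes q = q
    ... | no q = trans (α-flip _) (trans (cong not (¬-not q)) (not-involutive β))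
    sec-π : ∀ y → sec (π y) (A y) ≡ y
    sec-π y with ker _ y (proj₂ (surj (π y)))
    ... | inj₁ q = trans (pick-yes (_ Data.Bool.≟ _) (cong A (sym q))) (sym q)
    ... | inj₂ q = trans (pick-no (_ Data.Bool.≟ _) (λ e → not-¬ {A x} refl (sym (trans (sym (α-flip x)) (trans (cong A (sym q)) (sym e)))))) (sym q)
      where
      x : Fin n
      x = proj₁ (surj (π y))

  module _ (d : ℕ) (z₀ : Fin m) (d≥3 : 3 ≤ d) (cyc : iter P d z₀ ≡ z₀) (prim : ∀ i → 0 < i → i < d → iter P i z₀ ≢ z₀)
           (onZ : ∀ x → InZ x → ∃ λ i → i < d × iter P i z₀ ≡ x) where
    private
      z : ℕ → Fin m
      z i = iter P i z₀

      pred-d : ∀ {d} → 3 ≤ d → ∃ λ e → suc e ≡ d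
      pred-d {suc e} _ = e , refl
      e₀ : ℕ
      e₀ = proj₁ (pred-d d≥3)
      e₀-d : suc e₀ ≡ d
      e₀-d = proj₂ (pred-d d≥3)

      per-z : ∀ i → suc (Q.per (z i)) ≡ d
      per-z i = trans (cong suc (Q.per-unique (z i) e₀
          (trans (iter-swap P (suc e₀) i z₀) (cong (iter P i) (trans (cong (λ k → iter P k z₀) e₀-d) cyc)))
          (λ j j<e q → prim (suc j) (s≤s z≤n) (subst (suc j <_) e₀-d (s≤s j<e))
            (iter-inj P-inj i (trans (iter-swap P i (suc j) z₀) q))))) e₀-d

      per-small : ∀ x → ¬ InZ x → Q.per x ≤ 1
      per-small x nz with Q.per x ≤? 1
      ... | yes q = q
      ... | no q = ⊥-elim (Q.per-min x 1 (≰⇒> q) (¬InZ nz))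

      z-inj : ∀ {i j : Fin d} → z (toℕ i) ≡ z (toℕ j) → i ≡ j
      z-inj {i} {j} e = FinP.toℕ-injective (Q.iter-uniq z₀ (subst (toℕ i <_) (sym (per-z 0)) (FinP.toℕ<n i)) (subst (toℕ j <_) (sym (per-z 0)) (FinP.toℕ<n j)) e)

      module Cd = Count (λ x → orbitLen P x ≟ d)

      points-d : Cd.count ≡ d
      points-d = ≤-antisym (Cd.count≤ (λ (i : Fin d) → z (toℕ i)) covers)
                   (Cd.inj≤count (λ (i : Fin d) → z (toℕ i)) z-inj (λ i → trans (len _) (per-z (toℕ i))))
        where
        covers : ∀ y → orbitLen P y ≡ d → ∃ λ (i : Fin d) → z (toℕ i) ≡ y
        covers y e with InZ? y
        ... | no nz = ⊥-elim (<-irrefl refl (≤-trans d≥3 (≤-trans (≤-reflexive (trans (sym e) (len y))) (s≤s (per-small y nz)))))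
        ... | yes zy with onZ y zy
        ...   | i , i<d , q = fromℕ< i<d , trans (cong z (FinP.toℕ-fromℕ< i<d)) q

      cyc-d : cycCount P d ≡ 1
      cyc-d = go d≥3 points-d
        where
        go : ∀ {d} → 3 ≤ d → pointsOnCycles P d ≡ d → cycCount P d ≡ 1
        go {suc e} _ q rewrite q = n/n≡1 (suc e)

      cyc-other : ∀ j → j ≢ 1 → j ≢ 2 → j ≢ d → cycCount P j ≡ 0
      cyc-other zero _ _ _ = refl
      cyc-other (suc j) ne1 ne2 ned = trans (cong (_/ suc j) (Count.count-none (λ x → orbitLen P x ≟ suc j) none)) (0/n≡0 (suc j))
        where
        small : ∀ p → p ≤ 1 → suc p ≢ 1 → suc p ≢ 2 → ⊥
        small zero _ a _ = a refl
        small (suc zero) _ _ b = b refl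
        small (suc (suc _)) (s≤s ()) _ _
        none : ∀ x → orbitLen P x ≢ suc j
        none x e with InZ? x
        ... | no nz = small (Q.per x) (per-small x nz) (λ q → ne1 (trans (sym e) (trans (len x) q))) (λ q → ne2 (trans (sym e) (trans (len x) q)))
        ... | yes zx with onZ x zx
        ...   | i , _ , refl = ned (trans (sym e) (trans (len _) (per-z i)))

      count≡ : 2 + d ≡ cycCount P 1 + fixCount ρ
      count≡ = genus0⇒count ρ d≥3 (FinP.injective⇒≤ {f = λ (i : Fin d) → z (toℕ i)} z-inj) hg cyc-d cyc-other

      Fx : Tag × Fin m → Set
      Fx φ = Fix t (proj₁ φ) (proj₂ φ)

      tagged : ∀ {Q : Fin m → Set} (Q? : ∀ x → Dec (Q x)) (κ : Tag) → (∀ {x} → Q x → Fix t κ x) →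
               Σ (Fin (Count.count Q?) → Tag × Fin m) λ ψ → (∀ {i j} → ψ i ≡ ψ j → i ≡ j) × (∀ i → Fx (ψ i))
      tagged Q? κ fx = (λ i → κ , Count.elements Q? i) , (λ e → Count.elements-inj Q? (cong proj₂ e)) , (λ i → fx (Count.elements-Q Q? i))

      enum : Enum (2 + d) (Fix t)
      enum = subst (λ k → Enum k (Fix t)) (sym (trans count≡ (cong (_+ fixCount ρ) (n/1≡n (pointsOnCycles P 1)))))
          (glue (proj₁ eP) (proj₁ eRGB) (proj₁ (proj₂ eP)) (proj₁ (proj₂ eRGB)) dis Fx (proj₂ (proj₂ eP)) (proj₂ (proj₂ eRGB)))
        where
        eP = tagged (λ x → orbitLen P x ≟ 1) tP (λ {x} e → len1 x e)
        eR = tagged (λ x → ρ R x FinP.≟ x) tR (λ e → e)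
        eG = tagged (λ x → ρ G x FinP.≟ x) tG (λ e → e)
        eB = tagged (λ x → ρ B x FinP.≟ x) tB (λ e → e)
        FxRG FxRGB : Tag × Fin m → Set
        FxRG φ = Fx φ × (proj₁ φ ≢ tB) × (proj₁ φ ≢ tP)
        FxRGB φ = Fx φ × (proj₁ φ ≢ tP)
        eRG = glue (proj₁ eR) (proj₁ eG) (proj₁ (proj₂ eR)) (proj₁ (proj₂ eG)) (λ i j e → clash (cong proj₁ e)) FxRG
                (λ i → proj₂ (proj₂ eR) i , (λ ()) , (λ ())) (λ i → proj₂ (proj₂ eG) i , (λ ()) , (λ ()))
          where
          clash : tR ≢ tG
          clash ()
        eRGB' = glue (proj₁ eRG) (proj₁ eB) (proj₁ (proj₂ eRG)) (proj₁ (proj₂ eB)) (λ i j e → proj₁ (proj₂ (proj₂ (proj₂ eRG) i)) (cong proj₁ e)) FxRGB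
                  (λ i → proj₁ (proj₂ (proj₂ eRG) i) , proj₂ (proj₂ (proj₂ (proj₂ eRG) i))) (λ i → proj₂ (proj₂ eB) i , (λ ()))
        eRGB : Σ (Fin (fixCount ρ) → Tag × Fin m) λ ψ → (∀ {i j} → ψ i ≡ ψ j → i ≡ j) × (∀ i → Fx (ψ i))
        eRGB = proj₁ eRGB' , proj₁ (proj₂ eRGB') , (λ i → proj₁ (proj₂ (proj₂ eRGB') i))
        dis : ∀ i j → proj₁ eP i ≢ proj₁ eRGB j
        dis i j q = proj₂ (proj₂ (proj₂ eRGB') j) (cong proj₁ (sym q))

    opaque
      good : Good t d z₀
      good = record { I = I ; conn = conn ; d≥3 = d≥3 ; cyc = cyc ; prim = prim ; onZ = onZ ; enum = enum }
        where
        conn : (Q : Fin m → Set) → (∀ x → Q x → Q (ρ R x)) → (∀ x → Q x → Q (ρ G x)) →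
               (∀ x → Q x → Q (ρ B x)) → ∀ x y → Q x → Q y
        conn Q qr qg qb x y q with surj x | surj y
        ... | x' , refl | y' , refl = along (Q ∘ π) cl x' y' q
          where
          cl : ∀ c v → Q (π v) → Q (π (τ c v))
          cl R v q = subst Q (eqv R v) (qr _ q)
          cl G v q = subst Q (eqv G v) (qg _ q)
          cl B v q = subst Q (eqv B v) (qb _ q)

  Reducible : ℕ → Set₁
  Reducible d = ∃ λ z₀ → Good t d z₀

  private
    α-moves : ∀ y → α y ≢ y
    α-moves y e = not-¬ {A y} refl (sym (trans (sym (α-flip y)) (cong A e)))

    per-orbit : ∀ y i → O.per (iter p̂ i y) ≡ O.per y
    per-orbit y i = O.per-unique _ (O.per y) (trans (iter-swap p̂ (suc (O.per y)) i y) (cong (iter p̂ i) (O.per-ret y)))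
      (λ j j< q → O.per-min y j j< (iter-inj O.f-inj i (trans (iter-swap p̂ i (suc j) y) q)))

    per-α : ∀ y → O.per (α y) ≡ O.per y
    per-α y = O.per-unique _ (O.per y) (trans (sym (αpk (suc (O.per y)) y)) (cong α (O.per-ret y)))
      (λ j j< q → O.per-min y j j< (trans (sym (αα _)) (trans (cong α (trans (αpk (suc j) y) q)) (αα y))))

    two-free : ∀ y → orbitLen p̂ y ≡ 2 → ¬ InZ (π y)
    two-free y e zz = zz (trans (sym (πpk 2 y)) (cong π (trans (cong (λ k → iter p̂ k y) (sym (trans (sym (lenτ y)) e))) (O.per-ret y))))

  -- one cycle of length 2d, on which α is the d-th power of the cycle
  reducible-one : ∀ d → 3 ≤ d → (∀ y → orbitLen p̂ y ≡ 2 ⊎ orbitLen p̂ y ≡ d + d) → pointsOnCycles p̂ (d + d) ≡ d + d → Reducible d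
  reducible-one d d≥3 kinds cnt = π y₀ , good d (π y₀) d≥3 cyc prim onZ
    where
    module C = Count (λ y → orbitLen p̂ y ≟ d + d)
    some : ∃ λ y → orbitLen p̂ y ≡ d + d
    some = C.inhabited (subst (1 ≤_) (sym cnt) (≤-trans (≤-trans (s≤s z≤n) d≥3) (m≤m+n d d)))
    y₀ : Fin n
    y₀ = proj₁ some
    w : suc (O.per y₀) ≡ d + d
    w = trans (sym (lenτ y₀)) (proj₂ some)
    full : ∀ y → orbitLen p̂ y ≡ d + d → ∃ λ (i : Fin (d + d)) → iter p̂ (toℕ i) y₀ ≡ y
    full = C.count-full (λ (i : Fin (d + d)) → iter p̂ (toℕ i) y₀)
      (λ {i} {j} e → FinP.toℕ-injective (O.iter-uniq y₀ (subst (toℕ i <_) (sym w) (FinP.toℕ<n i)) (subst (toℕ j <_) (sym w) (FinP.toℕ<n j)) e))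
      (λ i → trans (lenτ _) (trans (cong suc (per-orbit y₀ (toℕ i))) w)) (≤-reflexive cnt)
    -- `α y₀` is on the same cycle, say at position `k`. As `α` commutes with the cycle and is an
    -- involution without fixed points, `k + k` is a multiple of `d + d` while `k` is not 0.
    αy₀ : α y₀ ≡ iter p̂ d y₀
    αy₀ = go (full (α y₀) (trans (lenτ _) (trans (cong suc (per-α y₀)) w)))
      where
      go : (∃ λ (i : Fin (d + d)) → iter p̂ (toℕ i) y₀ ≡ α y₀) → α y₀ ≡ iter p̂ d y₀
      go (i , e) = trans (sym e) (cong (λ k → iter p̂ k y₀) (which (O.iter-wrap y₀ k< (s≤s z≤n) twice)))
        where
        k : ℕ
        k = toℕ i
        k<d : k < d + d
        k<d = FinP.toℕ<n i
        k< : k + k < suc (O.per y₀) + suc (O.per y₀)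
        k< = subst (λ v → k + k < v + v) (sym w) (+-mono-≤ k<d (<⇒≤ k<d))
        twice : iter p̂ (k + k) y₀ ≡ iter p̂ 0 y₀
        twice = trans (iter-+ p̂ k k y₀) (trans (cong (iter p̂ k) e) (trans (sym (αpk k y₀)) (trans (cong α e) (αα y₀))))
        which : k + k ≡ 0 ⊎ k + k ≡ 0 + suc (O.per y₀) → k ≡ d
        which (inj₂ q) = double-injective (trans q w)
        which (inj₁ q) = ⊥-elim (α-moves y₀ (trans (sym e) (cong (λ j → iter p̂ j y₀) (double-injective {k} {0} q))))
    cyc : iter P d (π y₀) ≡ π y₀
    cyc = trans (sym (πpk d y₀)) (trans (cong π (sym αy₀)) (πα y₀))
    prim : ∀ i → 0 < i → i < d → iter P i (π y₀) ≢ π y₀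
    prim i 0<i i<d e with ker y₀ (iter p̂ i y₀) (sym (trans (πpk i y₀) e))
    ... | inj₁ q = <-irrefl (sym (O.iter-uniq y₀ {i} {0} (subst (i <_) (sym w) (<-≤-trans i<d (m≤m+n d d))) (s≤s z≤n) q)) 0<i
    ... | inj₂ q = <-irrefl (O.iter-uniq y₀ {i} {d} (subst (i <_) (sym w) (<-≤-trans i<d (m≤m+n d d))) (subst (d <_) (sym w) (+-monoˡ-≤ d (≤-trans (s≤s z≤n) d≥3))) (trans q αy₀)) i<d
    onZ : ∀ x → InZ x → ∃ λ i → i < d × iter P i (π y₀) ≡ x
    onZ x zx = go (surj x)
      where
      at : ∀ k → k < d + d → ∃ λ i → i < d × iter P i (π y₀) ≡ π (iter p̂ k y₀)
      at k k< with k <? d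
      ... | yes k<d = k , k<d , sym (πpk k y₀)
      ... | no k≮d with ≤⇒offset (≮⇒≥ k≮d)
      ...   | j , q = j , +-cancelˡ-< d j d (subst (_< d + d) (sym q) k<) ,
                sym (trans (πpk k y₀) (trans (cong (λ k → iter P k (π y₀)) (trans (sym q) (+-comm d j)))
                  (trans (iter-+ P j d (π y₀)) (cong (iter P j) cyc))))
      long : ∀ y → (∃ λ (i : Fin (d + d)) → iter p̂ (toℕ i) y₀ ≡ y) → ∃ λ i → i < d × iter P i (π y₀) ≡ π y
      long y (i , refl) = at (toℕ i) (FinP.toℕ<n i)
      by : ∀ y → InZ (π y) → orbitLen p̂ y ≡ 2 ⊎ orbitLen p̂ y ≡ d + d → ∃ λ i → i < d × iter P i (π y₀) ≡ π y
      by y zy (inj₁ e) = ⊥-elim (two-free y e zy)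
      by y zy (inj₂ e) = long y (full y e)
      go : (∃ λ y → π y ≡ x) → ∃ λ i → i < d × iter P i (π y₀) ≡ x
      go (y , refl) = by y zx (kinds y)

  -- two cycles of length d exchanged by α
  reducible-two : ∀ d → 3 ≤ d → (∀ y → orbitLen p̂ y ≡ 2 ⊎ orbitLen p̂ y ≡ d) → pointsOnCycles p̂ d ≡ d + d →
                  (∀ y → orbitLen p̂ y ≡ d → ∀ k → iter p̂ k y ≢ α y) → Reducible d
  reducible-two d d≥3 kinds cnt exch = π y₀ , good d (π y₀) d≥3 cyc prim onZ
    where
    module C = Count (λ y → orbitLen p̂ y ≟ d)
    some : ∃ λ y → orbitLen p̂ y ≡ d
    some = C.inhabited (subst (1 ≤_) (sym cnt) (≤-trans (≤-trans (s≤s z≤n) d≥3) (m≤m+n d d)))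
    y₀ : Fin n
    y₀ = proj₁ some
    w : suc (O.per y₀) ≡ d
    w = trans (sym (lenτ y₀)) (proj₂ some)
    wα : suc (O.per (α y₀)) ≡ d
    wα = trans (cong suc (per-α y₀)) w
    From : Fin n → Set
    From y = orbitLen p̂ y ≡ d × ∃ λ i → i < d × iter P i (π y₀) ≡ π y
    both : Σ (Fin (d + d) → Fin n) λ ψ → (∀ {i j} → ψ i ≡ ψ j → i ≡ j) × (∀ i → From (ψ i))
    both = glue (λ (i : Fin d) → iter p̂ (toℕ i) y₀) (λ (i : Fin d) → iter p̂ (toℕ i) (α y₀))
      (λ {i} {j} e → FinP.toℕ-injective (O.iter-uniq y₀ (subst (toℕ i <_) (sym w) (FinP.toℕ<n i)) (subst (toℕ j <_) (sym w) (FinP.toℕ<n j)) e))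
      (λ {i} {j} e → FinP.toℕ-injective (O.iter-uniq (α y₀) (subst (toℕ i <_) (sym wα) (FinP.toℕ<n i)) (subst (toℕ j <_) (sym wα) (FinP.toℕ<n j)) e))
      (λ i j e → apart (O.~-trans (toℕ i , e) (O.~-sym (O.~-iter (toℕ j)))))
      From
      (λ i → trans (lenτ _) (trans (cong suc (per-orbit y₀ (toℕ i))) w) , toℕ i , FinP.toℕ<n i , sym (πpk (toℕ i) y₀))
      (λ i → trans (lenτ _) (trans (cong suc (per-orbit (α y₀) (toℕ i))) wα) , toℕ i , FinP.toℕ<n i , sym (trans (πpk (toℕ i) (α y₀)) (cong (iter P (toℕ i)) (πα y₀))))
      where
      apart : ¬ y₀ O.~ α y₀
      apart (k , e) = exch y₀ (proj₂ some) k e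
    full : ∀ y → orbitLen p̂ y ≡ d → From y
    full y e = go (C.count-full (proj₁ both) (proj₁ (proj₂ both)) (λ i → proj₁ (proj₂ (proj₂ both) i)) (≤-reflexive cnt) y e)
      where
      go : (∃ λ i → proj₁ both i ≡ y) → From y
      go (i , q) = subst From q (proj₂ (proj₂ both) i)
    cyc : iter P d (π y₀) ≡ π y₀
    cyc = trans (sym (πpk d y₀)) (cong π (trans (cong (λ k → iter p̂ k y₀) (sym w)) (O.per-ret y₀)))
    prim : ∀ i → 0 < i → i < d → iter P i (π y₀) ≢ π y₀
    prim i 0<i i<d e with ker y₀ (iter p̂ i y₀) (sym (trans (πpk i y₀) e))
    ... | inj₁ q = <-irrefl (sym (O.iter-uniq y₀ {i} {0} (subst (i <_) (sym w) i<d) (s≤s z≤n) q)) 0<i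
    ... | inj₂ q = exch y₀ (proj₂ some) i q
    onZ : ∀ x → InZ x → ∃ λ i → i < d × iter P i (π y₀) ≡ x
    onZ x zx with surj x
    ... | y , refl with kinds y
    ...   | inj₁ e = ⊥-elim (two-free y e zx)
    ...   | inj₂ e = proj₂ (full y e)

-- The two families of surfaces and the constant

-- Both quotients have half as many triangles as the surfaces, so they live on the same `Fin m` and
-- their canonical forms can be compared.
cov-size : ∀ {n m o} {τ : Tri n} {t : Trip m} → Cov o τ t → n ≡ m * 2
cov-size {n} {m} C = ≤-antisym
    (FinP.injective⇒≤ {f = λ y → Fin.combine (π y) (bit (A y))} (λ {y} {y'} e →
      lift-≡ (FinP.combine-injectiveˡ (π y) (bit (A y)) (π y') (bit (A y')) e) (bit-inj (FinP.combine-injectiveʳ (π y) (bit (A y)) (π y') (bit (A y')) e))))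
    (FinP.injective⇒≤ {f = λ i → sec (proj₁ (Fin.remQuot {m} 2 i)) (unbit (proj₂ (Fin.remQuot {m} 2 i)))} (λ {i} {j} e →
      trans (sym (back i)) (trans (cong (λ y → Fin.combine (π y) (bit (A y))) e) (back j))))
  where
  open Cov C
  bit : Bool → Fin 2
  bit true = fzero
  bit false = fsuc fzero
  unbit : Fin 2 → Bool
  unbit fzero = true
  unbit (fsuc _) = false
  bit-inj : ∀ {a b} → bit a ≡ bit b → a ≡ b
  bit-inj {true} {true} _ = refl
  bit-inj {false} {false} _ = refl
  bit-unbit : ∀ i → bit (unbit i) ≡ i
  bit-unbit fzero = refl
  bit-unbit (fsuc fzero) = refl
  back : ∀ i → Fin.combine (π (sec (proj₁ (Fin.remQuot {m} 2 i)) (unbit (proj₂ (Fin.remQuot {m} 2 i))))) (bit (A (sec (proj₁ (Fin.remQuot {m} 2 i)) (unbit (proj₂ (Fin.remQuot {m} 2 i)))))) ≡ i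
  back i = trans (cong₂ Fin.combine (π-sec _ _) (trans (cong bit (A-sec _ _)) (bit-unbit _))) (FinP.combine-remQuot {m} 2 i)

record Presented (d : ℕ) {n : ℕ} (τ : Tri n) : Set₁ where
  field
    {m}  : ℕ
    {t}  : Trip m
    {z₀} : Fin m
    good : Good t d z₀
    cov  : Cov true τ t

supported : ∀ {n} {p : Fin n → Fin n} {μ : ℕ → ℕ} → HasCycleType p μ → ∀ y → μ (orbitLen p y) ≢ 0
supported {p = p} {μ} ct y e = <-irrefl (sym (trans (ct i) (trans (cong (i *_) e) (trans (*-comm i 0) refl)))) (Count.count-some (λ x → orbitLen p x ≟ i) y refl)
  where
  i : ℕ
  i = orbitLen p y

μ₁-support : ∀ g μ₂ i → μHyp1 g μ₂ i ≢ 0 → i ≡ 2 ⊎ i ≡ 4 * g ∸ 2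
μ₁-support g μ₂ i ne with i ≟ 2 | i ≟ 4 * g ∸ 2
... | yes e | _ = inj₁ e
... | no _ | yes e = inj₂ e
... | no _ | no _ = ⊥-elim (ne refl)

μ₂-support : ∀ g μ₂ i → μHyp2 g μ₂ i ≢ 0 → i ≡ 2 ⊎ i ≡ 2 * g
μ₂-support g μ₂ i ne with i ≟ 2 | i ≟ 2 * g
... | yes e | _ = inj₁ e
... | no _ | yes e = inj₂ e
... | no _ | no _ = ⊥-elim (ne refl)

μ₁-top : ∀ g μ₂ i → i ≡ 4 * g ∸ 2 → i ≢ 2 → μHyp1 g μ₂ i ≡ 1
μ₁-top g μ₂ i e ne with i ≟ 2 | i ≟ 4 * g ∸ 2
... | yes q | _ = ⊥-elim (ne q)
... | no _ | yes _ = refl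
... | no _ | no q = ⊥-elim (q e)

μ₂-top : ∀ g μ₂ i → i ≡ 2 * g → i ≢ 2 → μHyp2 g μ₂ i ≡ 2
μ₂-top g μ₂ i e ne with i ≟ 2 | i ≟ 2 * g
... | yes q | _ = ⊥-elim (ne q)
... | no _ | yes _ = refl
... | no _ | no q = ⊥-elim (q e)

-- With g = 2 + h this is 2g - 1: the involution halves the cycle of length 4g - 2.
d₁ : ℕ → ℕ
d₁ h = 3 + 2 * h

opaque
  present₁ : ∀ h μ₂ {n} (τ : Tri n) → InSTHyp1 (2 + h) μ₂ τ → Presented (d₁ h) τ
  present₁ h μ₂ τ (((ττ , word) , ct , _ , (A , flip)) , α , ((_ , α-τ) , (αα , _) , m , π , ρ , quot , hg)) =
      record { good = proj₂ red ; cov = Q.cov }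
    where
    module Q = Quotient τ ττ word A flip α αα α-τ π ρ quot hg
    N≡ : 4 * (2 + h) ∸ 2 ≡ d₁ h + d₁ h
    N≡ = cong (_∸ 2) (ring h)
      where
      ring : ∀ h → 4 * (2 + h) ≡ 2 + ((3 + 2 * h) + (3 + 2 * h))
      ring = solve-∀
    N≢2 : d₁ h + d₁ h ≢ 2
    N≢2 ()
    kinds : ∀ y → orbitLen (prod τ) y ≡ 2 ⊎ orbitLen (prod τ) y ≡ d₁ h + d₁ h
    kinds y with μ₁-support (2 + h) μ₂ (orbitLen (prod τ) y) (supported ct y)
    ... | inj₁ e = inj₁ e
    ... | inj₂ e = inj₂ (trans e N≡)
    red : Q.Reducible (d₁ h)
    red = Q.reducible-one (d₁ h) (s≤s (s≤s (s≤s z≤n))) kinds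
      (trans (ct (d₁ h + d₁ h)) (trans (cong ((d₁ h + d₁ h) *_) (μ₁-top (2 + h) μ₂ _ (sym N≡) N≢2)) (trans (*-comm _ 1) (+-identityʳ _))))

  present₂ : ∀ h μ₂ {n} (τ : Tri n) → InSTHyp2 (2 + h) μ₂ τ → Presented (2 * (2 + h)) τ
  present₂ h μ₂ τ (((ττ , word) , ct , _ , (A , flip)) , α , ((_ , α-τ) , (αα , _) , m , π , ρ , quot , hg) , exch) =
      record { good = proj₂ red ; cov = Q.cov }
    where
    module Q = Quotient τ ττ word A flip α αα α-τ π ρ quot hg
    d : ℕ
    d = 2 * (2 + h)
    ring : ∀ h → 2 * (2 + h) ≡ 4 + 2 * h
    ring = solve-∀
    N≢2 : d ≢ 2
    N≢2 e with trans (sym (ring h)) e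
    ... | ()
    kinds : ∀ y → orbitLen (prod τ) y ≡ 2 ⊎ orbitLen (prod τ) y ≡ d
    kinds y = μ₂-support (2 + h) μ₂ (orbitLen (prod τ) y) (supported ct y)
    red : Q.Reducible d
    red = Q.reducible-two d (subst (3 ≤_) (sym (ring h)) (s≤s (s≤s (s≤s z≤n)))) kinds
      (trans (ct d) (trans (cong (d *_) (μ₂-top (2 + h) μ₂ d refl N≢2)) (trans (*-comm d 2) (cong (_+_ d) (+-identityʳ d))))) exch

  -- Each surface is within 10d + 3 powers of the canonical form: twice 1 + 3d to reach one strip,
  -- 4d for the segments and 1 for the base point.
  connect-presented : ∀ {n d} {τ τ' : Tri n} → Presented d τ → Presented d τ' → ConnectedWithin (20 * d + 6) τ τ'
  connect-presented {d = d} X Y = go X Y (*-cancelʳ-≡ _ _ 2 (trans (sym (cov-size (Presented.cov X))) (cov-size (Presented.cov Y))))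
    where
    ring : ∀ d → ((1 + d * 3) + (1 + d * 3) + (d * 4 + 1)) + ((1 + d * 3) + (1 + d * 3) + (d * 4 + 1)) ≡ 20 * d + 6
    ring = solve-∀
    go : ∀ {n} {τ τ' : Tri n} (X : Presented d τ) (Y : Presented d τ') → Presented.m X ≡ Presented.m Y → ConnectedWithin (20 * d + 6) τ τ'
    go {τ = τ} {τ'} X Y refl = subst (λ N → ConnectedWithin N τ τ') (ring d) (connect (Presented.good X) (Presented.good Y) (Presented.cov X) (Presented.cov Y))

within-≤ : ∀ {n K L} (τ τ' : Tri n) → K ≤ L → ConnectedWithin K τ τ' → ConnectedWithin L τ τ'
within-≤ _ _ K≤L (k , τ'' , k≤ , s , i) = k , τ'' , ≤-trans k≤ K≤L , s , i

-- The constant is 43 = 20 * 2 + 3: `d` is at most 2g, and the additive 6 is at most 3g because g is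
-- at least 2.
bound : ∀ d g → 2 ≤ g → d ≤ 2 * g → 20 * d + 6 ≤ 43 * g
bound d g 2≤g d≤ = ≤-trans (+-mono-≤ (*-monoʳ-≤ 20 d≤) (*-monoʳ-≤ 3 2≤g)) (≤-reflexive (ring g))
  where
  ring : ∀ g → 20 * (2 * g) + 3 * g ≡ 43 * g
  ring = solve-∀

theorem1p6 : ∃[ C ] 0 < C ×
    (∀ (g μ₂ n : ℕ) → 2 ≤ g → (τ τ' : Tri n) →
    ((InSTHyp1 g μ₂ τ × InSTHyp1 g μ₂ τ') → ConnectedWithin (C * g) τ τ')
    × ((InSTHyp2 g μ₂ τ × InSTHyp2 g μ₂ τ') → ConnectedWithin (C * g) τ τ'))
theorem1p6 = 43 , s≤s z≤n , main
  where
  main : ∀ (g μ₂ n : ℕ) → 2 ≤ g → (τ τ' : Tri n) →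
    ((InSTHyp1 g μ₂ τ × InSTHyp1 g μ₂ τ') → ConnectedWithin (43 * g) τ τ')
    × ((InSTHyp2 g μ₂ τ × InSTHyp2 g μ₂ τ') → ConnectedWithin (43 * g) τ τ')
  main (suc (suc h)) μ₂ n 2≤g@(s≤s (s≤s _)) τ τ' =
    (λ { (X , Y) → within-≤ τ τ' (bound (d₁ h) (2 + h) 2≤g d₁≤) (connect-presented (present₁ h μ₂ τ X) (present₁ h μ₂ τ' Y)) }) ,
    (λ { (X , Y) → within-≤ τ τ' (bound _ (2 + h) 2≤g ≤-refl) (connect-presented (present₂ h μ₂ τ X) (present₂ h μ₂ τ' Y)) })
    where
    ring : ∀ h → 1 + (3 + 2 * h) ≡ 2 * (2 + h)
    ring = solve-∀
    d₁≤ : d₁ h ≤ 2 * (2 + h)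
    d₁≤ = subst (d₁ h ≤_) (ring h) (n≤1+n _)
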